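{- Let $s,t\geq 1$ be integers and let $p,q,l$ be three distinct primes with $p,q$ odd, $p\equiv 3 \pmod 4$, $\mathrm{ord}_{p^s}(l)=\phi(p^s)/2$, $\mathrm{ord}_{q^t}(l)=\phi(q^t)$ and $\gcd(\phi(p^s),\phi(q^t))=2$. Let $0\leq i\leq s-1$ and $0\leq j<j'\leq t$. Then in the ring $\mathbb{F}_l[x]/\langle x^{p^sq^t}-1\rangle$: (i) If $q$ is a quadratic residue modulo $p$, then \[\chi_{ij}\chi_{ij'}^*=\frac{p-3}{4}p^{s-i-1}\phi(q^{t-j'})(\chi_{ij}+\chi_{ij}^*)+\frac{\phi(p^{s-i})}{2}\phi(q^{t-j'})\Big(\sum_{i< k\leq s-1}(\chi_{kj}+\chi_{kj}^*)+\chi_{sj}\Big).\] (ii) If $q$ is a quadratic nonresidue modulo $p$ and $2\nmid j'-j$, then \[\chi_{ij}\chi_{ij'}^*=\frac{p-3}{4}p^{s-i-1}\phi(q^{t-j'})\chi_{ij}+\frac{p+1}{4}p^{s-i-1}\phi(q^{t-j'})\chi_{ij}^*.\] (iii) If $q$ is a quadratic nonresidue modulo $p$ and $2\mid j'-j$, then \[\chi_{ij}\chi_{ij'}^*=\frac{p-3}{4}p^{s-i-1}\phi(q^{t-j'})(\chi_{ij}+\chi_{ij}^*)+\frac{\phi(p^{s-i})}{2}\phi(q^{t-j'})\Big(\sum_{i< k\leq s-1}(\chi_{kj}+\chi_{kj}^*)+\chi_{sj}\Big).\]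
   Context: Here $\phi$ is Euler's phi function (with $\phi(1)=1$) and $\mathrm{ord}_m(k)$ is the multiplicative order of $k$ modulo $m$. Put $n=p^sq^t$. Fix an integer $g$ that is a primitive root both modulo $p^s$ and modulo $q^t$. For an integer $\gamma$, $C_\gamma=\{\gamma l^r \bmod n: r\geq 0\}\subseteq \mathbb{Z}_n$ is the $l$-cyclotomic coset modulo $n$ containing $\gamma$. For $0\leq i\leq s$, $0\leq j\leq t$ set $C_{ij}=C_{p^iq^j}$ and $C_{ij}^*=C_{p^iq^jg}$; in particular $C_{sj}=C_{sj}^*$ and $C_{st}=C_0=\{0\}$. Define elements of $\mathbb{F}_l[x]/\langle x^{n}-1\rangle$ by $\chi_{ij}=\sum_{\alpha\in C_{ij}}x^\alpha$ and $\chi_{ij}^*=\sum_{\alpha\in C_{ij}^*}x^\alpha$; in particular $\chi_{sj}=\chi_{sj}^*$ and $\chi_{st}=1$. Integer coefficients are read in $\mathbb{F}_l$, and empty sums are $0$. -}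

module Defs where

open import Algebra.Bundles using (CommutativeRing)
import Algebra.Definitions.RawMagma as RawMagmaDefs
import Algebra.Properties.Ring as RingProperties
import Algebra.Properties.AbelianGroup as AbelianGroupProperties
import Algebra.Properties.CommutativeSemigroup as CommutativeSemigroupProperties
import Algebra.Properties.Semiring.Exp as Exponentiation
open import Data.Fin.Base using (Fin; toℕ; fromℕ<)
import Data.Fin.Properties as Fin
open import Data.Integer.Base as ℤ using (ℤ; +_)
import Data.Integer.DivMod as ℤ
open import Data.Integer.Divisibility.Signed as ℤ using (divides)
import Data.Integer.Properties as ℤ
open import Data.Integer.Tactic.RingSolver using (solve-∀)
open import Data.List.Base using (List; []; _∷_; map; filter; foldr; length; upTo; allFin)
open import Data.Nat.Base as ℕ using (ℕ; zero; suc; NonZero)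
open import Data.Nat.Coprimality using (Coprime; coprime?)
open import Data.Nat.Induction using (<-rec)
import Data.Nat.Properties as ℕ
open import Data.Product.Base using (_×_; _,_; ∃-syntax)
open import Level using (Level; _⊔_; 0ℓ)
open import Relation.Binary.Bundles using (Setoid)
open import Relation.Binary.PropositionalEquality as ≡ using (_≡_)
open import Relation.Binary.Structures using (IsEquivalence)
open import Relation.Nullary using (¬_; Dec; yes; no)
open import Relation.Nullary.Decidable using (map′)
import Relation.Binary.Reasoning.Setoid as SetoidReasoning

private
  variable
    c ℓ : Level

module _ (R : CommutativeRing c ℓ) (m : CommutativeRing.Carrier R) where

  open CommutativeRing R
  open RawMagmaDefs *-rawMagma using (_∣_; _,_)
  open RingProperties ring using (-‿distribˡ-*; -‿distribʳ-*; x[y-z]≈xy-xz; [y-z]x≈yx-zx)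
  open AbelianGroupProperties +-abelianGroup
    using () renaming (⁻¹-∙-comm to -‿+-comm; ⁻¹-involutive to -‿involutive; ⁻¹-anti-homo-∙ to -‿anti-homo)
  open CommutativeSemigroupProperties +-commutativeSemigroup using (interchange)
  open SetoidReasoning setoid

  private
    infix 4 _≈ₘ_

    _≈ₘ_ : Carrier → Carrier → Set (c ⊔ ℓ)
    x ≈ₘ y = m ∣ (x - y)

    lift : ∀ {x y} → x ≈ y → x ≈ₘ y
    lift {x} {y} x≈y = 0# , (begin
      0# * m  ≈⟨ zeroˡ m ⟩
      0#      ≈⟨ -‿inverseʳ y ⟨
      y - y   ≈⟨ +-congʳ x≈y ⟨
      x - y   ∎)

    telescope : ∀ x y z → (x - y) + (y - z) ≈ x - z
    telescope x y z = begin
      (x - y) + (y - z)    ≈⟨ +-assoc x (- y) (y - z) ⟩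
      x + (- y + (y - z))  ≈⟨ +-congˡ (+-assoc (- y) y (- z)) ⟨
      x + ((- y + y) - z)  ≈⟨ +-congˡ (+-congʳ (-‿inverseˡ y)) ⟩
      x + (0# - z)         ≈⟨ +-congˡ (+-identityˡ (- z)) ⟩
      x - z                ∎

    ≈ₘ-sym : ∀ {x y} → x ≈ₘ y → y ≈ₘ x
    ≈ₘ-sym {x} {y} (a , eq) = - a , (begin
      - a * m      ≈⟨ -‿distribˡ-* a m ⟨
      - (a * m)    ≈⟨ -‿cong eq ⟩
      - (x - y)    ≈⟨ -‿anti-homo x (- y) ⟩
      - - y - x    ≈⟨ +-congʳ (-‿involutive y) ⟩
      y - x        ∎)

    ≈ₘ-trans : ∀ {x y z} → x ≈ₘ y → y ≈ₘ z → x ≈ₘ z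
    ≈ₘ-trans {x} {y} {z} (a , eq) (b , eq′) = a + b , (begin
      (a + b) * m        ≈⟨ distribʳ m a b ⟩
      a * m + b * m      ≈⟨ +-cong eq eq′ ⟩
      (x - y) + (y - z)  ≈⟨ telescope x y z ⟩
      x - z              ∎)

    +-congₘ : ∀ {x y u v} → x ≈ₘ y → u ≈ₘ v → x + u ≈ₘ y + v
    +-congₘ {x} {y} {u} {v} (a , eq) (b , eq′) = a + b , (begin
      (a + b) * m            ≈⟨ distribʳ m a b ⟩
      a * m + b * m          ≈⟨ +-cong eq eq′ ⟩
      (x - y) + (u - v)      ≈⟨ interchange x (- y) u (- v) ⟩
      (x + u) + (- y - v)    ≈⟨ +-congˡ (-‿+-comm y v) ⟩
      (x + u) - (y + v)      ∎)

    -‿congₘ : ∀ {x y} → x ≈ₘ y → - x ≈ₘ - y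
    -‿congₘ {x} {y} (a , eq) = - a , (begin
      - a * m      ≈⟨ -‿distribˡ-* a m ⟨
      - (a * m)    ≈⟨ -‿cong eq ⟩
      - (x - y)    ≈⟨ -‿+-comm x (- y) ⟨
      - x - - y    ∎)

    *-congₘ : ∀ {x y u v} → x ≈ₘ y → u ≈ₘ v → x * u ≈ₘ y * v
    *-congₘ {x} {y} {u} {v} (a , eq) (b , eq′) = a * u + y * b , (begin
      (a * u + y * b) * m                  ≈⟨ distribʳ m (a * u) (y * b) ⟩
      a * u * m + y * b * m                ≈⟨ +-cong (*-assoc a u m) (*-assoc y b m) ⟩
      a * (u * m) + y * (b * m)            ≈⟨ +-cong (*-congˡ (*-comm u m)) (*-congˡ eq′) ⟩
      a * (m * u) + y * (u - v)            ≈⟨ +-congʳ (*-assoc a m u) ⟨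
      a * m * u + y * (u - v)              ≈⟨ +-cong (*-congʳ eq) (x[y-z]≈xy-xz y u v) ⟩
      (x - y) * u + (y * u - y * v)        ≈⟨ +-congʳ ([y-z]x≈yx-zx u x y) ⟩
      (x * u - y * u) + (y * u - y * v)    ≈⟨ telescope (x * u) (y * u) (y * v) ⟩
      x * u - y * v                        ∎)

  infix 8 _/⟨_⟩

  _/⟨_⟩ : CommutativeRing c (c ⊔ ℓ)
  _/⟨_⟩ = record
    { Carrier = Carrier
    ; _≈_ = _≈ₘ_
    ; _+_ = _+_
    ; _*_ = _*_
    ; -_ = -_
    ; 0# = 0#
    ; 1# = 1#
    ; isCommutativeRing = record
      { isRing = record
        { +-isAbelianGroup = record
          { isGroup = record
            { isMonoid = record
              { isSemigroup = record
                { isMagma = record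
                  { isEquivalence = record
                    { refl = lift refl ; sym = ≈ₘ-sym ; trans = ≈ₘ-trans }
                  ; ∙-cong = +-congₘ
                  }
                ; assoc = λ x y z → lift (+-assoc x y z)
                }
              ; identity = (λ x → lift (+-identityˡ x)) , (λ x → lift (+-identityʳ x))
              }
            ; inverse = (λ x → lift (-‿inverseˡ x)) , (λ x → lift (-‿inverseʳ x))
            ; ⁻¹-cong = -‿congₘ
            }
          ; comm = λ x y → lift (+-comm x y)
          }
        ; *-cong = *-congₘ
        ; *-assoc = λ x y z → lift (*-assoc x y z)
        ; *-identity = (λ x → lift (*-identityˡ x)) , (λ x → lift (*-identityʳ x))
        ; distrib = (λ x y z → lift (distribˡ x y z)) , (λ x y z → lift (distribʳ x y z))
        }
      ; *-comm = λ x y → lift (*-comm x y)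
      }
    }

-- Coefficient lists, lowest degree first.  Trailing zeros are allowed, so
-- polynomials are compared coefficientwise.

module Polynomial (R : CommutativeRing c ℓ) where

  open CommutativeRing R
  open RingProperties ring using (-0#≈0#)
  open CommutativeSemigroupProperties +-commutativeSemigroup using (interchange; x∙yz≈y∙xz)

  Poly : Set c
  Poly = List Carrier

  coeff : Poly → ℕ → Carrier
  coeff []      _       = 0#
  coeff (a ∷ f) zero    = a
  coeff (a ∷ f) (suc k) = coeff f k

  infix  4 _≋_
  infixl 6 _⊕_
  infixl 7 _⊗_ _⊙_

  -- A record rather than a function type, so that the polynomials compared
  -- can be inferred from a proof.
  record _≋_ (f g : Poly) : Set ℓ where
    constructor mk≋
    field coeff-≈ : ∀ k → coeff f k ≈ coeff g k
  open _≋_ public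

  _⊕_ : Poly → Poly → Poly
  []      ⊕ g       = g
  (a ∷ f) ⊕ []      = a ∷ f
  (a ∷ f) ⊕ (b ∷ g) = a + b ∷ f ⊕ g

  ⊝_ : Poly → Poly
  ⊝ f = map (λ a → - a) f

  _⊙_ : Carrier → Poly → Poly
  a ⊙ f = map (a *_) f

  _⊗_ : Poly → Poly → Poly
  []      ⊗ g = []
  (a ∷ f) ⊗ g = a ⊙ g ⊕ (0# ∷ f ⊗ g)

  const : Carrier → Poly
  const a = a ∷ []

  X : Poly
  X = 0# ∷ 1# ∷ []

  coeff-⊕ : ∀ f g k → coeff (f ⊕ g) k ≈ coeff f k + coeff g k
  coeff-⊕ []      g       k       = sym (+-identityˡ _)
  coeff-⊕ (a ∷ f) []      k       = sym (+-identityʳ _)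
  coeff-⊕ (a ∷ f) (b ∷ g) zero    = refl
  coeff-⊕ (a ∷ f) (b ∷ g) (suc k) = coeff-⊕ f g k

  coeff-⊝ : ∀ f k → coeff (⊝ f) k ≈ - coeff f k
  coeff-⊝ []      k       = sym -0#≈0#
  coeff-⊝ (a ∷ f) zero    = refl
  coeff-⊝ (a ∷ f) (suc k) = coeff-⊝ f k

  coeff-⊙ : ∀ a f k → coeff (a ⊙ f) k ≈ a * coeff f k
  coeff-⊙ a []      k       = sym (zeroʳ a)
  coeff-⊙ a (b ∷ f) zero    = refl
  coeff-⊙ a (b ∷ f) (suc k) = coeff-⊙ a f k

  private
    ≋-isEquivalence : IsEquivalence _≋_
    ≋-isEquivalence = record
      { refl  = mk≋ λ _ → refl
      ; sym   = λ p → mk≋ λ k → sym (coeff-≈ p k)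
      ; trans = λ p q → mk≋ λ k → trans (coeff-≈ p k) (coeff-≈ q k)
      }

    open IsEquivalence ≋-isEquivalence
      renaming (refl to ≋-refl; sym to ≋-sym; trans to ≋-trans)

    ≋-setoid : Setoid c ℓ
    ≋-setoid = record { isEquivalence = ≋-isEquivalence }

    open SetoidReasoning ≋-setoid

    ∷-cong : ∀ {a b f g} → a ≈ b → f ≋ g → a ∷ f ≋ b ∷ g
    ∷-cong p q = mk≋ λ { zero → p ; (suc k) → coeff-≈ q k }

    ⊕-cong : ∀ {f f′ g g′} → f ≋ f′ → g ≋ g′ → f ⊕ g ≋ f′ ⊕ g′
    ⊕-cong {f} {f′} {g} {g′} p q = mk≋ λ k →
      trans (coeff-⊕ f g k) (trans (+-cong (coeff-≈ p k) (coeff-≈ q k)) (sym (coeff-⊕ f′ g′ k)))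

    ⊕-assoc : ∀ f g h → (f ⊕ g) ⊕ h ≋ f ⊕ (g ⊕ h)
    ⊕-assoc f g h = mk≋ λ k →
      trans (coeff-⊕ (f ⊕ g) h k) (trans (+-congʳ (coeff-⊕ f g k)) (trans (+-assoc _ _ _)
      (sym (trans (coeff-⊕ f (g ⊕ h) k) (+-congˡ (coeff-⊕ g h k))))))

    ⊕-comm : ∀ f g → f ⊕ g ≋ g ⊕ f
    ⊕-comm f g = mk≋ λ k →
      trans (coeff-⊕ f g k) (trans (+-comm _ _) (sym (coeff-⊕ g f k)))

    ⊕-identityʳ : ∀ f → f ⊕ [] ≋ f
    ⊕-identityʳ f = ⊕-comm f []

    ⊕-interchange : ∀ f g h i → (f ⊕ g) ⊕ (h ⊕ i) ≋ (f ⊕ h) ⊕ (g ⊕ i)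
    ⊕-interchange f g h i = mk≋ λ k →
      trans (coeff-⊕ (f ⊕ g) (h ⊕ i) k) (trans (+-cong (coeff-⊕ f g k) (coeff-⊕ h i k))
      (trans (interchange _ _ _ _)
      (sym (trans (coeff-⊕ (f ⊕ h) (g ⊕ i) k) (+-cong (coeff-⊕ f h k) (coeff-⊕ g i k))))))

    ⊕-xyz : ∀ f g h → f ⊕ (g ⊕ h) ≋ g ⊕ (f ⊕ h)
    ⊕-xyz f g h = mk≋ λ k →
      trans (coeff-⊕ f (g ⊕ h) k) (trans (+-congˡ (coeff-⊕ g h k)) (trans (x∙yz≈y∙xz _ _ _)
      (sym (trans (coeff-⊕ g (f ⊕ h) k) (+-congˡ (coeff-⊕ f h k))))))

    ⊝-cong : ∀ {f g} → f ≋ g → ⊝ f ≋ ⊝ g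
    ⊝-cong {f} {g} p = mk≋ λ k →
      trans (coeff-⊝ f k) (trans (-‿cong (coeff-≈ p k)) (sym (coeff-⊝ g k)))

    ⊝-inverseʳ : ∀ f → f ⊕ ⊝ f ≋ []
    ⊝-inverseʳ f = mk≋ λ k →
      trans (coeff-⊕ f (⊝ f) k) (trans (+-congˡ (coeff-⊝ f k)) (-‿inverseʳ _))

    ⊙-cong : ∀ {a b f g} → a ≈ b → f ≋ g → a ⊙ f ≋ b ⊙ g
    ⊙-cong {a} {b} {f} {g} p q = mk≋ λ k →
      trans (coeff-⊙ a f k) (trans (*-cong p (coeff-≈ q k)) (sym (coeff-⊙ b g k)))

    ⊙-distribˡ : ∀ a f g → a ⊙ (f ⊕ g) ≋ a ⊙ f ⊕ a ⊙ g
    ⊙-distribˡ a f g = mk≋ λ k →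
      trans (coeff-⊙ a (f ⊕ g) k) (trans (*-congˡ (coeff-⊕ f g k)) (trans (distribˡ a _ _)
      (sym (trans (coeff-⊕ (a ⊙ f) (a ⊙ g) k) (+-cong (coeff-⊙ a f k) (coeff-⊙ a g k))))))

    ⊙-distribʳ : ∀ a b f → (a + b) ⊙ f ≋ a ⊙ f ⊕ b ⊙ f
    ⊙-distribʳ a b f = mk≋ λ k →
      trans (coeff-⊙ (a + b) f k) (trans (distribʳ _ a b)
      (sym (trans (coeff-⊕ (a ⊙ f) (b ⊙ f) k) (+-cong (coeff-⊙ a f k) (coeff-⊙ b f k)))))

    ⊙-assoc : ∀ a b f → (a * b) ⊙ f ≋ a ⊙ (b ⊙ f)
    ⊙-assoc a b f = mk≋ λ k →
      trans (coeff-⊙ (a * b) f k) (trans (*-assoc a b _)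
      (sym (trans (coeff-⊙ a (b ⊙ f) k) (*-congˡ (coeff-⊙ b f k)))))

    ⊙-identity : ∀ f → 1# ⊙ f ≋ f
    ⊙-identity f = mk≋ λ k → trans (coeff-⊙ 1# f k) (*-identityˡ _)

    ⊙-zero : ∀ f → 0# ⊙ f ≋ []
    ⊙-zero f = mk≋ λ k → trans (coeff-⊙ 0# f k) (zeroˡ _)

    0∷[]≋[] : 0# ∷ [] ≋ []
    0∷[]≋[] = mk≋ λ { zero → refl ; (suc k) → refl }

    0∷-⊕ : ∀ f g → 0# ∷ (f ⊕ g) ≋ (0# ∷ f) ⊕ (0# ∷ g)
    0∷-⊕ f g = ∷-cong (sym (+-identityˡ 0#)) ≋-refl

    0∷-⊗ : ∀ f g → (0# ∷ f) ⊗ g ≋ 0# ∷ (f ⊗ g)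
    0∷-⊗ f g = ⊕-cong (⊙-zero g) ≋-refl

    ⊙-0∷ : ∀ a f → a ⊙ (0# ∷ f) ≋ 0# ∷ (a ⊙ f)
    ⊙-0∷ a f = ∷-cong (zeroʳ a) ≋-refl

    ⊗-zeroʳ : ∀ f → f ⊗ [] ≋ []
    ⊗-zeroʳ []      = ≋-refl
    ⊗-zeroʳ (a ∷ f) = ≋-trans (∷-cong refl (⊗-zeroʳ f)) 0∷[]≋[]

    ⊗-congˡ : ∀ f {g g′} → g ≋ g′ → f ⊗ g ≋ f ⊗ g′
    ⊗-congˡ []      p = ≋-refl
    ⊗-congˡ (a ∷ f) p = ⊕-cong (⊙-cong refl p) (∷-cong refl (⊗-congˡ f p))

    ⊗-∷ʳ : ∀ f b g → f ⊗ (b ∷ g) ≋ b ⊙ f ⊕ (0# ∷ f ⊗ g)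
    ⊗-∷ʳ []      b g = ≋-sym 0∷[]≋[]
    ⊗-∷ʳ (a ∷ f) b g = ∷-cong (+-congʳ (*-comm a b)) (begin
      a ⊙ g ⊕ f ⊗ (b ∷ g)              ≈⟨ ⊕-cong ≋-refl (⊗-∷ʳ f b g) ⟩
      a ⊙ g ⊕ (b ⊙ f ⊕ (0# ∷ f ⊗ g))   ≈⟨ ⊕-xyz (a ⊙ g) (b ⊙ f) (0# ∷ f ⊗ g) ⟩
      b ⊙ f ⊕ (a ∷ f) ⊗ g              ∎)

    ⊗-comm : ∀ f g → f ⊗ g ≋ g ⊗ f
    ⊗-comm []      g = ≋-sym (⊗-zeroʳ g)
    ⊗-comm (a ∷ f) g = begin
      a ⊙ g ⊕ (0# ∷ f ⊗ g)  ≈⟨ ⊕-cong ≋-refl (∷-cong refl (⊗-comm f g)) ⟩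
      a ⊙ g ⊕ (0# ∷ g ⊗ f)  ≈⟨ ⊗-∷ʳ g a f ⟨
      g ⊗ (a ∷ f)           ∎

    ⊗-cong : ∀ {f f′ g g′} → f ≋ f′ → g ≋ g′ → f ⊗ g ≋ f′ ⊗ g′
    ⊗-cong {f} {f′} {g} {g′} p q = begin
      f ⊗ g    ≈⟨ ⊗-congˡ f q ⟩
      f ⊗ g′   ≈⟨ ⊗-comm f g′ ⟩
      g′ ⊗ f   ≈⟨ ⊗-congˡ g′ p ⟩
      g′ ⊗ f′  ≈⟨ ⊗-comm g′ f′ ⟩
      f′ ⊗ g′  ∎

    ⊗-distribʳ : ∀ h f g → (f ⊕ g) ⊗ h ≋ f ⊗ h ⊕ g ⊗ h
    ⊗-distribʳ h []      g       = ≋-refl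
    ⊗-distribʳ h (a ∷ f) []      = ≋-sym (⊕-identityʳ _)
    ⊗-distribʳ h (a ∷ f) (b ∷ g) = begin
      (a + b) ⊙ h ⊕ (0# ∷ (f ⊕ g) ⊗ h)
        ≈⟨ ⊕-cong (⊙-distribʳ a b h)
             (≋-trans (∷-cong refl (⊗-distribʳ h f g)) (0∷-⊕ (f ⊗ h) (g ⊗ h))) ⟩
      (a ⊙ h ⊕ b ⊙ h) ⊕ ((0# ∷ f ⊗ h) ⊕ (0# ∷ g ⊗ h))
        ≈⟨ ⊕-interchange (a ⊙ h) (b ⊙ h) (0# ∷ f ⊗ h) (0# ∷ g ⊗ h) ⟩
      (a ∷ f) ⊗ h ⊕ (b ∷ g) ⊗ h ∎

    ⊗-distribˡ : ∀ h f g → h ⊗ (f ⊕ g) ≋ h ⊗ f ⊕ h ⊗ g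
    ⊗-distribˡ h f g = begin
      h ⊗ (f ⊕ g)    ≈⟨ ⊗-comm h (f ⊕ g) ⟩
      (f ⊕ g) ⊗ h    ≈⟨ ⊗-distribʳ h f g ⟩
      f ⊗ h ⊕ g ⊗ h  ≈⟨ ⊕-cong (⊗-comm f h) (⊗-comm g h) ⟩
      h ⊗ f ⊕ h ⊗ g  ∎

    ⊙-⊗ : ∀ a f g → (a ⊙ f) ⊗ g ≋ a ⊙ (f ⊗ g)
    ⊙-⊗ a []      g = ≋-refl
    ⊙-⊗ a (b ∷ f) g = begin
      (a * b) ⊙ g ⊕ (0# ∷ (a ⊙ f) ⊗ g)   ≈⟨ ⊕-cong (⊙-assoc a b g) (∷-cong refl (⊙-⊗ a f g)) ⟩
      a ⊙ (b ⊙ g) ⊕ (0# ∷ a ⊙ (f ⊗ g))   ≈⟨ ⊕-cong ≋-refl (⊙-0∷ a (f ⊗ g)) ⟨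
      a ⊙ (b ⊙ g) ⊕ a ⊙ (0# ∷ f ⊗ g)     ≈⟨ ⊙-distribˡ a (b ⊙ g) (0# ∷ f ⊗ g) ⟨
      a ⊙ ((b ∷ f) ⊗ g)                  ∎

    ⊗-assoc : ∀ f g h → (f ⊗ g) ⊗ h ≋ f ⊗ (g ⊗ h)
    ⊗-assoc []      g h = ≋-refl
    ⊗-assoc (a ∷ f) g h = begin
      (a ⊙ g ⊕ (0# ∷ f ⊗ g)) ⊗ h          ≈⟨ ⊗-distribʳ h (a ⊙ g) (0# ∷ f ⊗ g) ⟩
      (a ⊙ g) ⊗ h ⊕ (0# ∷ f ⊗ g) ⊗ h      ≈⟨ ⊕-cong (⊙-⊗ a g h) (0∷-⊗ (f ⊗ g) h) ⟩
      a ⊙ (g ⊗ h) ⊕ (0# ∷ (f ⊗ g) ⊗ h)    ≈⟨ ⊕-cong ≋-refl (∷-cong refl (⊗-assoc f g h)) ⟩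
      (a ∷ f) ⊗ (g ⊗ h)                   ∎

    ⊗-identityˡ : ∀ f → const 1# ⊗ f ≋ f
    ⊗-identityˡ f = begin
      1# ⊙ f ⊕ (0# ∷ [])  ≈⟨ ⊕-cong (⊙-identity f) 0∷[]≋[] ⟩
      f ⊕ []              ≈⟨ ⊕-identityʳ f ⟩
      f                   ∎

  polynomialRing : CommutativeRing c ℓ
  polynomialRing = record
    { Carrier = Poly
    ; _≈_ = _≋_
    ; _+_ = _⊕_
    ; _*_ = _⊗_
    ; -_ = ⊝_
    ; 0# = []
    ; 1# = const 1#
    ; isCommutativeRing = record
      { isRing = record
        { +-isAbelianGroup = record
          { isGroup = record
            { isMonoid = record
              { isSemigroup = record
                { isMagma = record { isEquivalence = ≋-isEquivalence ; ∙-cong = ⊕-cong }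
                ; assoc = ⊕-assoc
                }
              ; identity = (λ f → ≋-refl) , ⊕-identityʳ
              }
            ; inverse = (λ f → ≋-trans (⊕-comm (⊝ f) f) (⊝-inverseʳ f)) , ⊝-inverseʳ
            ; ⁻¹-cong = ⊝-cong
            }
          ; comm = ⊕-comm
          }
        ; *-cong = ⊗-cong
        ; *-assoc = ⊗-assoc
        ; *-identity = ⊗-identityˡ , (λ f → ≋-trans (⊗-comm f (const 1#)) (⊗-identityˡ f))
        ; distrib = ⊗-distribˡ , ⊗-distribʳ
        }
      ; *-comm = ⊗-comm
      }
    }

infix 4 _≡_[mod_]

_≡_[mod_] : ℤ → ℤ → ℕ → Set
a ≡ b [mod m ] = + m ℤ.∣ a ℤ.- b

φ : ℕ → ℕ
φ m = length (filter (λ k → coprime? k m) (map suc (upTo m)))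

-- IsOrder m k d reads ord_m(k) = d.
IsOrder : ℕ → ℤ → ℕ → Set
IsOrder m k d =
  1 ℕ.≤ d × k ℤ.^ d ≡ + 1 [mod m ] × (∀ e → 1 ℕ.≤ e → k ℤ.^ e ≡ + 1 [mod m ] → d ℕ.≤ e)

PrimitiveRoot : ℕ → ℤ → Set
PrimitiveRoot m g = IsOrder m g (φ m)

QuadraticResidue QuadraticNonresidue : ℕ → ℕ → Set
QuadraticResidue    a m = Coprime a m × (∃[ x ] x ℤ.* x ≡ + a [mod m ])
QuadraticNonresidue a m = Coprime a m × ¬ (∃[ x ] x ℤ.* x ≡ + a [mod m ])

module Coset (l n : ℕ) where

  -- Fin n stands for ℤ_n, so α = γ lʳ mod n becomes a congruence.
  _∈C[_] : Fin n → ℤ → Set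
  α ∈C[ γ ] = ∃[ r ] + toℕ α ≡ γ ℤ.* (+ l) ℤ.^ r [mod n ]

  private
    mod-trans : ∀ a b c → a ≡ b [mod n ] → b ≡ c [mod n ] → a ≡ c [mod n ]
    mod-trans a b c p q =
      ≡.subst (+ n ℤ.∣_) (lemma a b c) (ℤ.∣m∣n⇒∣m+n p q)
      where
      lemma : ∀ a b c → (a ℤ.- b) ℤ.+ (b ℤ.- c) ≡ a ℤ.- c
      lemma = solve-∀

    mod-*ʳ : ∀ a b c → a ≡ b [mod n ] → a ℤ.* c ≡ b ℤ.* c [mod n ]
    mod-*ʳ a b c p = ≡.subst (+ n ℤ.∣_) (lemma a b c) (ℤ.∣m⇒∣m*n c p)
      where
      lemma : ∀ a b c → (a ℤ.- b) ℤ.* c ≡ a ℤ.* c ℤ.- b ℤ.* c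
      lemma = solve-∀

    mod-%≡ : .{{_ : NonZero n}} → ∀ a b → a ℤ.%ℕ n ≡ b ℤ.%ℕ n → a ≡ b [mod n ]
    mod-%≡ a b eq = divides (a ℤ./ℕ n ℤ.- b ℤ./ℕ n) (≡.trans
      (≡.cong₂ ℤ._-_
        (≡.trans (ℤ.a≡a%ℕn+[a/ℕn]*n a n)
          (≡.cong (λ z → + z ℤ.+ a ℤ./ℕ n ℤ.* + n) eq))
        (ℤ.a≡a%ℕn+[a/ℕn]*n b n))
      (lemma (+ (b ℤ.%ℕ n)) (a ℤ./ℕ n) (b ℤ./ℕ n) (+ n)))
      where
      lemma : ∀ r x y m → (r ℤ.+ x ℤ.* m) ℤ.- (r ℤ.+ y ℤ.* m) ≡ (x ℤ.- y) ℤ.* m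
      lemma = solve-∀

    pow : ℤ → ℕ → ℤ
    pow γ r = γ ℤ.* (+ l) ℤ.^ r

    pow-+ : ∀ γ a b → pow γ (a ℕ.+ b) ≡ pow γ a ℤ.* (+ l) ℤ.^ b
    pow-+ γ a b = ≡.trans (≡.cong (γ ℤ.*_) (ℤ.^-distribˡ-+-* (+ l) a b))
                          (≡.sym (ℤ.*-assoc γ _ _))

    collision : .{{_ : NonZero n}} → ∀ γ →
                ∃[ a ] ∃[ b ] (a ℕ.< b × b ℕ.≤ n × pow γ b ≡ pow γ a [mod n ])
    collision γ =
      let residue : Fin (suc n) → Fin n
          residue r = fromℕ< (ℤ.n%ℕd<d (pow γ (toℕ r)) n)
          a , b , a<b , eq = Fin.pigeonhole (ℕ.n<1+n n) residue
          eq′ = ≡.trans (≡.sym (Fin.toℕ-fromℕ< _)) (≡.trans (≡.cong toℕ (≡.sym eq)) (Fin.toℕ-fromℕ< _))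
      in toℕ a , toℕ b , a<b , ℕ.≤-pred (Fin.toℕ<n b) , mod-%≡ (pow γ (toℕ b)) (pow γ (toℕ a)) eq′

    bound : .{{_ : NonZero n}} → ∀ α γ r → α ≡ pow γ r [mod n ] →
            ∃[ i ] α ≡ pow γ (toℕ {n} i) [mod n ]
    bound α γ = <-rec _ (λ r rec p → step r rec p (r ℕ.<? n) (collision γ))
      where
      Bounded : Set
      Bounded = ∃[ i ] α ≡ pow γ (toℕ {n} i) [mod n ]

      step : ∀ r → (∀ {r′} → r′ ℕ.< r → α ≡ pow γ r′ [mod n ] → Bounded) →
             α ≡ pow γ r [mod n ] → Dec (r ℕ.< n) →
             ∃[ a ] ∃[ b ] (a ℕ.< b × b ℕ.≤ n × pow γ b ≡ pow γ a [mod n ]) →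
             Bounded
      step r rec p (yes r<n) _ =
        fromℕ< r<n ,
        ≡.subst (λ k → α ≡ pow γ k [mod n ]) (≡.sym (Fin.toℕ-fromℕ< r<n)) p
      step r rec p (no r≮n) (a , b , a<b , b≤n , b≡a) =
        rec r′<r (mod-trans α (pow γ r) (pow γ (a ℕ.+ d)) p r≡r′)
        where
        d = r ℕ.∸ b
        b+d≡r : b ℕ.+ d ≡ r
        b+d≡r = ℕ.m+[n∸m]≡n (ℕ.≤-trans b≤n (ℕ.≮⇒≥ r≮n))
        r′<r : a ℕ.+ d ℕ.< r
        r′<r = ≡.subst (a ℕ.+ d ℕ.<_) b+d≡r (ℕ.+-monoˡ-< d a<b)
        r≡r′ : pow γ r ≡ pow γ (a ℕ.+ d) [mod n ]
        r≡r′ = ≡.subst₂ (λ u v → u ≡ v [mod n ])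
          (≡.trans (≡.sym (pow-+ γ b d)) (≡.cong (pow γ) b+d≡r))
          (≡.sym (pow-+ γ a d))
          (mod-*ʳ (pow γ b) (pow γ a) ((+ l) ℤ.^ d) b≡a)

  -- By pigeonhole every element of C_γ already occurs as γ lʳ with r < n.
  _∈C[_]? : ∀ α γ → Dec (α ∈C[ γ ])
  α ∈C[ γ ]? = map′ (λ (i , p) → toℕ i , p) (λ (r , p) → bound (+ toℕ α) γ r p)
    (Fin.any? (λ i → + n ℤ.∣? (+ toℕ α ℤ.- pow γ (toℕ i))))
    where
    instance
      n≢0 : NonZero n
      n≢0 = Fin.nonZeroIndex α

-- 𝔽 l is ℤ with congruence modulo l as its equality, so an integer is
-- its own image in 𝔽 l.
𝔽 : ℕ → CommutativeRing 0ℓ 0ℓ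
𝔽 l = ℤ.+-*-commutativeRing /⟨ + l ⟩

module CosetSums (p q s t l : ℕ) (g : ℤ) where

  n : ℕ
  n = p ℕ.^ s ℕ.* q ℕ.^ t

  private
    module F  = Polynomial (𝔽 l)
    module Fx = CommutativeRing F.polynomialRing
    open Exponentiation Fx.semiring using () renaming (_^_ to _^ₓ_)

  open Coset l n public

  𝔽[x]/⟨xⁿ-1⟩ : CommutativeRing 0ℓ 0ℓ
  𝔽[x]/⟨xⁿ-1⟩ = F.polynomialRing /⟨ F.X ^ₓ n Fx.- Fx.1# ⟩

  open CommutativeRing 𝔽[x]/⟨xⁿ-1⟩ public
    using (Carrier; _≈_) renaming (_+_ to infixl 6 _⊞_; _*_ to infixl 7 _⊠_)
  open CommutativeRing 𝔽[x]/⟨xⁿ-1⟩ using (0#; semiring)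
  open Exponentiation semiring using (_^_)

  ∑ : {A : Set} → List A → (A → Carrier) → Carrier
  ∑ as f = foldr (λ a acc → f a ⊞ acc) 0# as

  infixr 8 _·_

  _·_ : ℕ → Carrier → Carrier
  k · f = F.const (+ k) ⊠ f

  cosetSum : ℤ → Carrier
  cosetSum γ = ∑ (filter (_∈C[ γ ]?) (allFin n)) (λ α → F.X ^ toℕ α)

  χ χ* : ℕ → ℕ → Carrier
  χ  i j = cosetSum (+ (p ℕ.^ i ℕ.* q ℕ.^ j))
  χ* i j = cosetSum (+ (p ℕ.^ i ℕ.* q ℕ.^ j) ℤ.* g)

  ∑[_<k<_] : ℕ → ℕ → (ℕ → Carrier) → Carrier
  ∑[ a <k< b ] = ∑ (filter (a ℕ.<?_) (upTo b))

{-# OPTIONS --safe #-}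
module Submission where

-- Writing ℤ/n as ℤ/pˢ × ℤ/qᵗ, the coset of pⁱqʲ is a product.  Its factor modulo qᵗ
-- consists of all elements exactly divisible by qʲ, because l is a primitive root there.
-- Modulo pˢ the powers of l form a subgroup of index two and odd order h, so -l is a
-- primitive root, every unit is ± a power of l, and the sign is the quadratic character, which depends only on the
-- residue modulo p.  Since -1 and g are nonresidues, the starred coset is the negative of the
-- unstarred one modulo pˢ, and the sign of qʲ decides which of the two classes occurs.
-- The product of two coset sums is the convolution of their indicator functions, which
-- factors over p and q.  At q the set of larger level j' acts by translations preserving
-- level j.  At p, with w the indicator of the class of pⁱ, the function
-- D c = Σₐ w a w (a - c) is even and invariant under multiplication by l, hence constant on
-- the elements exactly divisible by pⁱ; the constant follows from Σ_c D c = (Σ w)².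
-- The convolution w ⋆ w is obtained from D because w a + w (- a) indicates exact
-- divisibility by pⁱ.

open import Defs
open import Algebra.Bundles using (CommutativeRing)
open import Data.Integer.Base using (ℤ; +_)
open import Data.Nat.Base as ℕ using (ℕ; zero; suc; NonZero; s≤s; _<_; _≤_)
open import Data.Nat.Coprimality using (Coprime)
open import Data.Nat.Primality using (Prime; prime⇒nonZero; prime⇒irreducible; ¬prime[1]; prime[2])
open import Relation.Binary.PropositionalEquality using (_≡_; _≢_)

-- The condition p ≡ 3 modulo 4 acts through the oddness of h. It keeps -1 out of the powers of l,
-- so that the even function D takes a single value on both classes. It also turns gcd(2h, φ(qᵗ)) =
-- 2 into coprimality of h and φ(qᵗ), which lets the exponents of l be chosen independently modulo
-- pˢ and qᵗ and so makes a coset a product.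
--
-- Write p = 3 + 4k and P = p^(s-i-1). A class of level i has H = (1 + 2k)P elements modulo pˢ. If d
-- is the value of D on exact multiples of pⁱ, summing D gives H² = 2dH + PH, hence d = kP; w ⋆ w
-- has the value d on the class and d + P = (k + 1)P on its negative. These are the origin of (p -
-- 3)/4 and (p + 1)/4. Cancelling H and 2 is the obstacle to working in 𝔽 l, where either can
-- vanish; all counts are therefore made over ℤ and only then mapped to the quotient ring.
--
-- With ε the quadratic character of q, the coset of pⁱqʲ has sign εʲ modulo pˢ, and that of pⁱqʲ′g
-- has sign -εʲ′. So equal powers of ε lead to D, opposite powers to w ⋆ w, and only the parity of
-- j′ - j matters for a nonresidue q.

-- Congruences between integers

module Congruences where

  open import Data.Integer.Base hiding (NonZero)
  open import Data.Integer.DivMod using (_%ℕ_; _/ℕ_; a≡a%ℕn+[a/ℕn]*n; n%ℕd<d)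
  open import Data.Integer.Divisibility.Signed
  open import Data.Integer.Properties
  open import Data.Integer.Tactic.RingSolver using (solve-∀)
  open import Data.Nat.Base as ℕ using (ℕ; zero; suc; NonZero)
  import Data.Nat.Divisibility as ℕ
  import Data.Nat.Properties as ℕ
  open import Data.Sum.Base using (inj₁; inj₂)
  open import Relation.Binary.Bundles using (Setoid)
  open import Relation.Binary.PropositionalEquality
  open import Relation.Nullary using (contradiction)

  infix 4 _~_⟨_⟩

  -- A record, so that the two sides can be inferred from a proof.
  record _~_⟨_⟩ (a b : ℤ) (m : ℕ) : Set where
    constructor mk~
    field ∣-difference : a ≡ b [mod m ]
  open _~_⟨_⟩ public

  private variable
    a b c d : ℤ
    k m : ℕ

  ~-reflexive : a ≡ b → a ~ b ⟨ m ⟩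
  ~-reflexive {a} refl = mk~ (divides 0ℤ (i≡j⇒i-j≡0 {a} refl))

  ~-refl : a ~ a ⟨ m ⟩
  ~-refl = ~-reflexive refl

  ~-sym : a ~ b ⟨ m ⟩ → b ~ a ⟨ m ⟩
  ~-sym {a} {b} (mk~ p) = mk~ (subst (_ ∣_) (lemma a b) (∣m⇒∣-m p))
    where
    lemma : ∀ a b → - (a - b) ≡ b - a
    lemma = solve-∀

  ~-trans : a ~ b ⟨ m ⟩ → b ~ c ⟨ m ⟩ → a ~ c ⟨ m ⟩
  ~-trans {a} {b} {_} {c} (mk~ p) (mk~ q) = mk~ (subst (_ ∣_) (lemma a b c) (∣m∣n⇒∣m+n p q))
    where
    lemma : ∀ a b c → (a - b) + (b - c) ≡ a - c
    lemma = solve-∀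

  ~-setoid : ℕ → Setoid _ _
  ~-setoid m = record
    { _≈_ = _~_⟨ m ⟩
    ; isEquivalence = record { refl = ~-refl ; sym = ~-sym ; trans = ~-trans }
    }

  +-cong~ : a ~ b ⟨ m ⟩ → c ~ d ⟨ m ⟩ → a + c ~ b + d ⟨ m ⟩
  +-cong~ {a} {b} {_} {c} {d} (mk~ p) (mk~ q) = mk~ (subst (_ ∣_) (lemma a b c d) (∣m∣n⇒∣m+n p q))
    where
    lemma : ∀ a b c d → (a - b) + (c - d) ≡ (a + c) - (b + d)
    lemma = solve-∀

  *-cong~ : a ~ b ⟨ m ⟩ → c ~ d ⟨ m ⟩ → a * c ~ b * d ⟨ m ⟩
  *-cong~ {a} {b} {_} {c} {d} (mk~ p) (mk~ q) =
    mk~ (subst (_ ∣_) (lemma a b c d) (∣m∣n⇒∣m+n (∣m⇒∣m*n c p) (∣n⇒∣m*n b q)))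
    where
    lemma : ∀ a b c d → (a - b) * c + b * (c - d) ≡ a * c - b * d
    lemma = solve-∀

  *-congˡ~ : ∀ c → a ~ b ⟨ m ⟩ → c * a ~ c * b ⟨ m ⟩
  *-congˡ~ c = *-cong~ (~-refl {c})

  *-congʳ~ : ∀ c → a ~ b ⟨ m ⟩ → a * c ~ b * c ⟨ m ⟩
  *-congʳ~ c p = *-cong~ p (~-refl {c})

  -‿cong~ : a ~ b ⟨ m ⟩ → - a ~ - b ⟨ m ⟩
  -‿cong~ {a} {b} (mk~ p) = mk~ (subst (_ ∣_) (lemma a b) (∣m⇒∣-m p))
    where
    lemma : ∀ a b → - (a - b) ≡ - a - - b
    lemma = solve-∀

  ∸-cong~ : a ~ b ⟨ m ⟩ → c ~ d ⟨ m ⟩ → a - c ~ b - d ⟨ m ⟩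
  ∸-cong~ p q = +-cong~ p (-‿cong~ q)

  ^-cong~ : ∀ e → a ~ b ⟨ m ⟩ → a ^ e ~ b ^ e ⟨ m ⟩
  ^-cong~ zero    p = ~-refl
  ^-cong~ (suc e) p = *-cong~ p (^-cong~ e p)

  ~-weaken : k ℕ.∣ m → a ~ b ⟨ m ⟩ → a ~ b ⟨ k ⟩
  ~-weaken k∣m (mk~ p) = mk~ (∣-trans (∣ᵤ⇒∣ k∣m) p)

  ~0⇒∣ : a ~ 0ℤ ⟨ m ⟩ → + m ∣ a
  ~0⇒∣ {a} (mk~ p) = subst (_ ∣_) (+-identityʳ a) p

  ∣⇒~0 : + m ∣ a → a ~ 0ℤ ⟨ m ⟩
  ∣⇒~0 {_} {a} p = mk~ (subst (_ ∣_) (sym (+-identityʳ a)) p)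

  ∣-resp-~ : a ~ b ⟨ m ⟩ → + m ∣ a → + m ∣ b
  ∣-resp-~ p d = ~0⇒∣ (~-trans (~-sym p) (∣⇒~0 d))

  -- The modulus loses the same factor, so a non-unit can be cancelled. This strips `rʲ` from
  -- elements of level `j`.
  ~-unscale : ∀ k .{{_ : NonZero k}} → + k * a ~ + k * b ⟨ k ℕ.* m ⟩ → a ~ b ⟨ m ⟩
  ~-unscale {a} {b} {m} k@(suc _) (mk~ (divides x e)) = mk~ (divides x (*-cancelˡ-≡ (+ k) _ _ (begin
    + k * (a - b)       ≡⟨ *-distribˡ-- (+ k) a b ⟩
    + k * a - + k * b   ≡⟨ e ⟩
    x * + (k ℕ.* m)     ≡⟨ cong (x *_) (pos-* k m) ⟩
    x * (+ k * + m)     ≡⟨ lemma (+ k) x (+ m) ⟨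
    + k * (x * + m)     ∎)))
    where
    open ≡-Reasoning
    *-distribˡ-- : ∀ c a b → c * (a - b) ≡ c * a - c * b
    *-distribˡ-- = solve-∀
    lemma : ∀ k x m → k * (x * m) ≡ x * (k * m)
    lemma = solve-∀

  ~-% : ∀ a m .{{_ : NonZero m}} → + (a %ℕ m) ~ a ⟨ m ⟩
  ~-% a m = mk~ (divides (- (a /ℕ m)) (begin
    + (a %ℕ m) - a                                    ≡⟨ cong (λ z → + (a %ℕ m) - z) (a≡a%ℕn+[a/ℕn]*n a m) ⟩
    + (a %ℕ m) - (+ (a %ℕ m) + (a /ℕ m) * + m)        ≡⟨ lemma (+ (a %ℕ m)) (a /ℕ m) (+ m) ⟩
    - (a /ℕ m) * + m                                  ∎))
    where
    open ≡-Reasoning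
    lemma : ∀ r x m → r - (r + x * m) ≡ - x * m
    lemma = solve-∀

  private
    ~⇒≡-≤ : ∀ {x y} → x ℕ.< m → y ℕ.≤ x → + x ~ + y ⟨ m ⟩ → x ≡ y
    ~⇒≡-≤ {m} {x} {y} x<m y≤x (mk~ p) = ℕ.≤-antisym (ℕ.m∸n≡0⇒m≤n x∸y≡0) y≤x
      where
      m∣x∸y : m ℕ.∣ x ℕ.∸ y
      m∣x∸y = subst (λ z → m ℕ.∣ ∣ z ∣) (trans (m-n≡m⊖n x y) (⊖-≥ y≤x)) (∣⇒∣ᵤ p)
      x∸y≡0 : x ℕ.∸ y ≡ 0
      x∸y≡0 with x ℕ.∸ y in eq
      ... | zero  = refl
      ... | suc e = contradiction (subst (m ℕ.∣_) eq m∣x∸y)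
        (ℕ.>⇒∤ (subst (ℕ._< m) eq (ℕ.≤-<-trans (ℕ.m∸n≤m x y) x<m)))

  ~⇒≡ : ∀ {x y} → x ℕ.< m → y ℕ.< m → + x ~ + y ⟨ m ⟩ → x ≡ y
  ~⇒≡ {m} {x} {y} x<m y<m p with ℕ.≤-total x y
  ... | inj₁ x≤y = sym (~⇒≡-≤ y<m x≤y (~-sym p))
  ... | inj₂ y≤x = ~⇒≡-≤ x<m y≤x p

  %-cong : ∀ m .{{_ : NonZero m}} → a ~ b ⟨ m ⟩ → a %ℕ m ≡ b %ℕ m
  %-cong {a} {b} m p = ~⇒≡ (n%ℕd<d a m) (n%ℕd<d b m) (~-trans (~-% a m) (~-trans p (~-sym (~-% b m))))

-- Units, multiplicative orders and primitive roots

module Units where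

  open import Data.Fin.Base as Fin using (Fin; zero; suc; toℕ)
  import Data.Fin.Properties as Fin
  open import Data.Integer.Base hiding (NonZero; suc; _%_; _/_)
  open import Data.Integer.DivMod using (_%ℕ_; n%ℕd<d)
  open import Data.Integer.Divisibility.Signed using (_∣_; divides; ∣⇒∣ᵤ; ∣ᵤ⇒∣; ∣m∣n⇒∣m-n; ∣m⇒∣m*n; ∣-trans)
  open import Data.Integer.Properties
  open import Data.Integer.Tactic.RingSolver using (solve-∀)
  open import Data.List.Base using (List; map; filter; upTo)
  open import Data.List.Membership.Propositional using (_∈_)
  open import Data.List.Membership.Propositional.Properties using (∈-map⁺; ∈-upTo⁺; ∈-filter⁺)
  open import Data.List.Relation.Unary.Any using (index)
  open import Data.List.Membership.Setoid.Properties using (index-injective)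
  open import Data.Nat.Base as ℕ using (ℕ; zero; suc)
  open import Data.Nat.Coprimality using (Coprime; coprime?; coprime-Bézout)
  open import Data.Nat.DivMod using (_/_; _%_; m≡m%n+[m/n]*n; m%n<n)
  import Data.Nat.Divisibility as ℕ
  open import Data.Nat.GCD using (module Bézout)
  import Data.Nat.Properties as ℕ
  open import Data.Product.Base using (_×_; _,_; ∃-syntax)
  open import Data.Sum.Base using (inj₁; inj₂)
  open import Relation.Binary.PropositionalEquality
  import Relation.Binary.Reasoning.Setoid as SetoidReasoning
  open import Relation.Nullary using (¬_; contradiction)
  open Congruences

  private
    module ~-Reasoning (m : ℕ) = SetoidReasoning (~-setoid m)

  private variable
    a b : ℤ
    d k m : ℕ

  record Unit (m : ℕ) (a : ℤ) : Set where
    constructor unit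
    field
      inverse   : ℤ
      *-inverse : a * inverse ~ 1ℤ ⟨ m ⟩

  Unit-resp-~ : a ~ b ⟨ m ⟩ → Unit m a → Unit m b
  Unit-resp-~ p (unit c e) = unit c (~-trans (*-congʳ~ c (~-sym p)) e)

  Unit-* : Unit m a → Unit m b → Unit m (a * b)
  Unit-* {m} {a} {b} (unit c e) (unit d f) = unit (c * d) (~-trans (~-reflexive (lemma a b c d)) (*-cong~ e f))
    where
    lemma : ∀ a b c d → (a * b) * (c * d) ≡ (a * c) * (b * d)
    lemma = solve-∀

  Unit-1 : Unit m 1ℤ
  Unit-1 = unit 1ℤ ~-refl

  Unit-neg : Unit m a → Unit m (- a)
  Unit-neg {m} {a} (unit c e) = unit (- c) (~-trans (~-reflexive (lemma a c)) e)
    where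
    lemma : ∀ a c → - a * - c ≡ a * c
    lemma = solve-∀

  Unit-^ : ∀ e → Unit m a → Unit m (a ^ e)
  Unit-^ zero    u = Unit-1
  Unit-^ (suc e) u = Unit-* u (Unit-^ e u)

  *-cancelˡ~ : ∀ u → Unit m u → u * a ~ u * b ⟨ m ⟩ → a ~ b ⟨ m ⟩
  *-cancelˡ~ {m} {a} {b} u (unit c e) p = begin
    a             ≡⟨ *-identityˡ a ⟨
    1ℤ * a        ≈⟨ *-congʳ~ a e ⟨
    u * c * a     ≡⟨ lemma u c a ⟩
    c * (u * a)   ≈⟨ *-congˡ~ c p ⟩
    c * (u * b)   ≡⟨ lemma u c b ⟨
    u * c * b     ≈⟨ *-congʳ~ b e ⟩
    1ℤ * b        ≡⟨ *-identityˡ b ⟩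
    b             ∎
    where
    open ~-Reasoning m
    lemma : ∀ u c a → u * c * a ≡ c * (u * a)
    lemma = solve-∀

  -- If `a b` is 1 modulo `k` and `a c` is 1 modulo `m`, then `(1 - a b)(1 - a c)` vanishes modulo
  -- `k m`. Expanding it as `1 - a (b + c - a b c)` shows the inverse.
  Unit-modulus-* : Unit k a → Unit m a → Unit (k ℕ.* m) a
  Unit-modulus-* {k} {a} {m} (unit b (mk~ (divides x e))) (unit c (mk~ (divides y f))) =
    unit (b + c - a * b * c) (mk~ (divides (- (x * y)) (begin
      a * (b + c - a * b * c) - 1ℤ          ≡⟨ lemma a b c ⟩
      - ((a * b - 1ℤ) * (a * c - 1ℤ))       ≡⟨ cong₂ (λ u v → - (u * v)) e f ⟩
      - ((x * + k) * (y * + m))             ≡⟨ lemma′ x (+ k) y (+ m) ⟩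
      - (x * y) * (+ k * + m)               ≡⟨ cong (- (x * y) *_) (pos-* k m) ⟨
      - (x * y) * + (k ℕ.* m)               ∎)))
    where
    open ≡-Reasoning
    lemma : ∀ a b c → a * (b + c - a * b * c) - 1ℤ ≡ - ((a * b - 1ℤ) * (a * c - 1ℤ))
    lemma = solve-∀
    lemma′ : ∀ x k y m → - ((x * k) * (y * m)) ≡ - (x * y) * (k * m)
    lemma′ = solve-∀

  Unit-modulus-^ : ∀ e → Unit m a → Unit (m ℕ.^ e) a
  Unit-modulus-^ {m} {a} zero    u = unit 0ℤ (mk~ (divides (a * 0ℤ - 1ℤ) (sym (*-identityʳ _))))
  Unit-modulus-^ (suc e) u = Unit-modulus-* u (Unit-modulus-^ e u)

  Unit⇒Coprime : Unit m a → Coprime ∣ a ∣ m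
  Unit⇒Coprime {m} {a} (unit b (mk~ p)) {d} (d∣a , d∣m) = ℕ.∣1⇒≡1 (∣⇒∣ᵤ d∣1)
    where
    d∣1 : + d ∣ 1ℤ
    d∣1 = subst (+ d ∣_) (lemma (a * b))
      (∣m∣n⇒∣m-n (∣m⇒∣m*n b (∣ᵤ⇒∣ {+ d} {a} d∣a)) (∣-trans (∣ᵤ⇒∣ {+ d} {+ m} d∣m) p))
      where
      lemma : ∀ x → x - (x - 1ℤ) ≡ 1ℤ
      lemma = solve-∀

  private
    Coprime⇒Unit-+ : ∀ {x} → Coprime x m → Unit m (+ x)
    Coprime⇒Unit-+ {m} {x} c with coprime-Bézout c
    ... | Bézout.+- u v eq = unit (+ u) (mk~ (divides (+ v) (begin
      + x * + u - 1ℤ              ≡⟨ cong (_- 1ℤ) (trans (*-comm (+ x) (+ u)) (sym (pos-* u x))) ⟩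
      + (u ℕ.* x) - 1ℤ            ≡⟨ cong (λ z → + z - 1ℤ) eq ⟨
      + (v ℕ.* m)                 ≡⟨ pos-* v m ⟩
      + v * + m                   ∎)))
      where open ≡-Reasoning
    ... | Bézout.-+ u v eq = unit (- + u) (mk~ (divides (- + v) (begin
      + x * - + u - 1ℤ            ≡⟨ lemma (+ x) (+ u) ⟩
      - (1ℤ + + u * + x)          ≡⟨ cong (λ z → - (1ℤ + z)) (pos-* u x) ⟨
      - + (1 ℕ.+ u ℕ.* x)         ≡⟨ cong (λ z → - + z) eq ⟩
      - + (v ℕ.* m)               ≡⟨ cong -_ (pos-* v m) ⟩
      - (+ v * + m)               ≡⟨ neg-distribˡ-* (+ v) (+ m) ⟩
      - + v * + m                 ∎)))
      where
      open ≡-Reasoning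
      lemma : ∀ x u → x * - u - 1ℤ ≡ - (1ℤ + u * x)
      lemma = solve-∀

  Coprime⇒Unit : ∀ a → Coprime ∣ a ∣ m → Unit m a
  Coprime⇒Unit (+ x)    c = Coprime⇒Unit-+ c
  Coprime⇒Unit -[1+ x ] c = Unit-neg (Coprime⇒Unit-+ c)

  prime⇒Unit : ∀ {p} → Prime p → ∀ e → ¬ + p ∣ a → Unit (p ℕ.^ e) a
  prime⇒Unit {a} {p} pr e p∤a = Unit-modulus-^ e (Coprime⇒Unit a cop)
    where
    cop : Coprime ∣ a ∣ p
    cop {d} (d∣a , d∣p) with prime⇒irreducible pr d∣p
    ... | inj₁ d≡1  = d≡1
    ... | inj₂ refl = contradiction (∣ᵤ⇒∣ d∣a) p∤a

  Unit⇒∤ : ∀ {p} → Prime p → p ℕ.∣ m → Unit m a → ¬ + p ∣ a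
  Unit⇒∤ {a = a} {p} pr p∣m u p∣a =
    ¬prime[1] (subst Prime (Unit⇒Coprime u (∣⇒∣ᵤ {+ p} {a} p∣a , p∣m)) pr)

  -- Split `x` as `x (m c) - x (m c - 1)`, where `c` inverts `m` modulo `k`. In the first term `k`
  -- comes from `x` and `m` is visible; in the second `m` comes from `x` and `k` divides `m c - 1`.
  ∣-coprime-* : ∀ {x} → Unit k (+ m) → + k ∣ x → + m ∣ x → + (k ℕ.* m) ∣ x
  ∣-coprime-* {k} {m} {x} (unit c (mk~ (divides w e))) (divides y f) (divides z g) =
    divides (y * c - z * w) (begin
      x                                              ≡⟨ lemma x (+ m * c) ⟩
      x * (+ m * c) - x * (+ m * c - 1ℤ)             ≡⟨ cong₂ (λ u v → u * (+ m * c) - v * (+ m * c - 1ℤ)) f g ⟩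
      y * + k * (+ m * c) - z * + m * (+ m * c - 1ℤ) ≡⟨ cong (λ v → y * + k * (+ m * c) - z * + m * v) e ⟩
      y * + k * (+ m * c) - z * + m * (w * + k)      ≡⟨ lemma′ y (+ k) (+ m) c z w ⟩
      (y * c - z * w) * (+ k * + m)                  ≡⟨ cong ((y * c - z * w) *_) (pos-* k m) ⟨
      (y * c - z * w) * + (k ℕ.* m)                  ∎)
    where
    open ≡-Reasoning
    lemma : ∀ x y → x ≡ x * y - x * (y - 1ℤ)
    lemma = solve-∀
    lemma′ : ∀ y k m c z w → y * k * (m * c) - z * m * (w * k) ≡ (y * c - z * w) * (k * m)
    lemma′ = solve-∀

  ~-coprime-* : Unit k (+ m) → a ~ b ⟨ k ⟩ → a ~ b ⟨ m ⟩ → a ~ b ⟨ k ℕ.* m ⟩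
  ~-coprime-* u (mk~ p) (mk~ q) = mk~ (∣-coprime-* u p q)

  ^-period : a ^ d ~ 1ℤ ⟨ m ⟩ → ∀ x r → a ^ (r ℕ.+ d ℕ.* x) ~ a ^ r ⟨ m ⟩
  ^-period {a} {d} {m} p x r = begin
    a ^ (r ℕ.+ d ℕ.* x)    ≡⟨ ^-distribˡ-+-* a r (d ℕ.* x) ⟩
    a ^ r * a ^ (d ℕ.* x)  ≡⟨ cong (a ^ r *_) (^-*-assoc a d x) ⟨
    a ^ r * (a ^ d) ^ x    ≈⟨ *-congˡ~ (a ^ r) (^-cong~ x p) ⟩
    a ^ r * 1ℤ ^ x         ≡⟨ cong (a ^ r *_) (^-zeroˡ x) ⟩
    a ^ r * 1ℤ             ≡⟨ *-identityʳ _ ⟩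
    a ^ r                  ∎
    where open ~-Reasoning m

  order-Unit : IsOrder m a d → Unit m a
  order-Unit {d = suc e} (_ , p , _) = unit _ (mk~ p)

  order-∣ : ∀ {e} → IsOrder m a d → a ^ e ~ 1ℤ ⟨ m ⟩ → d ℕ.∣ e
  order-∣ {m} {a} {suc d} {e} (_ , p , least) q = ℕ.m%n≡0⇒n∣m e (suc d) (remainder _ refl)
    where
    a^r~1 : a ^ (e % suc d) ~ 1ℤ ⟨ m ⟩
    a^r~1 = begin
      a ^ (e % suc d)                               ≈⟨ ^-period {d = suc d} (mk~ p) (e / suc d) (e % suc d) ⟨
      a ^ (e % suc d ℕ.+ suc d ℕ.* (e / suc d))     ≡⟨ cong (λ z → a ^ (e % suc d ℕ.+ z)) (ℕ.*-comm (suc d) (e / suc d)) ⟩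
      a ^ (e % suc d ℕ.+ (e / suc d) ℕ.* suc d)     ≡⟨ cong (a ^_) (m≡m%n+[m/n]*n e (suc d)) ⟨
      a ^ e                                         ≈⟨ q ⟩
      1ℤ                                            ∎
      where open ~-Reasoning m
    remainder : ∀ r → e % suc d ≡ r → e % suc d ≡ 0
    remainder zero    eq = eq
    remainder (suc r) eq = contradiction
      (least (suc r) (ℕ.s≤s ℕ.z≤n) (∣-difference (subst (λ z → a ^ z ~ 1ℤ ⟨ m ⟩) eq a^r~1)))
      (ℕ.<⇒≱ (subst (ℕ._< suc d) eq (m%n<n e (suc d))))

  order-distinct : ∀ {r s} → IsOrder m a d → r ℕ.< s → s ℕ.< d → ¬ a ^ r ~ a ^ s ⟨ m ⟩
  order-distinct {m} {a} {d} {r} {s} o@(_ , _ , least) r<s s<d p = ℕ.<⇒≱ (ℕ.≤-<-trans (ℕ.m∸n≤m s r) s<d)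
    (least (s ℕ.∸ r) (ℕ.m<n⇒0<n∸m r<s) (∣-difference (~-sym
      (*-cancelˡ~ (a ^ r) (Unit-^ r (order-Unit o)) (begin
        a ^ r * 1ℤ               ≡⟨ *-identityʳ _ ⟩
        a ^ r                    ≈⟨ p ⟩
        a ^ s                    ≡⟨ cong (a ^_) (ℕ.m+[n∸m]≡n (ℕ.<⇒≤ r<s)) ⟨
        a ^ (r ℕ.+ (s ℕ.∸ r))    ≡⟨ ^-distribˡ-+-* a r (s ℕ.∸ r) ⟩
        a ^ r * a ^ (s ℕ.∸ r)    ∎)))))
    where open ~-Reasoning m

  -- Among the φ m powers of g and the unit a, two coincide.
  primitiveRoot-generates : ∀ {g} → PrimitiveRoot m g → Unit m a → ∃[ r ] a ~ g ^ r ⟨ m ⟩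
  primitiveRoot-generates {zero} (() , _)
  primitiveRoot-generates {m@(suc _)} {a} {g} o u = conclude (Fin.pigeonhole (ℕ.n<1+n (φ m)) position)
    where
    U : List ℕ
    U = filter (λ k → coprime? k m) (map suc (upTo m))

    -- The list behind `φ m` runs over 1, ..., m, so the residue is taken of `b - 1` and then raised
    -- by one.
    representative : ℤ → ℕ
    representative b = suc ((b - 1ℤ) %ℕ m)

    representative-~ : ∀ b → + representative b ~ b ⟨ m ⟩
    representative-~ b = begin
      1ℤ + + ((b - 1ℤ) %ℕ m)  ≈⟨ +-cong~ (~-refl {1ℤ}) (~-% (b - 1ℤ) m) ⟩
      1ℤ + (b - 1ℤ)           ≡⟨ lemma b ⟩
      b                       ∎
      where
      open ~-Reasoning m
      lemma : ∀ b → 1ℤ + (b - 1ℤ) ≡ b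
      lemma = solve-∀

    representative-∈ : ∀ b → Unit m b → representative b ∈ U
    representative-∈ b v = ∈-filter⁺ (λ k → coprime? k m)
      (∈-map⁺ suc (∈-upTo⁺ (n%ℕd<d (b - 1ℤ) m)))
      (Unit⇒Coprime (Unit-resp-~ (~-sym (representative-~ b)) v))

    element : Fin (suc (φ m)) → ℤ
    element zero    = a
    element (suc r) = g ^ toℕ r

    element-unit : ∀ i → Unit m (element i)
    element-unit zero    = u
    element-unit (suc r) = Unit-^ (toℕ r) (order-Unit o)

    position : Fin (suc (φ m)) → Fin (φ m)
    position i = index (representative-∈ (element i) (element-unit i))

    position-injective : ∀ i j → position i ≡ position j → element i ~ element j ⟨ m ⟩
    position-injective i j eq = begin
      element i                     ≈⟨ representative-~ (element i) ⟨
      + representative (element i)  ≡⟨ cong +_ (index-injective (setoid ℕ) (representative-∈ _ (element-unit i)) (representative-∈ _ (element-unit j)) eq) ⟩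
      + representative (element j)  ≈⟨ representative-~ (element j) ⟩
      element j                     ∎
      where open ~-Reasoning m

    -- A collision of two powers with exponents below `φ m` would contradict the order of `g`, so
    -- the smaller of the two colliding indices is that of `a`.
    conclude : (∃[ i ] ∃[ j ] (i Fin.< j × position i ≡ position j)) → ∃[ r ] a ~ g ^ r ⟨ m ⟩
    conclude (i@zero    , j@(suc r) , _   , eq) = toℕ r , position-injective i j eq
    conclude (i@(suc r) , j@(suc s) , r<s , eq) = contradiction
      (position-injective i j eq)
      (order-distinct o (ℕ.≤-pred r<s) (Fin.toℕ<n s))

-- Sums over a complete residue system

module ResidueSums {c ℓ} (R : CommutativeRing c ℓ) where

  open import Algebra.Properties.Semiring.Sum (CommutativeRing.semiring R)
  open import Data.Fin.Base using (Fin; zero; suc; toℕ; fromℕ<)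
  open import Data.Fin.Permutation using (Permutation′; permutation)
  import Data.Fin.Properties as Fin
  open import Data.Integer.Base as ℤ using (ℤ; +_; 1ℤ)
  open import Data.Integer.DivMod using (n%ℕd<d)
  import Data.Integer.Properties as ℤ
  open import Data.Integer.Tactic.RingSolver using (solve-∀)
  open import Data.Nat.Base as ℕ using (ℕ; zero; suc; NonZero)
  open import Relation.Binary.PropositionalEquality as ≡ using (_≡_)
  import Relation.Binary.Reasoning.Setoid as SetoidReasoning
  open Congruences
  open Units

  open CommutativeRing R
  open SetoidReasoning setoid

  -- Summands are functions on all of ℤ, so that substitutions such as `a ↦ u a + v` need no
  -- reduction modulo `n`; invariance under the choice of representative is the separate condition
  -- `Periodic`.
  S : ℕ → (ℤ → Carrier) → Carrier
  S n f = sum {n} (λ i → f (+ toℕ i))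

  Periodic : ℕ → (ℤ → Carrier) → Set ℓ
  Periodic n f = ∀ {a b} → a ~ b ⟨ n ⟩ → f a ≈ f b

  S-cong : ∀ n {f g} → (∀ a → f a ≈ g a) → S n f ≈ S n g
  S-cong n p = sum-cong-≋ {n} (λ i → p (+ toℕ i))

  S-+-distrib : ∀ n f g → S n (λ a → f a + g a) ≈ S n f + S n g
  S-+-distrib n f g = ∑-distrib-+ {n} (λ i → f (+ toℕ i)) (λ i → g (+ toℕ i))

  S-*ˡ : ∀ n x f → S n (λ a → x * f a) ≈ x * S n f
  S-*ˡ n x f = sym (*-distribˡ-sum {n} x (λ i → f (+ toℕ i)))

  S-*ʳ : ∀ n x f → S n (λ a → f a * x) ≈ S n f * x
  S-*ʳ n x f = sym (*-distribʳ-sum {n} x (λ i → f (+ toℕ i)))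

  S-comm : ∀ m n (f : ℤ → ℤ → Carrier) → S m (λ a → S n (f a)) ≈ S n (λ b → S m (λ a → f a b))
  S-comm m n f = ∑-comm {m} {n} (λ i j → f (+ toℕ i) (+ toℕ j))

  S-zero : ∀ n → S n (λ _ → 0#) ≈ 0#
  S-zero = sum-replicate-zero

  S-reindex : ∀ n .{{_ : NonZero n}} {f} → Periodic n f → (π π⁻¹ : ℤ → ℤ) →
              (∀ {a b} → a ~ b ⟨ n ⟩ → π a ~ π b ⟨ n ⟩) →
              (∀ {a b} → a ~ b ⟨ n ⟩ → π⁻¹ a ~ π⁻¹ b ⟨ n ⟩) →
              (∀ a → π (π⁻¹ a) ~ a ⟨ n ⟩) → (∀ a → π⁻¹ (π a) ~ a ⟨ n ⟩) →
              S n (λ a → f (π a)) ≈ S n f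
  S-reindex n {f} f-periodic π π⁻¹ π-cong π⁻¹-cong ππ⁻¹ π⁻¹π = begin
    S n (λ a → f (π a))                              ≈⟨ sum-cong-≋ {n} (λ i → f-periodic (reduce-~ π i)) ⟨
    sum {n} (λ i → f (+ toℕ (reduce π i)))           ≈⟨ sum-permute {n} (λ i → f (+ toℕ i)) permutation-π ⟨
    S n f                                            ∎
    where
    reduce : (ℤ → ℤ) → Fin n → Fin n
    reduce ρ i = fromℕ< (n%ℕd<d (ρ (+ toℕ i)) n)

    reduce-~ : ∀ ρ i → + toℕ (reduce ρ i) ~ ρ (+ toℕ i) ⟨ n ⟩
    reduce-~ ρ i = ~-trans (~-reflexive (≡.cong +_ (Fin.toℕ-fromℕ< _))) (~-% (ρ (+ toℕ i)) n)

    inverse : ∀ ρ σ → (∀ {a b} → a ~ b ⟨ n ⟩ → ρ a ~ ρ b ⟨ n ⟩) → (∀ a → ρ (σ a) ~ a ⟨ n ⟩) →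
              ∀ i → reduce ρ (reduce σ i) ≡ i
    inverse ρ σ ρ-cong ρσ i = Fin.toℕ-injective (~⇒≡ (Fin.toℕ<n _) (Fin.toℕ<n i)
      (~-trans (reduce-~ ρ (reduce σ i)) (~-trans (ρ-cong (reduce-~ σ i)) (ρσ (+ toℕ i)))))

    permutation-π : Permutation′ n
    permutation-π = permutation (reduce π) (reduce π⁻¹)
      (inverse π π⁻¹ π-cong ππ⁻¹) (inverse π⁻¹ π π⁻¹-cong π⁻¹π)

  S-affine : ∀ n .{{_ : NonZero n}} {f} → Periodic n f → ∀ {u} → Unit n u → ∀ v →
             S n (λ a → f (a ℤ.* u ℤ.+ v)) ≈ S n f
  S-affine n f-periodic {u} (unit w uw~1) v =
    S-reindex n f-periodic (λ a → a ℤ.* u ℤ.+ v) (λ b → (b ℤ.- v) ℤ.* w)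
      (λ p → +-cong~ (*-congʳ~ u p) (~-refl {v}))
      (λ p → *-congʳ~ w (+-cong~ p (~-refl {ℤ.- v})))
      (λ b → ~-trans (~-reflexive (rearrange₁ b u v w))
               (~-trans (+-cong~ (*-congˡ~ (b ℤ.- v) uw~1) (~-refl {v})) (~-reflexive (simplify b v))))
      (λ a → ~-trans (~-reflexive (rearrange₂ a u v w))
               (~-trans (*-congˡ~ a uw~1) (~-reflexive (ℤ.*-identityʳ a))))
    where
    rearrange₁ : ∀ b u v w → ((b ℤ.- v) ℤ.* w) ℤ.* u ℤ.+ v ≡ (b ℤ.- v) ℤ.* (u ℤ.* w) ℤ.+ v
    rearrange₁ = solve-∀
    rearrange₂ : ∀ a u v w → (a ℤ.* u ℤ.+ v ℤ.- v) ℤ.* w ≡ a ℤ.* (u ℤ.* w)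
    rearrange₂ = solve-∀
    simplify : ∀ b v → (b ℤ.- v) ℤ.* 1ℤ ℤ.+ v ≡ b
    simplify = solve-∀

  S-dilate : ∀ n .{{_ : NonZero n}} {f} → Periodic n f → ∀ {u} → Unit n u →
             S n (λ a → f (u ℤ.* a)) ≈ S n f
  S-dilate n {f} f-periodic {u} U = trans
    (S-cong n (λ a → f-periodic (~-reflexive (≡.trans (ℤ.*-comm u a) (≡.sym (ℤ.+-identityʳ _))))))
    (S-affine n f-periodic U (+ 0))

  S-shift : ∀ n .{{_ : NonZero n}} {f} → Periodic n f → ∀ c → S n (λ a → f (a ℤ.+ c)) ≈ S n f
  S-shift n {f} f-periodic c = trans
    (S-cong n (λ a → f-periodic (~-reflexive (≡.cong (ℤ._+ c) (≡.sym (ℤ.*-identityʳ a))))))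
    (S-affine n f-periodic Unit-1 c)

  S-reflect : ∀ n .{{_ : NonZero n}} {f} → Periodic n f → ∀ c → S n (λ a → f (c ℤ.- a)) ≈ S n f
  S-reflect n {f} f-periodic c = trans
    (S-cong n (λ a → f-periodic (~-reflexive (lemma c a))))
    (S-affine n f-periodic (Unit-neg Unit-1) c)
    where
    lemma : ∀ c a → c ℤ.- a ≡ a ℤ.* (ℤ.- 1ℤ) ℤ.+ c
    lemma = solve-∀

  S-split : ∀ m n f → S (m ℕ.+ n) f ≈ S m f + S n (λ a → f (+ m ℤ.+ a))
  S-split zero    n f = trans (S-cong n (λ a → reflexive (≡.cong f (≡.sym (ℤ.+-identityˡ a))))) (sym (+-identityˡ _))
  S-split (suc m) n f = begin
    f (+ 0) + S (m ℕ.+ n) (λ a → f (1ℤ ℤ.+ a))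
      ≈⟨ +-congˡ (S-split m n (λ a → f (1ℤ ℤ.+ a))) ⟩
    f (+ 0) + (S m (λ a → f (1ℤ ℤ.+ a)) + S n (λ a → f (1ℤ ℤ.+ (+ m ℤ.+ a))))
      ≈⟨ +-assoc _ _ _ ⟨
    S (suc m) f + S n (λ a → f (1ℤ ℤ.+ (+ m ℤ.+ a)))
      ≈⟨ +-congˡ (S-cong n (λ a → reflexive (≡.cong f (≡.sym (ℤ.+-assoc 1ℤ (+ m) a))))) ⟩
    S (suc m) f + S n (λ a → f (+ suc m ℤ.+ a)) ∎

  S-blocks : ∀ k m f → S (k ℕ.* m) f ≈ S k (λ u → S m (λ v → f (u ℤ.* + m ℤ.+ v)))
  S-blocks zero    m f = refl
  S-blocks (suc k) m f = begin
    S (m ℕ.+ k ℕ.* m) f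
      ≈⟨ S-split m (k ℕ.* m) f ⟩
    S m f + S (k ℕ.* m) (λ a → f (+ m ℤ.+ a))
      ≈⟨ +-cong (S-cong m (λ v → reflexive (≡.cong f (≡.sym (ℤ.+-identityˡ v)))))
                (S-blocks k m (λ a → f (+ m ℤ.+ a))) ⟩
    S m (λ v → f (+ 0 ℤ.+ v)) + S k (λ u → S m (λ v → f (+ m ℤ.+ (u ℤ.* + m ℤ.+ v))))
      ≈⟨ +-congˡ (S-cong k (λ u → S-cong m (λ v → reflexive (≡.cong f (lemma u v (+ m)))))) ⟩
    S m (λ v → f (+ 0 ℤ.+ v)) + S k (λ u → S m (λ v → f ((1ℤ ℤ.+ u) ℤ.* + m ℤ.+ v))) ∎
    where
    lemma : ∀ u v m → m ℤ.+ (u ℤ.* m ℤ.+ v) ≡ (1ℤ ℤ.+ u) ℤ.* m ℤ.+ v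
    lemma = solve-∀

  -- Writing the index as `u m + v` takes the place of the Chinese remainder bijection: `g` sees
  -- only `v`, and for fixed `v` the map `u ↦ u m + v` permutes the residues modulo `k`, because `m`
  -- is a unit there.
  S-coprime-* : ∀ k m .{{_ : NonZero k}} {f g} → Unit k (+ m) → Periodic k f → Periodic m g →
                S (k ℕ.* m) (λ a → f a * g a) ≈ S k f * S m g
  S-coprime-* k m {f} {g} U f-periodic g-periodic = begin
    S (k ℕ.* m) (λ a → f a * g a)
      ≈⟨ S-blocks k m (λ a → f a * g a) ⟩
    S k (λ u → S m (λ v → f (u ℤ.* + m ℤ.+ v) * g (u ℤ.* + m ℤ.+ v)))
      ≈⟨ S-cong k (λ u → S-cong m (λ v → *-congˡ {f (u ℤ.* + m ℤ.+ v)} (g-periodic (um+v~v u v)))) ⟩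
    S k (λ u → S m (λ v → f (u ℤ.* + m ℤ.+ v) * g v))
      ≈⟨ S-comm k m (λ u v → f (u ℤ.* + m ℤ.+ v) * g v) ⟩
    S m (λ v → S k (λ u → f (u ℤ.* + m ℤ.+ v) * g v))
      ≈⟨ S-cong m (λ v → trans (S-*ʳ k (g v) (λ u → f (u ℤ.* + m ℤ.+ v))) (*-congʳ (S-affine k f-periodic U v))) ⟩
    S m (λ v → S k f * g v)
      ≈⟨ S-*ˡ m (S k f) g ⟩
    S k f * S m g ∎
    where
    um+v~v : ∀ u v → u ℤ.* + m ℤ.+ v ~ v ⟨ m ⟩
    um+v~v u v = ~-trans (+-cong~ (∣⇒~0 (divides u ≡.refl)) (~-refl {v})) (~-reflexive (ℤ.+-identityˡ v))
      where open import Data.Integer.Divisibility.Signed using (divides)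

-- Indicator functions, Euler's function and convolutions over ℤ

module Counting where

  open import Data.Fin.Base using (Fin; zero; suc; toℕ)
  import Data.Fin.Properties as Fin
  open import Data.Integer.Base hiding (NonZero; suc; _≤_; _<_)
  open import Data.Integer.Divisibility.Signed using (_∣_; _∣?_; divides; ∣⇒∣ᵤ; ∣ᵤ⇒∣; ∣-trans)
  open import Data.Integer.Properties
  open import Algebra.Properties.Semiring.Sum +-*-semiring using (sum-cong-≋)
  open import Data.Integer.Tactic.RingSolver using (solve-∀)
  open import Data.List.Base using (filter; length; applyUpTo)
  open import Data.List.Properties using (map-upTo)
  open import Data.Nat.Base as ℕ using (ℕ; zero; suc; NonZero; s≤s)
  open import Data.Nat.Coprimality using (coprime?)
  import Data.Nat.Divisibility as ℕ
  import Data.Nat.Properties as ℕ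
  import Data.Nat.Tactic.RingSolver as ℕ
  open import Function.Base using (_∘_)
  open import Relation.Binary.PropositionalEquality
  open import Relation.Nullary using (¬_; Dec; yes; no; contradiction)
  open import Relation.Unary using (Pred; Decidable)
  open Congruences
  open Units
  open ResidueSums +-*-commutativeRing

  private variable
    P Q : Set
    k m : ℕ
    f g : ℤ → ℤ

  𝟙 : Dec P → ℤ
  𝟙 (yes _) = 1ℤ
  𝟙 (no  _) = 0ℤ

  𝟙-yes : (d : Dec P) → P → 𝟙 d ≡ 1ℤ
  𝟙-yes (yes _) _ = refl
  𝟙-yes (no ¬p) p = contradiction p ¬p

  𝟙-no : (d : Dec P) → ¬ P → 𝟙 d ≡ 0ℤ
  𝟙-no (yes p) ¬p = contradiction p ¬p
  𝟙-no (no _)  _  = refl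

  𝟙-cong : (d : Dec P) (e : Dec Q) → (P → Q) → (Q → P) → 𝟙 d ≡ 𝟙 e
  𝟙-cong (yes p) e to from = sym (𝟙-yes e (to p))
  𝟙-cong (no ¬p) e to from = sym (𝟙-no e (¬p ∘ from))

  𝟙-idem : (d : Dec P) → 𝟙 d * 𝟙 d ≡ 𝟙 d
  𝟙-idem (yes _) = refl
  𝟙-idem (no  _) = refl

  z : ℕ → ℤ → ℤ
  z m a = 𝟙 (+ m ∣? a)

  Periodic-weaken : k ℕ.∣ m → Periodic k f → Periodic m f
  Periodic-weaken k∣m p q = p (~-weaken k∣m q)

  z-periodic : ∀ m → Periodic m (z m)
  z-periodic m {a} {b} p = 𝟙-cong (+ m ∣? a) (+ m ∣? b) (∣-resp-~ p) (∣-resp-~ (~-sym p))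

  S-const-1 : ∀ n → S n (λ _ → 1ℤ) ≡ + n
  S-const-1 zero    = refl
  S-const-1 (suc n) = cong (_+_ 1ℤ) (S-const-1 n)

  S-z-self : ∀ m .{{_ : NonZero m}} → S m (z m) ≡ 1ℤ
  S-z-self (suc m) = cong₂ _+_ (𝟙-yes (+ suc m ∣? 0ℤ) (divides 0ℤ refl))
    (trans (sum-cong-≋ {m} (λ i → 𝟙-no (+ suc m ∣? + suc (toℕ i)) (λ d → ℕ.>⇒∤ (s≤s (Fin.toℕ<n i)) (∣⇒∣ᵤ d)))) (S-zero m))

  S-z : ∀ k m .{{_ : NonZero m}} → S (k ℕ.* m) (z m) ≡ + k
  S-z k m = begin
    S (k ℕ.* m) (z m)                                ≡⟨ S-blocks k m (z m) ⟩
    S k (λ u → S m (λ v → z m (u * + m + v)))        ≡⟨ S-cong k (λ u → S-cong m (λ v → z-periodic m (um+v~v u v))) ⟩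
    S k (λ _ → S m (z m))                            ≡⟨ S-cong k (λ _ → S-z-self m) ⟩
    S k (λ _ → 1ℤ)                                   ≡⟨ S-const-1 k ⟩
    + k                                              ∎
    where
    open ≡-Reasoning
    um+v~v : ∀ u v → u * + m + v ~ v ⟨ m ⟩
    um+v~v u v = ~-trans (+-cong~ (∣⇒~0 (divides u refl)) (~-refl {v})) (~-reflexive (+-identityˡ v))

  length-filter : ∀ {Pr : Pred ℕ _} (P? : Decidable Pr) (h : ℕ → ℕ) n →
                  + length (filter P? (applyUpTo h n)) ≡ S n (λ a → 𝟙 (P? (h ∣ a ∣)))
  length-filter P? h zero    = refl
  length-filter P? h (suc n) with P? (h 0)
  ... | yes _ = cong (_+_ 1ℤ) (trans (length-filter P? (h ∘ suc) n) (sum-cong-≋ {n} (λ i → refl)))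
  ... | no  _ = trans (length-filter P? (h ∘ suc) n) (sym (+-identityˡ _))

  -- Of the `p ^ suc e` residues exactly `p ^ e` are multiples of `p`, and the others are coprime to
  -- the modulus. The additive form avoids truncated subtraction. `φ` lists 1, ..., n while `S` runs
  -- over 0, ..., n - 1, whence the shift by 1.
  φ-prime-power : ∀ {p} → Prime p → ∀ e → φ (p ℕ.^ suc e) ℕ.+ p ℕ.^ e ≡ p ℕ.^ suc e
  φ-prime-power {p} pr e = +-injective (begin
    + (φ n ℕ.+ p ℕ.^ e)
      ≡⟨ cong₂ _+_ (trans (cong (λ xs → + length (filter (λ k → coprime? k n) xs)) (map-upTo suc n))
           (length-filter (λ k → coprime? k n) suc n)) (sym (trans (cong (λ k → S k (z p)) (ℕ.*-comm p (p ℕ.^ e))) (S-z (p ℕ.^ e) p))) ⟩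
    S n (λ a → 𝟙 (coprime? (suc ∣ a ∣) n)) + S n (z p)
      ≡⟨ cong (_+ S n (z p)) (sum-cong-≋ {n} (λ i → coprime-z (toℕ i))) ⟩
    S n (λ a → 1ℤ - z p (a + 1ℤ)) + S n (z p)
      ≡⟨ cong (_+ S n (z p)) (S-shift n {λ a → 1ℤ - z p a} (λ q → cong (_-_ 1ℤ) (z-periodic-n q)) 1ℤ) ⟩
    S n (λ a → 1ℤ - z p a) + S n (z p)
      ≡⟨ S-+-distrib n (λ a → 1ℤ - z p a) (z p) ⟨
    S n (λ a → 1ℤ - z p a + z p a)
      ≡⟨ S-cong n (λ a → lemma (z p a)) ⟩
    S n (λ _ → 1ℤ)
      ≡⟨ S-const-1 n ⟩
    + n ∎)
    where
    open ≡-Reasoning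
    n : ℕ
    n = p ℕ.^ suc e
    instance
      p≢0 : NonZero p
      p≢0 = prime⇒nonZero pr
      n≢0 : NonZero n
      n≢0 = ℕ.m^n≢0 p (suc e)
    z-periodic-n : Periodic n (z p)
    z-periodic-n = Periodic-weaken (ℕ.m∣m*n (p ℕ.^ e)) (z-periodic p)
    lemma : ∀ x → 1ℤ - x + x ≡ 1ℤ
    lemma = solve-∀
    coprime-z : ∀ x → 𝟙 (coprime? (suc x) n) ≡ 1ℤ - z p (+ x + 1ℤ)
    coprime-z x = trans (decide (+ p ∣? + suc x)) (cong (λ y → 1ℤ - z p y) (+-comm 1ℤ (+ x)))
      where
      decide : (d : Dec (+ p ∣ + suc x)) → 𝟙 (coprime? (suc x) n) ≡ 1ℤ - 𝟙 d
      decide (yes p∣x) = 𝟙-no (coprime? (suc x) n) (λ c →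
        Unit⇒∤ pr (ℕ.m∣m*n (p ℕ.^ e)) (Coprime⇒Unit (+ suc x) c) p∣x)
      decide (no p∤x) = 𝟙-yes (coprime? (suc x) n) (Unit⇒Coprime (prime⇒Unit pr (suc e) p∤x))

  φ≡2h : ∀ {p} k e → Prime p → p ≡ 3 ℕ.+ 4 ℕ.* k → φ (p ℕ.^ suc e) ≡ 2 ℕ.* ((1 ℕ.+ 2 ℕ.* k) ℕ.* p ℕ.^ e)
  φ≡2h {p} k e pr refl = ℕ.+-cancelʳ-≡ (p ℕ.^ e) _ _ (trans (φ-prime-power pr e) (lemma k (p ℕ.^ e)))
    where
    lemma : ∀ k x → (3 ℕ.+ 4 ℕ.* k) ℕ.* x ≡ 2 ℕ.* ((1 ℕ.+ 2 ℕ.* k) ℕ.* x) ℕ.+ x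
    lemma = ℕ.solve-∀

  infixl 7 _⋆⟨_⟩_
  _⋆⟨_⟩_ : (ℤ → ℤ) → ℕ → (ℤ → ℤ) → ℤ → ℤ
  (f ⋆⟨ n ⟩ g) c = S n (λ a → f a * g (c - a))

  SupportedOn : ℕ → (ℤ → ℤ) → Set
  SupportedOn m g = ∀ {a} → ¬ + m ∣ a → g a ≡ 0ℤ

  ⋆-comm : ∀ n .{{_ : NonZero n}} {f g} → Periodic n f → Periodic n g → ∀ c → (f ⋆⟨ n ⟩ g) c ≡ (g ⋆⟨ n ⟩ f) c
  ⋆-comm n {f} {g} f-periodic g-periodic c = begin
    S n (λ a → f a * g (c - a))              ≡⟨ S-reflect n {λ a → f a * g (c - a)} (λ p → cong₂ _*_ (f-periodic p) (g-periodic (∸-cong~ (~-refl {c}) p))) c ⟨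
    S n (λ a → f (c - a) * g (c - (c - a)))  ≡⟨ S-cong n (λ a → trans (*-comm (f (c - a)) (g (c - (c - a)))) (cong (λ b → g b * f (c - a)) (lemma c a))) ⟩
    S n (λ a → g a * f (c - a))              ∎
    where
    open ≡-Reasoning
    lemma : ∀ c a → c - (c - a) ≡ a
    lemma = solve-∀

  -- A nonzero term has `m` dividing `c - a`, and then `f` does not distinguish `a` from `c`; so
  -- `f c` leaves the sum.
  ⋆-local : ∀ n .{{_ : NonZero n}} {f g} → Periodic m f → Periodic n g → SupportedOn m g →
            ∀ c → (f ⋆⟨ n ⟩ g) c ≡ f c * S n g
  ⋆-local {m} n {f} {g} f-periodic g-periodic g-supported c = begin
    S n (λ a → f a * g (c - a))  ≡⟨ S-cong n pointwise ⟩
    S n (λ a → f c * g (c - a))  ≡⟨ S-*ˡ n (f c) (λ a → g (c - a)) ⟩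
    f c * S n (λ a → g (c - a))  ≡⟨ cong (f c *_) (S-reflect n g-periodic c) ⟩
    f c * S n g                  ∎
    where
    open ≡-Reasoning
    pointwise : ∀ a → f a * g (c - a) ≡ f c * g (c - a)
    pointwise a with + m ∣? c - a
    ... | yes m∣c-a = cong (_* g (c - a)) (f-periodic (~-sym (mk~ m∣c-a)))
    ... | no  m∤c-a = trans (cong (f a *_) (g-supported m∤c-a))
                        (trans (*-zeroʳ (f a)) (sym (trans (cong (f c *_) (g-supported m∤c-a)) (*-zeroʳ (f c)))))

  -- The functions w and w ∘ -_ indicate the two classes into which the
  -- multiples of L that are not multiples of M fall.
  module TwoClasses (n L M P : ℕ) .{{_ : NonZero n}} .{{_ : NonZero M}}
    (n≡PM : n ≡ P ℕ.* M) (L∣M : L ℕ.∣ M)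
    (w : ℤ → ℤ) (w-periodic : Periodic M w) (w-supported : SupportedOn L w)
    (w-idem : ∀ a → w a * w a ≡ w a)
    (partition : ∀ a → w a + w (- a) ≡ z L a - z M a)
    where

    -- `D c` counts the pairs of class elements modulo `n` with difference `c`, and `E c` those with
    -- sum `c`.
    D E : ℤ → ℤ
    D c = S n (λ a → w a * w (a - c))
    E = w ⋆⟨ n ⟩ w

    H : ℤ
    H = S n w

    private
      M∣n : M ℕ.∣ n
      M∣n = subst (M ℕ.∣_) (sym n≡PM) (ℕ.n∣m*n P)

    w-periodicₙ : Periodic n w
    w-periodicₙ = Periodic-weaken M∣n w-periodic

    S-w-neg : S n (λ a → w (- a)) ≡ H
    S-w-neg = trans (S-cong n (λ a → cong w (sym (+-identityˡ (- a))))) (S-reflect n w-periodicₙ 0ℤ)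

    S-z-M : S n (z M) ≡ + P
    S-z-M = trans (cong (λ k → S k (z M)) n≡PM) (S-z P M)

    -- The multiples of `L` consist of the class, its negative and the multiples of `M`.
    2H+P : H + H + + P ≡ S n (z L)
    2H+P = begin
      H + H + + P                                  ≡⟨ cong₂ (λ x y → H + x + y) S-w-neg S-z-M ⟨
      H + S n (λ a → w (- a)) + S n (z M)          ≡⟨ cong (_+ S n (z M)) (S-+-distrib n w (λ a → w (- a))) ⟨
      S n (λ a → w a + w (- a)) + S n (z M)        ≡⟨ S-+-distrib n (λ a → w a + w (- a)) (z M) ⟨
      S n (λ a → w a + w (- a) + z M a)            ≡⟨ S-cong n (λ a → trans (cong (_+ z M a) (partition a)) (lemma (z L a) (z M a))) ⟩
      S n (z L)                                    ∎
      where
      open ≡-Reasoning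
      lemma : ∀ x y → x - y + y ≡ x
      lemma = solve-∀

    -- Exchanging the two elements of a pair reverses their difference.
    D-neg : ∀ c → D (- c) ≡ D c
    D-neg c = begin
      S n (λ a → w a * w (a - - c))              ≡⟨ S-shift n {λ a → w a * w (a - - c)} (λ p → cong₂ _*_ (w-periodicₙ p) (w-periodicₙ (∸-cong~ p (~-refl { - c})))) (- c) ⟨
      S n (λ a → w (a - c) * w (a - c - - c))    ≡⟨ S-cong n (λ a → trans (*-comm (w (a - c)) (w (a - c - - c))) (cong (λ b → w b * w (a - c)) (lemma a c))) ⟩
      S n (λ a → w a * w (a - c))                ∎
      where
      open ≡-Reasoning
      lemma : ∀ a c → a - c - - c ≡ a
      lemma = solve-∀

    D-M∣ : ∀ {c} → + M ∣ c → D c ≡ H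
    D-M∣ {c} M∣c = S-cong n (λ a → trans (cong (w a *_) (w-periodic (a-c~a a))) (w-idem a))
      where
      a-c~a : ∀ a → a - c ~ a ⟨ M ⟩
      a-c~a a = ~-trans (∸-cong~ (~-refl {a}) (∣⇒~0 M∣c)) (~-reflexive (+-identityʳ a))

    D-L∤ : ∀ {c} → ¬ + L ∣ c → D c ≡ 0ℤ
    D-L∤ {c} L∤c = trans (S-cong n vanish) (S-zero n)
      where
      vanish : ∀ a → w a * w (a - c) ≡ 0ℤ
      vanish a with + L ∣? a
      ... | no  L∤a = trans (cong (_* w (a - c)) (w-supported L∤a)) (*-zeroˡ (w (a - c)))
      ... | yes L∣a = trans (cong (w a *_) (w-supported L∤a-c)) (*-zeroʳ (w a))
        where
        L∤a-c : ¬ + L ∣ a - c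
        L∤a-c d = L∤c (∣-resp-~ (mk~ {a} {c} d) L∣a)

    -- Every pair of class elements has exactly one difference.
    S-D : S n D ≡ H * H
    S-D = begin
      S n (λ c → S n (λ a → w a * w (a - c)))    ≡⟨ S-comm n n (λ c a → w a * w (a - c)) ⟩
      S n (λ a → S n (λ c → w a * w (a - c)))    ≡⟨ S-cong n (λ a → trans (S-*ˡ n (w a) (λ c → w (a - c))) (cong (w a *_) (S-reflect n w-periodicₙ a))) ⟩
      S n (λ a → w a * H)                        ≡⟨ S-*ʳ n H w ⟩
      H * H                                      ∎
      where open ≡-Reasoning

    w-neg-M∣ : ∀ {c} → + M ∣ c → w c + w (- c) ≡ 0ℤ
    w-neg-M∣ {c} M∣c = trans (partition c)
      (cong₂ _-_ (𝟙-yes (+ L ∣? c) (∣-trans (∣ᵤ⇒∣ {+ L} {+ M} L∣M) M∣c)) (𝟙-yes (+ M ∣? c) M∣c))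

    w-neg-L∤ : ∀ {c} → ¬ + L ∣ c → w c + w (- c) ≡ 0ℤ
    w-neg-L∤ {c} L∤c = trans (partition c)
      (cong₂ _-_ (𝟙-no (+ L ∣? c) L∤c) (𝟙-no (+ M ∣? c) (L∤c ∘ ∣-trans (∣ᵤ⇒∣ {+ L} {+ M} L∣M))))

    w-neg-exact : ∀ {c} → + L ∣ c → ¬ + M ∣ c → w c + w (- c) ≡ 1ℤ
    w-neg-exact {c} L∣c M∤c = trans (partition c) (cong₂ _-_ (𝟙-yes (+ L ∣? c) L∣c) (𝟙-no (+ M ∣? c) M∤c))

    module _ (d : ℤ) (D-exact : ∀ {c} → + L ∣ c → ¬ + M ∣ c → D c ≡ d) where

      -- There are three kinds of `c`: multiples of `M`, other multiples of `L`, and the rest, where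
      -- `D` is `H`, `d` and 0. The sum `w c + w (- c)` indicates the second kind.
      D-formula : ∀ c → D c ≡ d * (w c + w (- c)) + H * z M c
      D-formula c with + M ∣? c
      ... | yes M∣c = trans (D-M∣ M∣c) (sym (trans (cong (λ x → d * x + H * 1ℤ) (w-neg-M∣ M∣c)) (lemma d H)))
        where
        lemma : ∀ d H → d * 0ℤ + H * 1ℤ ≡ H
        lemma = solve-∀
      ... | no M∤c with + L ∣? c
      ...   | yes L∣c = trans (D-exact L∣c M∤c) (sym (trans (cong (λ x → d * x + H * 0ℤ) (w-neg-exact L∣c M∤c)) (lemma d H)))
        where
        lemma : ∀ d H → d * 1ℤ + H * 0ℤ ≡ d
        lemma = solve-∀
      ...   | no L∤c = trans (D-L∤ L∤c) (sym (trans (cong (λ x → d * x + H * 0ℤ) (w-neg-L∤ L∤c)) (lemma d H)))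
        where
        lemma : ∀ d H → d * 0ℤ + H * 0ℤ ≡ 0ℤ
        lemma = solve-∀

      -- Both sides count pairs: Σ_c D c = H² is compared with the sum of D-formula.
      H-formula : .{{_ : Data.Integer.Base.NonZero H}} → H ≡ d + d + + P
      H-formula = *-cancelʳ-≡ H (d + d + + P) H (begin
        H * H                                                  ≡⟨ S-D ⟨
        S n D                                                  ≡⟨ S-cong n D-formula ⟩
        S n (λ c → d * (w c + w (- c)) + H * z M c)            ≡⟨ S-+-distrib n (λ c → d * (w c + w (- c))) (λ c → H * z M c) ⟩
        S n (λ c → d * (w c + w (- c))) + S n (λ c → H * z M c) ≡⟨ cong₂ _+_ (S-*ˡ n d (λ c → w c + w (- c))) (S-*ˡ n H (z M)) ⟩
        d * S n (λ c → w c + w (- c)) + H * S n (z M)          ≡⟨ cong₂ (λ x y → d * x + H * y) (trans (S-+-distrib n w (λ c → w (- c))) (cong (_+_ H) S-w-neg)) S-z-M ⟩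
        d * (H + H) + H * + P                                  ≡⟨ lemma d H (+ P) ⟩
        (d + d + + P) * H                                      ∎)
        where
        open ≡-Reasoning
        lemma : ∀ d H P → d * (H + H) + H * P ≡ (d + d + P) * H
        lemma = solve-∀

      -- Σₐ w a (w (c - a) + w (a - c) + z M (c - a)) = Σₐ w a z L (c - a) by the partition.
      E-formula : H ≡ d + d + + P → ∀ c → E c ≡ d * w c + (d + + P) * w (- c)
      E-formula H≡2d+P c = begin
        E c                                                                 ≡⟨ lemma₁ (E c) (D c) ⟩
        E c + D c - D c                                                     ≡⟨ cong₂ _-_ E+D (D-formula c) ⟩
        (z L c * H - w c * + P) - (d * (w c + w (- c)) + H * z M c)         ≡⟨ lemma₂ (z L c) (z M c) H (w c) (+ P) (d * (w c + w (- c))) ⟩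
        (z L c - z M c) * H - w c * + P - d * (w c + w (- c))               ≡⟨ cong₂ (λ x y → x * y - w c * + P - d * (w c + w (- c))) (sym (partition c)) H≡2d+P ⟩
        (w c + w (- c)) * (d + d + + P) - w c * + P - d * (w c + w (- c))   ≡⟨ lemma₃ (w c) (w (- c)) d (+ P) ⟩
        d * w c + (d + + P) * w (- c)                                       ∎
        where
        open ≡-Reasoning
        lemma₁ : ∀ x y → x ≡ x + y - y
        lemma₁ = solve-∀
        lemma₂ : ∀ l m h w p x → (l * h - w * p) - (x + h * m) ≡ (l - m) * h - w * p - x
        lemma₂ = solve-∀
        lemma₃ : ∀ w v d p → (w + v) * (d + d + p) - w * p - d * (w + v) ≡ d * w + (d + p) * v
        lemma₃ = solve-∀
        lemma₄ : ∀ a c → - (c - a) ≡ a - c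
        lemma₄ = solve-∀
        lemma₅ : ∀ x l m → x * (l - m) ≡ x * l - x * m
        lemma₅ = solve-∀
        lemma₆ : ∀ x m → x - m + m ≡ x
        lemma₆ = solve-∀
        pointwise : ∀ a → w a * w (c - a) + w a * w (a - c) + w a * z M (c - a) ≡ w a * z L (c - a)
        pointwise a = begin
          w a * w (c - a) + w a * w (a - c) + w a * z M (c - a)
            ≡⟨ cong (_+ w a * z M (c - a)) (*-distribˡ-+ (w a) (w (c - a)) (w (a - c))) ⟨
          w a * (w (c - a) + w (a - c)) + w a * z M (c - a)
            ≡⟨ cong (λ b → w a * (w (c - a) + w b) + w a * z M (c - a)) (lemma₄ a c) ⟨
          w a * (w (c - a) + w (- (c - a))) + w a * z M (c - a)
            ≡⟨ cong (λ x → w a * x + w a * z M (c - a)) (partition (c - a)) ⟩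
          w a * (z L (c - a) - z M (c - a)) + w a * z M (c - a)
            ≡⟨ cong (_+ w a * z M (c - a)) (lemma₅ (w a) (z L (c - a)) (z M (c - a))) ⟩
          w a * z L (c - a) - w a * z M (c - a) + w a * z M (c - a)
            ≡⟨ lemma₆ (w a * z L (c - a)) (w a * z M (c - a)) ⟩
          w a * z L (c - a) ∎
        z-supported : ∀ k → SupportedOn k (z k)
        z-supported k {a} k∤a = 𝟙-no (+ k ∣? a) k∤a
        z-L-periodicₙ : Periodic n (z L)
        z-L-periodicₙ = Periodic-weaken (ℕ.∣-trans L∣M M∣n) (z-periodic L)
        z-M-periodicₙ : Periodic n (z M)
        z-M-periodicₙ = Periodic-weaken M∣n (z-periodic M)
        w⋆z-M : (w ⋆⟨ n ⟩ z M) c ≡ w c * + P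
        w⋆z-M = trans (⋆-local n w-periodic z-M-periodicₙ (z-supported M) c) (cong (w c *_) S-z-M)
        w⋆z-L : (w ⋆⟨ n ⟩ z L) c ≡ z L c * H
        w⋆z-L = trans (⋆-comm n w-periodicₙ z-L-periodicₙ c) (⋆-local n (z-periodic L) w-periodicₙ w-supported c)
        E+D+z : E c + D c + (w ⋆⟨ n ⟩ z M) c ≡ (w ⋆⟨ n ⟩ z L) c
        E+D+z = begin
          E c + D c + (w ⋆⟨ n ⟩ z M) c
            ≡⟨ cong (_+ (w ⋆⟨ n ⟩ z M) c) (S-+-distrib n (λ a → w a * w (c - a)) (λ a → w a * w (a - c))) ⟨
          S n (λ a → w a * w (c - a) + w a * w (a - c)) + (w ⋆⟨ n ⟩ z M) c
            ≡⟨ S-+-distrib n (λ a → w a * w (c - a) + w a * w (a - c)) (λ a → w a * z M (c - a)) ⟨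
          S n (λ a → w a * w (c - a) + w a * w (a - c) + w a * z M (c - a))
            ≡⟨ S-cong n pointwise ⟩
          (w ⋆⟨ n ⟩ z L) c ∎
        E+D : E c + D c ≡ z L c * H - w c * + P
        E+D = trans (lemma₁ (E c + D c) ((w ⋆⟨ n ⟩ z M) c)) (cong₂ _-_ (trans E+D+z w⋆z-L) w⋆z-M)

-- Sums over filtered lists

module ListSums {c ℓ} (Q : CommutativeRing c ℓ) where

  open import Algebra.Properties.Semiring.Sum (CommutativeRing.semiring Q) using (sum)
  open import Data.Fin.Base using (Fin; zero; suc)
  open import Data.Integer.Base using (ℤ; 0ℤ; 1ℤ)
  open import Data.List.Base using (List; []; _∷_; _++_; _∷ʳ_; filter; foldr; tabulate; upTo)
  open import Data.List.Properties using (filter-++; filter-accept; filter-reject; upTo-∷ʳ)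
  open import Data.Nat.Base as ℕ using (ℕ; zero; suc; _<_; _≤_)
  import Data.Nat.Properties as ℕ
  open import Data.Sum.Base using (inj₁; inj₂)
  open import Function.Base using (_∘_)
  open import Level using (0ℓ)
  open import Relation.Binary.PropositionalEquality as ≡ using (_≡_)
  open import Relation.Nullary using (yes; no)
  open import Relation.Unary using (Pred; Decidable)
  import Relation.Binary.Reasoning.Setoid as SetoidReasoning
  open CommutativeRing Q hiding (zero)
  open SetoidReasoning setoid
  open Counting using (𝟙)

  ∑ˡ : ∀ {A : Set} → List A → (A → Carrier) → Carrier
  ∑ˡ as f = foldr (λ a acc → f a + acc) 0# as

  -- Filtering becomes weighting by an indicator. Its values are 0 and 1, so two equations for `κ`
  -- suffice.
  ∑ˡ-filter-tabulate : (κ : ℤ → Carrier) → κ 0ℤ ≈ 0# → κ 1ℤ ≈ 1# →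
    ∀ {A : Set} {P : Pred A 0ℓ} (P? : Decidable P) (F : A → Carrier) n (h : Fin n → A) →
    ∑ˡ (filter P? (tabulate h)) F ≈ sum {n} (λ i → κ (𝟙 (P? (h i))) * F (h i))
  ∑ˡ-filter-tabulate κ κ-0 κ-1 P? F zero    h = refl
  ∑ˡ-filter-tabulate κ κ-0 κ-1 P? F (suc n) h with P? (h zero)
  ... | yes _ = +-cong (sym (trans (*-congʳ κ-1) (*-identityˡ (F (h zero))))) (∑ˡ-filter-tabulate κ κ-0 κ-1 P? F n (h ∘ suc))
  ... | no  _ = trans (∑ˡ-filter-tabulate κ κ-0 κ-1 P? F n (h ∘ suc))
                  (trans (sym (+-identityˡ _)) (+-congʳ (sym (trans (*-congʳ κ-0) (zeroˡ (F (h zero)))))))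

  ∑ˡ-∷ʳ : ∀ {A : Set} (as : List A) x F → ∑ˡ (as ∷ʳ x) F ≈ ∑ˡ as F + F x
  ∑ˡ-∷ʳ []       x F = +-comm (F x) 0#
  ∑ˡ-∷ʳ (a ∷ as) x F = trans (+-congˡ (∑ˡ-∷ʳ as x F)) (sym (+-assoc _ _ _))

  private
    filter-upTo : ∀ i M → filter (i ℕ.<?_) (upTo (suc M)) ≡ filter (i ℕ.<?_) (upTo M) ++ filter (i ℕ.<?_) (M ∷ [])
    filter-upTo i M = ≡.trans (≡.cong (filter (i ℕ.<?_)) (≡.sym (upTo-∷ʳ M))) (filter-++ (i ℕ.<?_) (upTo M) (M ∷ []))

    filter-upTo-[] : ∀ i M → M ≤ suc i → filter (i ℕ.<?_) (upTo M) ≡ []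
    filter-upTo-[] i zero    _     = ≡.refl
    filter-upTo-[] i (suc M) M≤i   = ≡.trans (filter-upTo i M)
      (≡.cong₂ _++_ (filter-upTo-[] i M (ℕ.≤-trans (ℕ.n≤1+n M) M≤i)) (filter-reject (i ℕ.<?_) (ℕ.≤⇒≯ (ℕ.≤-pred M≤i))))

  -- Each `F k` is the difference of `Z k` and `Z (suc k)`. The end term `Z M` stays on the left
  -- because it is the summand that follows the sum in the theorem.
  ∑ˡ-telescope : ∀ (F Z : ℕ → Carrier) i M → i < M → (∀ k → i < k → k < M → F k + Z (suc k) ≈ Z k) →
                 ∑ˡ (filter (i ℕ.<?_) (upTo M)) F + Z M ≈ Z (suc i)
  ∑ˡ-telescope F Z i (suc M) i<1+M step with ℕ.m≤n⇒m<n∨m≡n (ℕ.≤-pred i<1+M)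
  ... | inj₂ ≡.refl = trans (+-congʳ (reflexive (≡.cong (λ as → ∑ˡ as F) (filter-upTo-[] i (suc i) ℕ.≤-refl)))) (+-identityˡ _)
  ... | inj₁ i<M = begin
    ∑ˡ (filter (i ℕ.<?_) (upTo (suc M))) F + Z (suc M)
      ≈⟨ +-congʳ (reflexive (≡.cong (λ as → ∑ˡ as F) (≡.trans (filter-upTo i M)
           (≡.cong (filter (i ℕ.<?_) (upTo M) ++_) (filter-accept (i ℕ.<?_) i<M))))) ⟩
    ∑ˡ (filter (i ℕ.<?_) (upTo M) ∷ʳ M) F + Z (suc M)
      ≈⟨ +-congʳ (∑ˡ-∷ʳ (filter (i ℕ.<?_) (upTo M)) M F) ⟩
    ∑ˡ (filter (i ℕ.<?_) (upTo M)) F + F M + Z (suc M)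
      ≈⟨ +-assoc _ _ _ ⟩
    ∑ˡ (filter (i ℕ.<?_) (upTo M)) F + (F M + Z (suc M))
      ≈⟨ +-congˡ (step M i<M ℕ.≤-refl) ⟩
    ∑ˡ (filter (i ℕ.<?_) (upTo M)) F + Z M
      ≈⟨ ∑ˡ-telescope F Z i M i<M (λ k i<k k<M → step k i<k (ℕ.m≤n⇒m≤1+n k<M)) ⟩
    Z (suc i) ∎

-- The group ring of ℤ/n and its image in a ring where `x ^ n` is 1

module GroupRing {c ℓ} (Q : CommutativeRing c ℓ) where

  open import Algebra.Properties.CommutativeSemigroup (CommutativeRing.*-commutativeSemigroup Q) using (interchange)
  open import Algebra.Properties.Semiring.Exp (CommutativeRing.semiring Q) using (_^_; ^-homo-*; ^-assocʳ; ^-congˡ)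
  open import Data.Fin.Base using (Fin; toℕ)
  open import Data.Integer.Base as ℤ using (ℤ; +_; 0ℤ; 1ℤ)
  open import Data.Integer.DivMod using (_%ℕ_)
  import Data.Integer.Properties as ℤ
  open import Data.Integer.Tactic.RingSolver using (solve-∀)
  open import Data.Nat.Base as ℕ using (ℕ; zero; suc; NonZero)
  open import Data.Nat.DivMod using (_/_; _%_; m≡m%n+[m/n]*n)
  import Data.Nat.Properties as ℕ
  open import Data.List.Base using (filter; allFin; upTo)
  open import Function.Base using (id)
  open import Level using (0ℓ)
  open import Relation.Binary.PropositionalEquality as ≡ using (_≡_)
  import Relation.Binary.Reasoning.Setoid as SetoidReasoning
  open import Relation.Unary using (Pred; Decidable)
  open Congruences
  open Counting using (𝟙; _⋆⟨_⟩_)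

  open CommutativeRing Q
  open SetoidReasoning setoid
  open ResidueSums Q
  open ListSums Q
  open import Algebra.Properties.Semiring.Sum semiring using (sum-cong-≋)
  private module ℤΣ = ResidueSums ℤ.+-*-commutativeRing

  1^n≈1 : ∀ n → 1# ^ n ≈ 1#
  1^n≈1 zero    = refl
  1^n≈1 (suc n) = trans (*-identityˡ _) (1^n≈1 n)

  module Embedding (κ : ℤ → Carrier) (κ-cong : ∀ {a b} → a ≡ b → κ a ≈ κ b) (κ-0 : κ 0ℤ ≈ 0#) (κ-1 : κ 1ℤ ≈ 1#)
           (κ-+ : ∀ a b → κ (a ℤ.+ b) ≈ κ a + κ b) (κ-* : ∀ a b → κ (a ℤ.* b) ≈ κ a * κ b)
           (n : ℕ) .{{_ : NonZero n}} (x : Carrier) (xⁿ≈1 : x ^ n ≈ 1#) where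

    -- Extends the powers of `x` to integer exponents, in particular to the differences `c - a` that
    -- occur in a convolution.
    e : ℤ → Carrier
    e a = x ^ (a %ℕ n)

    e-periodic : Periodic n e
    e-periodic p = reflexive (≡.cong (x ^_) (%-cong n p))

    e-pos : ∀ k → e (+ k) ≈ x ^ k
    e-pos k = sym (begin
      x ^ k                            ≡⟨ ≡.cong (x ^_) (m≡m%n+[m/n]*n k n) ⟩
      x ^ (k % n ℕ.+ k / n ℕ.* n)      ≈⟨ ^-homo-* x (k % n) (k / n ℕ.* n) ⟩
      x ^ (k % n) * x ^ (k / n ℕ.* n)  ≈⟨ *-congˡ (reflexive (≡.cong (x ^_) (ℕ.*-comm (k / n) n))) ⟩
      x ^ (k % n) * x ^ (n ℕ.* (k / n)) ≈⟨ *-congˡ (^-assocʳ x n (k / n)) ⟨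
      x ^ (k % n) * (x ^ n) ^ (k / n)  ≈⟨ *-congˡ (trans (^-congˡ (k / n) xⁿ≈1) (1^n≈1 (k / n))) ⟩
      x ^ (k % n) * 1#                 ≈⟨ *-identityʳ _ ⟩
      x ^ (k % n)                      ∎)

    e-* : ∀ a b → e a * e b ≈ e (a ℤ.+ b)
    e-* a b = begin
      x ^ (a %ℕ n) * x ^ (b %ℕ n)    ≈⟨ ^-homo-* x (a %ℕ n) (b %ℕ n) ⟨
      x ^ (a %ℕ n ℕ.+ b %ℕ n)        ≈⟨ e-pos (a %ℕ n ℕ.+ b %ℕ n) ⟨
      e (+ (a %ℕ n) ℤ.+ + (b %ℕ n))  ≈⟨ e-periodic (+-cong~ (~-% a n) (~-% b n)) ⟩
      e (a ℤ.+ b)                    ∎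

    κ-S : ∀ m f → κ (ℤΣ.S m f) ≈ S m (λ a → κ (f a))
    κ-S zero    f = κ-0
    κ-S (suc m) f = trans (κ-+ (f (+ 0)) _) (+-congˡ (κ-S m (λ a → f (1ℤ ℤ.+ a))))

    -- The image of the group ring element with coefficients `f` under the homomorphism from ℤ[ℤ/n]
    -- that sends the generator to `x`.
    G : (ℤ → ℤ) → Carrier
    G f = S n (λ a → κ (f a) * e a)

    G-cong : ∀ {f g} → (∀ a → f a ≡ g a) → G f ≈ G g
    G-cong p = S-cong n (λ a → *-congʳ {e a} (κ-cong (p a)))

    G-+ : ∀ f g → G (λ a → f a ℤ.+ g a) ≈ G f + G g
    G-+ f g = trans (S-cong n (λ a → trans (*-congʳ (κ-+ (f a) (g a))) (distribʳ (e a) (κ (f a)) (κ (g a)))))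
                    (S-+-distrib n (λ a → κ (f a) * e a) (λ a → κ (g a) * e a))

    G-scale : ∀ k f → G (λ a → k ℤ.* f a) ≈ κ k * G f
    G-scale k f = trans (S-cong n (λ a → trans (*-congʳ (κ-* k (f a))) (*-assoc (κ k) (κ (f a)) (e a))))
                        (S-*ˡ n (κ k) (λ a → κ (f a) * e a))

    -- The substitution `b = c - a` shifts the inner sum. It evaluates `g` and `e` outside 0, ..., n
    -- - 1, hence the periodicity asked of `g`.
    G-⋆ : ∀ f g → ℤΣ.Periodic n g → G f * G g ≈ G (f ⋆⟨ n ⟩ g)
    G-⋆ f g g-periodic = begin
      G f * G g
        ≈⟨ S-*ʳ n (G g) (λ a → κ (f a) * e a) ⟨
      S n (λ a → (κ (f a) * e a) * G g)
        ≈⟨ S-cong n (λ a → trans (sym (S-*ˡ n (κ (f a) * e a) (λ b → κ (g b) * e b)))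
             (sym (S-shift n (h-periodic a) (ℤ.- a)))) ⟩
      S n (λ a → S n (λ c → h a (c ℤ.- a)))
        ≈⟨ S-cong n (λ a → S-cong n (λ c → h-shift a c)) ⟩
      S n (λ a → S n (λ c → κ (f a ℤ.* g (c ℤ.- a)) * e c))
        ≈⟨ S-comm n n (λ a c → κ (f a ℤ.* g (c ℤ.- a)) * e c) ⟩
      S n (λ c → S n (λ a → κ (f a ℤ.* g (c ℤ.- a)) * e c))
        ≈⟨ S-cong n (λ c → trans (S-*ʳ n (e c) (λ a → κ (f a ℤ.* g (c ℤ.- a))))
             (*-congʳ (sym (κ-S n (λ a → f a ℤ.* g (c ℤ.- a)))))) ⟩
      G (f ⋆⟨ n ⟩ g) ∎
      where
      h : ℤ → ℤ → Carrier
      h a b = (κ (f a) * e a) * (κ (g b) * e b)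

      h-periodic : ∀ a → Periodic n (h a)
      h-periodic a p = *-congˡ (*-cong (κ-cong (g-periodic p)) (e-periodic p))

      h-shift : ∀ a c → h a (c ℤ.- a) ≈ κ (f a ℤ.* g (c ℤ.- a)) * e c
      h-shift a c = begin
        (κ (f a) * e a) * (κ (g (c ℤ.- a)) * e (c ℤ.- a))  ≈⟨ interchange _ _ _ _ ⟩
        (κ (f a) * κ (g (c ℤ.- a))) * (e a * e (c ℤ.- a))  ≈⟨ *-cong (sym (κ-* (f a) _)) (e-* a (c ℤ.- a)) ⟩
        κ (f a ℤ.* g (c ℤ.- a)) * e (a ℤ.+ (c ℤ.- a))      ≡⟨ ≡.cong (λ z → κ (f a ℤ.* g (c ℤ.- a)) * e z) (lemma a c) ⟩
        κ (f a ℤ.* g (c ℤ.- a)) * e c                      ∎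
        where
        lemma : ∀ a c → a ℤ.+ (c ℤ.- a) ≡ c
        lemma = solve-∀

    ∑ˡ≈G : ∀ {P : Pred (Fin n) 0ℓ} (P? : Decidable P) f → (∀ α → 𝟙 (P? α) ≡ f (+ toℕ α)) →
           ∑ˡ (filter P? (allFin n)) (λ α → x ^ toℕ α) ≈ G f
    ∑ˡ≈G P? f P≡f = trans (∑ˡ-filter-tabulate κ κ-0 κ-1 P? (λ α → x ^ toℕ α) n id)
      (sum-cong-≋ {n} (λ α → *-cong (κ-cong (P≡f α)) (sym (e-pos (toℕ α)))))

    G-sum : ∀ {X Y f g} → X ≈ G f → Y ≈ G g → X + Y ≈ G (λ a → f a ℤ.+ g a)
    G-sum {f = f} {g} X≈ Y≈ = trans (+-cong X≈ Y≈) (sym (G-+ f g))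

    G-combination : ∀ {X Y} A B {f g} → X ≈ G f → Y ≈ G g →
                    κ A * X + κ B * Y ≈ G (λ c → A ℤ.* f c ℤ.+ B ℤ.* g c)
    G-combination A B {f} {g} X≈ Y≈ = sym (trans (G-+ (λ c → A ℤ.* f c) (λ c → B ℤ.* g c))
      (+-cong (trans (G-scale A f) (*-congˡ (sym X≈))) (trans (G-scale B g) (*-congˡ (sym Y≈)))))

    product-combination : ∀ {X Y U V} A B {f f′ g h} → ℤΣ.Periodic n f′ →
      X ≈ G f → Y ≈ G f′ → U ≈ G g → V ≈ G h →
      (∀ c → (f ⋆⟨ n ⟩ f′) c ≡ A ℤ.* g c ℤ.+ B ℤ.* h c) → X * Y ≈ κ A * U + κ B * V
    product-combination A B {f} {f′} {g} {h} f′-periodic X≈ Y≈ U≈ V≈ convolution =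
      trans (*-cong X≈ Y≈) (trans (G-⋆ f f′ f′-periodic) (trans (G-cong convolution) (sym (G-combination A B {g} {h} U≈ V≈))))

    sum-telescope : ∀ (F : ℕ → Carrier) (φ ψ : ℕ → ℤ → ℤ) i M {T} → i ℕ.< M →
      (∀ k → i ℕ.< k → k ℕ.< M → F k ≈ G (φ k)) → T ≈ G (ψ M) →
      (∀ k → i ℕ.< k → k ℕ.< M → ∀ a → φ k a ℤ.+ ψ (suc k) a ≡ ψ k a) →
      ∑ˡ (filter (i ℕ.<?_) (upTo M)) F + T ≈ G (ψ (suc i))
    sum-telescope F φ ψ i M i<M F≈ T≈ step = trans (+-congˡ T≈) (∑ˡ-telescope F (λ k → G (ψ k)) i M i<M
      (λ k i<k k<M → trans (+-congʳ (F≈ k i<k k<M)) (trans (sym (G-+ (φ k) (ψ (suc k)))) (G-cong (step k i<k k<M)))))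

-- Cosets of the powers of `l` modulo a prime power

module PowerCosets (l : ℕ) where

  open import Data.Fin.Base using (Fin; toℕ; fromℕ<)
  import Data.Fin.Properties as Fin
  open import Data.Integer.Base hiding (NonZero; suc; _≤_; _<_)
  open import Data.Integer.DivMod using (n%ℕd<d)
  open import Data.Integer.Divisibility.Signed using (_∣_; _∣?_; divides; ∣ᵤ⇒∣; ∣m⇒∣m*n; ∣-trans; ∣-refl)
  open import Data.Integer.Properties
  open import Data.Integer.Tactic.RingSolver using (solve-∀)
  open import Data.Nat.Base as ℕ using (ℕ; suc; NonZero; s≤s; _<_; _≤_)
  import Data.Nat.Divisibility as ℕ
  import Data.Nat.Properties as ℕ
  open import Data.Product.Base using (_×_; _,_; ∃-syntax)
  open import Data.Sum.Base using (inj₁; inj₂; [_,_]′)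
  open import Relation.Binary.PropositionalEquality
  import Relation.Binary.Reasoning.Setoid as SetoidReasoning
  open import Relation.Nullary using (¬_; Dec; yes; no; contradiction)
  open import Relation.Nullary.Decidable using (map′)
  open Congruences
  open Counting
  open ResidueSums +-*-commutativeRing
  open Units

  private
    module ~-Reasoning (m : ℕ) = SetoidReasoning (~-setoid m)

  private variable
    a b : ℤ
    m : ℕ

  K : ℕ → ℤ → ℤ → Set
  K m γ a = ∃[ r ] a ~ γ * (+ l) ^ r ⟨ m ⟩

  -- Opaque, because unfolding the search over Fin m makes conversion checking explode.
  opaque
    K? : ∀ m .{{_ : NonZero m}} γ a → Dec (K m γ a)
    K? m γ a = map′
      (λ (r , p) → r , ~-trans (~-sym α~a) (mk~ p))
      (λ (r , p) → r , ∣-difference (~-trans α~a p))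
      (Coset._∈C[_]? l m α γ)
      where
      α : Fin m
      α = fromℕ< (n%ℕd<d a m)
      α~a : + toℕ α ~ a ⟨ m ⟩
      α~a = ~-trans (~-reflexive (cong +_ (Fin.toℕ-fromℕ< (n%ℕd<d a m)))) (~-% a m)

  K-resp-~ : ∀ {γ} → a ~ b ⟨ m ⟩ → K m γ a → K m γ b
  K-resp-~ p (r , q) = r , ~-trans (~-sym p) q

  coset : ∀ m .{{_ : NonZero m}} → ℤ → ℤ → ℤ
  coset m γ a = 𝟙 (K? m γ a)

  module _ {r : ℕ} (r-prime : Prime r) (T : ℕ) where

    private instance
      r≢0 : NonZero r
      r≢0 = prime⇒nonZero r-prime
      r^T≢0 : NonZero (r ℕ.^ T)
      r^T≢0 = ℕ.m^n≢0 r T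

    r^-mono-∣ : ∀ {j k} → j ≤ k → r ℕ.^ j ℕ.∣ r ℕ.^ k
    r^-mono-∣ {j} {k} j≤k = ℕ.divides (r ℕ.^ (k ℕ.∸ j)) (trans (cong (r ℕ.^_) (sym (ℕ.m∸n+n≡m j≤k))) (ℕ.^-distribˡ-+-* r (k ℕ.∸ j) j))

    ~-multiple⇒∣ : ∀ {j} b → j ≤ T → a ~ + (r ℕ.^ j) * b ⟨ r ℕ.^ T ⟩ → + (r ℕ.^ j) ∣ a
    ~-multiple⇒∣ {j = j} b j≤T p = ∣-resp-~ (~-sym (~-weaken (r^-mono-∣ j≤T) p)) (∣m⇒∣m*n b (∣-refl {+ (r ℕ.^ j)}))

    -- Since `j < T`, the congruence survives modulo `r ^ suc j`; cancelling `r ^ j` there would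
    -- leave `r` dividing the unit `b`.
    ~-unit-multiple⇒∤ : ∀ {j} b → j < T → Unit (r ℕ.^ T) b → a ~ + (r ℕ.^ j) * b ⟨ r ℕ.^ T ⟩ → ¬ + (r ℕ.^ suc j) ∣ a
    ~-unit-multiple⇒∤ {a} {j} b j<T U p d = Unit⇒∤ r-prime r∣r^T U (~0⇒∣ (~-unscale (r ℕ.^ j) {{ℕ.m^n≢0 r j}}
      (subst (λ k → + (r ℕ.^ j) * b ~ + (r ℕ.^ j) * 0ℤ ⟨ k ⟩) (ℕ.*-comm r (r ℕ.^ j)) (begin
        + (r ℕ.^ j) * b    ≈⟨ ~-weaken (r^-mono-∣ j<T) p ⟨
        a                  ≈⟨ ∣⇒~0 d ⟩
        0ℤ                 ≡⟨ *-zeroʳ (+ (r ℕ.^ j)) ⟨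
        + (r ℕ.^ j) * 0ℤ   ∎))))
      where
      open ~-Reasoning (r ℕ.^ suc j)
      r∣r^T : r ℕ.∣ r ℕ.^ T
      r∣r^T = subst (ℕ._∣ r ℕ.^ T) (ℕ.^-identityʳ r) (r^-mono-∣ (ℕ.≤-trans (s≤s ℕ.z≤n) j<T))

    exact-multiple : ∀ j → + (r ℕ.^ j) ∣ a → ¬ + (r ℕ.^ suc j) ∣ a → ∃[ b ] (a ≡ + (r ℕ.^ j) * b × Unit (r ℕ.^ T) b)
    exact-multiple j (divides b refl) r^1+j∤a = b , *-comm b (+ (r ℕ.^ j)) , prime⇒Unit r-prime T r∤b
      where
      r∤b : ¬ + r ∣ b
      r∤b (divides c refl) = r^1+j∤a (divides c (trans (*-assoc c (+ r) (+ (r ℕ.^ j))) (cong (c *_) (sym (pos-* r (r ℕ.^ j))))))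

    -- Indicates that rʲ exactly divides a in ℤ/rᵀ, where 0 is at level T.
    level : ℕ → ℤ → ℤ
    level j a with j ℕ.<? T
    ... | yes _ = z (r ℕ.^ j) a - z (r ℕ.^ suc j) a
    ... | no  _ = z (r ℕ.^ j) a

    level-< : ∀ {j} → j < T → ∀ a → level j a ≡ z (r ℕ.^ j) a - z (r ℕ.^ suc j) a
    level-< {j} j<T a with j ℕ.<? T
    ... | yes _   = refl
    ... | no  j≮T = contradiction j<T j≮T

    level-T : ∀ a → level T a ≡ z (r ℕ.^ T) a
    level-T a with T ℕ.<? T
    ... | yes T<T = contradiction T<T (ℕ.<-irrefl refl)
    ... | no  _   = refl

    level-exact : ∀ {j} → j < T → ∀ {a} → + (r ℕ.^ j) ∣ a → ¬ + (r ℕ.^ suc j) ∣ a → z (r ℕ.^ j) a - z (r ℕ.^ suc j) a ≡ 1ℤ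
    level-exact {j} j<T {a} d nd = cong₂ _-_ (𝟙-yes (+ (r ℕ.^ j) ∣? a) d) (𝟙-no (+ (r ℕ.^ suc j) ∣? a) nd)

    level-deeper : ∀ j → + (r ℕ.^ suc j) ∣ a → z (r ℕ.^ j) a - z (r ℕ.^ suc j) a ≡ 0ℤ
    level-deeper {a} j d = cong₂ _-_ (𝟙-yes (+ (r ℕ.^ j) ∣? a) (∣-trans (∣ᵤ⇒∣ {+ (r ℕ.^ j)} {+ (r ℕ.^ suc j)} (r^-mono-∣ (ℕ.n≤1+n j))) d)) (𝟙-yes (+ (r ℕ.^ suc j) ∣? a) d)

    level-shallower : ∀ j → ¬ + (r ℕ.^ j) ∣ a → z (r ℕ.^ j) a - z (r ℕ.^ suc j) a ≡ 0ℤ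
    level-shallower {a} j nd = cong₂ _-_ (𝟙-no (+ (r ℕ.^ j) ∣? a) nd) (𝟙-no (+ (r ℕ.^ suc j) ∣? a)
      (λ d → nd (∣-trans (∣ᵤ⇒∣ {+ (r ℕ.^ j)} {+ (r ℕ.^ suc j)} (r^-mono-∣ (ℕ.n≤1+n j))) d)))

    -- The period is `r ^ suc j` and not merely `r ^ T`: this is why translation by an element of a
    -- higher level preserves level `j`.
    level-periodic-< : ∀ {j} → j < T → Periodic (r ℕ.^ suc j) (level j)
    level-periodic-< {j} j<T {a} {b} p = trans (level-< j<T a) (trans
      (cong₂ _-_ (z-periodic (r ℕ.^ j) (~-weaken (r^-mono-∣ (ℕ.n≤1+n j)) p)) (z-periodic (r ℕ.^ suc j) p))
      (sym (level-< j<T b)))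

    level-periodic : ∀ {j} → j ≤ T → Periodic (r ℕ.^ T) (level j)
    level-periodic {j} j≤T {a} {b} p with ℕ.m≤n⇒m<n∨m≡n j≤T

    ... | inj₁ j<T  = Periodic-weaken (r^-mono-∣ j<T) (level-periodic-< j<T) p
    ... | inj₂ refl = trans (level-T a) (trans (z-periodic (r ℕ.^ T) p) (sym (level-T b)))

    level-supported : ∀ {j} → j ≤ T → SupportedOn (r ℕ.^ j) (level j)
    level-supported {j} j≤T {a} nd with ℕ.m≤n⇒m<n∨m≡n j≤T
    ... | inj₁ j<T  = trans (level-< j<T a) (level-shallower j nd)
    ... | inj₂ refl = trans (level-T a) (𝟙-no (+ (r ℕ.^ T) ∣? a) nd)

    S-z-power : ∀ {j} → j ≤ T → S (r ℕ.^ T) (z (r ℕ.^ j)) ≡ + (r ℕ.^ (T ℕ.∸ j))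
    S-z-power {j} j≤T = trans
      (cong (λ k → S k (z (r ℕ.^ j))) (trans (cong (r ℕ.^_) (sym (ℕ.m∸n+n≡m j≤T))) (ℕ.^-distribˡ-+-* r (T ℕ.∸ j) j)))
      (S-z (r ℕ.^ (T ℕ.∸ j)) (r ℕ.^ j) {{ℕ.m^n≢0 r j}})

    S-level : ∀ {j} → j ≤ T → S (r ℕ.^ T) (level j) ≡ + φ (r ℕ.^ (T ℕ.∸ j))
    S-level {j} j≤T with ℕ.m≤n⇒m<n∨m≡n j≤T
    -- At level `T` only the zero residue remains, and `φ 1` evaluates to 1.
    ... | inj₂ refl = trans (S-cong (r ℕ.^ T) level-T) (trans (S-z-power j≤T)
                        (trans (cong (λ k → + (r ℕ.^ k)) (ℕ.n∸n≡0 T)) (cong (λ k → + φ (r ℕ.^ k)) (sym (ℕ.n∸n≡0 T)))))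
    ... | inj₁ j<T = begin
      S n (level j)                                ≡⟨ S-cong n (level-< j<T) ⟩
      S n (λ a → zⱼ a - zⱼ₊₁ a)                    ≡⟨ lemma₁ (S n (λ a → zⱼ a - zⱼ₊₁ a)) (S n zⱼ₊₁) ⟩
      S n (λ a → zⱼ a - zⱼ₊₁ a) + S n zⱼ₊₁ - S n zⱼ₊₁ ≡⟨ cong (_- S n zⱼ₊₁) (S-+-distrib n (λ a → zⱼ a - zⱼ₊₁ a) zⱼ₊₁) ⟨
      S n (λ a → zⱼ a - zⱼ₊₁ a + zⱼ₊₁ a) - S n zⱼ₊₁   ≡⟨ cong (_- S n zⱼ₊₁) (S-cong n (λ a → lemma₂ (zⱼ a) (zⱼ₊₁ a))) ⟩
      S n zⱼ - S n zⱼ₊₁                            ≡⟨ cong₂ _-_ (S-z-power j≤T) (S-z-power j<T) ⟩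
      + (r ℕ.^ (T ℕ.∸ j)) - + (r ℕ.^ e)            ≡⟨ cong (λ k → + (r ℕ.^ k) - + (r ℕ.^ e)) T∸j ⟩
      + (r ℕ.^ suc e) - + (r ℕ.^ e)                ≡⟨ cong (λ k → + k - + (r ℕ.^ e)) (φ-prime-power r-prime e) ⟨
      + φ (r ℕ.^ suc e) + + (r ℕ.^ e) - + (r ℕ.^ e) ≡⟨ lemma₁ (+ φ (r ℕ.^ suc e)) (+ (r ℕ.^ e)) ⟨
      + φ (r ℕ.^ suc e)                            ≡⟨ cong (λ k → + φ (r ℕ.^ k)) T∸j ⟨
      + φ (r ℕ.^ (T ℕ.∸ j))                        ∎
      where
      open ≡-Reasoning
      n = r ℕ.^ T
      e = T ℕ.∸ suc j
      zⱼ = z (r ℕ.^ j)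
      zⱼ₊₁ = z (r ℕ.^ suc j)
      T∸j : T ℕ.∸ j ≡ suc e
      T∸j = ℕ.+-∸-assoc 1 j<T
      lemma₁ : ∀ x y → x ≡ x + y - y
      lemma₁ = solve-∀
      lemma₂ : ∀ x y → x - y + y ≡ x
      lemma₂ = solve-∀

    coset-T : ∀ u a → coset (r ℕ.^ T) (+ (r ℕ.^ T) * u) a ≡ z (r ℕ.^ T) a
    coset-T u a = 𝟙-cong (K? (r ℕ.^ T) (+ (r ℕ.^ T) * u) a) (+ (r ℕ.^ T) ∣? a)
      (λ (k , p) → ~-multiple⇒∣ (u * (+ l) ^ k) ℕ.≤-refl (~-trans p (~-reflexive (*-assoc (+ (r ℕ.^ T)) u ((+ l) ^ k)))))
      (λ d → 0 , ~-trans (∣⇒~0 d) (~-sym (∣⇒~0 (∣m⇒∣m*n 1ℤ (∣m⇒∣m*n u (∣-refl {+ (r ℕ.^ T)}))))))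

    -- The powers of a primitive root exhaust the units, so the coset of `r ^ j * u` consists of all
    -- unit multiples of `r ^ j`. To reach `r ^ j * b`, take a power of `l` congruent to `b` divided
    -- by `u`.
    coset-level-< : PrimitiveRoot (r ℕ.^ T) (+ l) → ∀ {j} → j < T → ∀ {u} → Unit (r ℕ.^ T) u →
                    ∀ a → coset (r ℕ.^ T) (+ (r ℕ.^ j) * u) a ≡ z (r ℕ.^ j) a - z (r ℕ.^ suc j) a
    coset-level-< o {j} j<T {u} U@(unit u⁻¹ uu⁻¹~1) a = decide (+ (r ℕ.^ j) ∣? a) (+ (r ℕ.^ suc j) ∣? a)
      where
      n = r ℕ.^ T
      γ = + (r ℕ.^ j) * u
      L = + (r ℕ.^ j)
      U⁻¹ : Unit n u⁻¹
      U⁻¹ = unit u (~-trans (~-reflexive (*-comm u⁻¹ u)) uu⁻¹~1)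
      K⇒ : ∀ {k} → a ~ γ * (+ l) ^ k ⟨ n ⟩ → a ~ L * (u * (+ l) ^ k) ⟨ n ⟩
      K⇒ {k} p = ~-trans p (~-reflexive (*-assoc L u ((+ l) ^ k)))
      exact⇒K : L ∣ a → ¬ + (r ℕ.^ suc j) ∣ a → K n γ a
      exact⇒K d nd =
        let b , a≡Lb , B = exact-multiple j d nd
            k , p = primitiveRoot-generates o (Unit-* U⁻¹ B)
        in k , (begin
          a                       ≡⟨ a≡Lb ⟩
          L * b                   ≡⟨ cong (L *_) (*-identityˡ b) ⟨
          L * (1ℤ * b)            ≈⟨ *-congˡ~ L (*-congʳ~ b uu⁻¹~1) ⟨
          L * (u * u⁻¹ * b)       ≡⟨ lemma L u u⁻¹ b ⟩
          L * u * (u⁻¹ * b)       ≈⟨ *-congˡ~ γ p ⟩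
          L * u * (+ l) ^ k       ∎)
        where
        open ~-Reasoning n
        lemma : ∀ L u v b → L * (u * v * b) ≡ L * u * (v * b)
        lemma = solve-∀
      decide : Dec (L ∣ a) → Dec (+ (r ℕ.^ suc j) ∣ a) → coset n γ a ≡ z (r ℕ.^ j) a - z (r ℕ.^ suc j) a
      decide (no nd) _ = trans (𝟙-no (K? n γ a) (λ (k , p) → nd (~-multiple⇒∣ (u * (+ l) ^ k) (ℕ.<⇒≤ j<T) (K⇒ {k} p)))) (sym (level-shallower j nd))
      decide (yes d) (yes d′) = trans (𝟙-no (K? n γ a) (λ (k , p) →
        ~-unit-multiple⇒∤ (u * (+ l) ^ k) j<T (Unit-* U (Unit-^ k (order-Unit o))) (K⇒ {k} p) d′)) (sym (level-deeper j d′))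
      decide (yes d) (no nd) = trans (𝟙-yes (K? n γ a) (exact⇒K d nd)) (sym (level-exact j<T d nd))

    coset-level : PrimitiveRoot (r ℕ.^ T) (+ l) → ∀ {j} → j ≤ T → ∀ {u} → Unit (r ℕ.^ T) u →
                  ∀ a → coset (r ℕ.^ T) (+ (r ℕ.^ j) * u) a ≡ level j a
    coset-level o j≤T {u} U a = [ (λ j<T → trans (coset-level-< o j<T U a) (sym (level-< j<T a)))
                                , (λ { refl → trans (coset-T u a) (sym (level-T a)) })
                                ]′ (ℕ.m≤n⇒m<n∨m≡n j≤T)

-- Parity, powers of -1 and lifting congruences to prime powers

module OddParity where

  open import Data.Empty using (⊥-elim)
  open import Data.Integer.Base hiding (NonZero; suc; _≤_; _<_)
  open import Data.Integer.Divisibility.Signed using (_∣_; divides)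
  open import Data.Integer.Properties
  open import Data.Integer.Tactic.RingSolver using (solve-∀)
  open import Data.Nat.Base as ℕ using (ℕ; zero; suc)
  open import Data.Nat.Coprimality using (Coprime; coprime-divisor)
  import Data.Nat.Divisibility as ℕ
  import Data.Nat.Properties as ℕ
  import Data.Nat.Tactic.RingSolver as ℕ
  open import Data.Product.Base using (_,_; ∃-syntax)
  open import Data.Sum.Base using (_⊎_; inj₁; inj₂)
  open import Relation.Binary.PropositionalEquality
  open import Relation.Nullary using (¬_)
  open Congruences
  open Units

  Odd : ℕ → Set
  Odd n = ∃[ x ] n ≡ 1 ℕ.+ 2 ℕ.* x

  Odd-* : ∀ {m n} → Odd m → Odd n → Odd (m ℕ.* n)
  Odd-* (x , refl) (y , refl) = x ℕ.+ y ℕ.+ 2 ℕ.* (x ℕ.* y) , lemma x y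
    where
    lemma : ∀ x y → (1 ℕ.+ 2 ℕ.* x) ℕ.* (1 ℕ.+ 2 ℕ.* y) ≡ 1 ℕ.+ 2 ℕ.* (x ℕ.+ y ℕ.+ 2 ℕ.* (x ℕ.* y))
    lemma = ℕ.solve-∀

  Odd-^ : ∀ {m} e → Odd m → Odd (m ℕ.^ e)
  Odd-^ zero    o = 0 , refl
  Odd-^ (suc e) o = Odd-* o (Odd-^ e o)

  even-or-odd : ∀ n → (∃[ x ] n ≡ 2 ℕ.* x) ⊎ Odd n
  even-or-odd zero    = inj₁ (0 , refl)
  even-or-odd (suc n) with even-or-odd n
  ... | inj₁ (x , refl) = inj₂ (x , refl)
  ... | inj₂ (x , refl) = inj₁ (suc x , sym (ℕ.*-distribˡ-+ 2 1 x))

  Odd⇒2∤ : ∀ {n} → Odd n → ¬ 2 ℕ.∣ n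
  Odd⇒2∤ (x , refl) d with ℕ.∣⇒≤ (ℕ.∣m+n∣m⇒∣n (subst (2 ℕ.∣_) (ℕ.+-comm 1 (2 ℕ.* x)) d) (ℕ.m∣m*n x))
  ... | ℕ.s≤s ()

  Odd-∣2* : ∀ {h n} → Odd h → h ℕ.∣ 2 ℕ.* n → h ℕ.∣ n
  Odd-∣2* {h} o = coprime-divisor cop
    where
    cop : Coprime h 2
    cop {d} (d∣h , d∣2) with prime⇒irreducible prime[2] d∣2
    ... | inj₁ d≡1  = d≡1
    ... | inj₂ refl = ⊥-elim (Odd⇒2∤ o d∣h)

  -1^even : ∀ x → -1ℤ ^ (2 ℕ.* x) ≡ 1ℤ
  -1^even x = trans (sym (^-*-assoc -1ℤ 2 x)) (^-zeroˡ x)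

  -1^odd : ∀ {n} → Odd n → -1ℤ ^ n ≡ -1ℤ
  -1^odd (x , refl) = cong (_*_ -1ℤ) (-1^even x)

  neg-^ : ∀ a n → (- a) ^ n ≡ -1ℤ ^ n * a ^ n
  neg-^ a zero    = refl
  neg-^ a (suc n) = trans (cong (- a *_) (neg-^ a n)) (lemma a (-1ℤ ^ n) (a ^ n))
    where
    lemma : ∀ a e x → - a * (e * x) ≡ -1ℤ * e * (a * x)
    lemma = solve-∀

  private
    -- The cofactor `Σ a^(n-1-i) b^i` of `a - b` in `a ^ n - b ^ n`, in Horner form.
    geometric : ℕ → ℤ → ℤ → ℤ
    geometric zero    a b = 0ℤ
    geometric (suc n) a b = a ^ n + b * geometric n a b

    geometric-difference : ∀ n a b → a ^ n - b ^ n ≡ (a - b) * geometric n a b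
    geometric-difference zero    a b = sym (*-zeroʳ (a - b))
    geometric-difference (suc n) a b = begin
      a * a ^ n - b * b ^ n                                ≡⟨ lemma₁ a b (a ^ n) (b ^ n) ⟩
      (a - b) * a ^ n + b * (a ^ n - b ^ n)                ≡⟨ cong (λ x → (a - b) * a ^ n + b * x) (geometric-difference n a b) ⟩
      (a - b) * a ^ n + b * ((a - b) * geometric n a b)    ≡⟨ lemma₂ a b (a ^ n) (geometric n a b) ⟩
      (a - b) * (a ^ n + b * geometric n a b)              ∎
      where
      open ≡-Reasoning
      lemma₁ : ∀ a b x y → a * x - b * y ≡ (a - b) * x + b * (x - y)
      lemma₁ = solve-∀
      lemma₂ : ∀ a b x g → (a - b) * x + b * ((a - b) * g) ≡ (a - b) * (x + b * g)
      lemma₂ = solve-∀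

    geometric-~ : ∀ {m a b} n → a ~ b ⟨ m ⟩ → geometric (suc n) a b ~ + suc n * b ^ n ⟨ m ⟩
    geometric-~ {m} {a} {b} zero    p = ~-reflexive (cong (_+_ 1ℤ) (*-zeroʳ b))
    geometric-~ {m} {a} {b} (suc n) p = ~-trans
      (+-cong~ (^-cong~ (suc n) p) (*-congˡ~ b (geometric-~ n p)))
      (~-reflexive (lemma b (b ^ n) (+ suc n)))
      where
      lemma : ∀ b x k → b * x + b * (k * x) ≡ (1ℤ + k) * (b * x)
      lemma = solve-∀

  -- In `a ^ p - b ^ p` the factor `a - b` supplies `m`. Its cofactor supplies the extra `p`: modulo
  -- `p` all its `p` terms are equal to `b ^ (p - 1)`.
  ^p-lift : ∀ {p m a b} → p ℕ.∣ m → a ~ b ⟨ m ⟩ → a ^ p ~ b ^ p ⟨ p ℕ.* m ⟩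
  ^p-lift {zero} p∣m q = ~-refl
  ^p-lift {p@(suc n)} {m} {a} {b} p∣m q@(mk~ (divides x e)) with ~0⇒∣ p∣geometric
    where
    p∣geometric : geometric p a b ~ 0ℤ ⟨ p ⟩
    p∣geometric = ~-trans (geometric-~ n (~-weaken p∣m q)) (∣⇒~0 (divides (b ^ n) (*-comm (+ p) (b ^ n))))
  ... | divides y f = mk~ (divides (x * y) (begin
    a ^ p - b ^ p                  ≡⟨ geometric-difference p a b ⟩
    (a - b) * geometric p a b      ≡⟨ cong₂ _*_ e f ⟩
    x * + m * (y * + p)            ≡⟨ lemma x (+ m) y (+ p) ⟩
    x * y * (+ p * + m)            ≡⟨ cong (x * y *_) (pos-* p m) ⟨
    x * y * + (p ℕ.* m)            ∎))
    where
    open ≡-Reasoning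
    lemma : ∀ x m y p → x * m * (y * p) ≡ x * y * (p * m)
    lemma = solve-∀

  ^pᵉ-lift : ∀ {p a b} e → a ~ b ⟨ p ⟩ → a ^ (p ℕ.^ e) ~ b ^ (p ℕ.^ e) ⟨ p ℕ.^ suc e ⟩
  ^pᵉ-lift {p} {a} {b} zero    q = subst (λ m → a * 1ℤ ~ b * 1ℤ ⟨ m ⟩) (sym (ℕ.^-identityʳ p)) (*-congʳ~ 1ℤ q)
  ^pᵉ-lift {p} {a} {b} (suc e) q = subst₂ (λ x y → x ~ y ⟨ p ℕ.^ suc (suc e) ⟩) (power a) (power b)
    (^p-lift {p} (ℕ.m∣m*n (p ℕ.^ e)) (^pᵉ-lift e q))
    where
    power : ∀ c → (c ^ (p ℕ.^ e)) ^ p ≡ c ^ (p ℕ.^ suc e)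
    power c = trans (^-*-assoc c (p ℕ.^ e) p) (cong (c ^_) (ℕ.*-comm (p ℕ.^ e) p))

-- The powers of `l` modulo `pˢ` and the quadratic character

module HalfOrder (p k e l : ℕ) (p-prime : Prime p) (p≡3+4k : p ≡ 3 ℕ.+ 4 ℕ.* k)
  (l-order : IsOrder (p ℕ.^ suc e) (+ l) ((1 ℕ.+ 2 ℕ.* k) ℕ.* p ℕ.^ e))
  where

  open import Data.Empty using (⊥-elim)
  open import Data.Integer.Base hiding (NonZero; suc; _≤_; _<_)
  open import Data.Integer.Divisibility.Signed using (_∣_; _∣?_; divides; ∣⇒∣ᵤ; ∣m⇒∣m*n; ∣m⇒∣-m; ∣-refl)
  open import Data.Integer.Properties
  open import Data.Integer.Tactic.RingSolver using (solve-∀)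
  import Data.Nat.Divisibility as ℕ
  import Data.Nat.Properties as ℕ
  import Data.Nat.Tactic.RingSolver as ℕ
  open import Data.Product.Base using (_×_; _,_; ∃-syntax; proj₁; proj₂)
  open import Data.Sum.Base using (_⊎_; inj₁; inj₂; [_,_]′)
  import Relation.Binary.Reasoning.Setoid as SetoidReasoning
  open import Relation.Binary.PropositionalEquality
  open import Relation.Nullary using (¬_; Dec; yes; no; contradiction)
  open Congruences
  open Counting
  open OddParity
  open PowerCosets l
  open ResidueSums +-*-commutativeRing
  open Units

  private
    module ~-Reasoning (m : ℕ) = SetoidReasoning (~-setoid m)

  private variable
    a b σ τ : ℤ
    i m : ℕ

  n h : ℕ
  n = p ℕ.^ suc e
  h = (1 ℕ.+ 2 ℕ.* k) ℕ.* p ℕ.^ e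

  instance
    p≢0 : NonZero p
    p≢0 = prime⇒nonZero p-prime
    n≢0 : NonZero n
    n≢0 = ℕ.m^n≢0 p (suc e)

  p∣n : p ℕ.∣ n
  p∣n = ℕ.m∣m*n (p ℕ.^ e)

  p-odd : Odd p
  p-odd = 1 ℕ.+ 2 ℕ.* k , trans p≡3+4k (lemma k)
    where
    lemma : ∀ k → 3 ℕ.+ 4 ℕ.* k ≡ 1 ℕ.+ 2 ℕ.* (1 ℕ.+ 2 ℕ.* k)
    lemma = ℕ.solve-∀

  h-odd : Odd h
  h-odd = Odd-* (k , refl) (Odd-^ e p-odd)

  φn≡2h : φ n ≡ 2 ℕ.* h
  φn≡2h = φ≡2h k e p-prime p≡3+4k

  l-unit : Unit n (+ l)
  l-unit = order-Unit l-order

  l^h~1 : (+ l) ^ h ~ 1ℤ ⟨ n ⟩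
  l^h~1 = mk~ (proj₁ (proj₂ l-order))

  ¬-1~1 : ¬ -1ℤ ~ 1ℤ ⟨ n ⟩
  ¬-1~1 q = Odd⇒2∤ p-odd (subst (2 ℕ.∣_) (sym p≡2) ℕ.∣-refl)
    where
    p≡2 : p ≡ 2
    p≡2 with prime⇒irreducible prime[2] (∣⇒∣ᵤ {+ p} {i = -1ℤ - 1ℤ} (∣-difference (~-weaken p∣n q)))
    ... | inj₁ p≡1 = ⊥-elim (¬prime[1] (subst Prime p≡1 p-prime))
    ... | inj₂ eq  = eq

  -- Squaring would give `h ∣ 2 x`. As `h` is odd, already `h ∣ x`, so `l ^ x` would be 1 and not
  -- -1.
  ¬-1~l^ : ∀ x → ¬ -1ℤ ~ (+ l) ^ x ⟨ n ⟩
  ¬-1~l^ x q = ¬-1~1 (~-trans q l^x~1)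
    where
    l^2x~1 : (+ l) ^ (2 ℕ.* x) ~ 1ℤ ⟨ n ⟩
    l^2x~1 = begin
      (+ l) ^ (2 ℕ.* x)   ≡⟨ cong ((+ l) ^_) (ℕ.*-comm 2 x) ⟩
      (+ l) ^ (x ℕ.* 2)   ≡⟨ ^-*-assoc (+ l) x 2 ⟨
      ((+ l) ^ x) ^ 2     ≈⟨ ^-cong~ 2 q ⟨
      1ℤ                  ∎
      where open ~-Reasoning n
    l^x~1 : (+ l) ^ x ~ 1ℤ ⟨ n ⟩
    l^x~1 =
      let ℕ.divides y x≡yh = Odd-∣2* {h} {x} h-odd (order-∣ l-order l^2x~1)
      in ~-trans (~-reflexive (cong ((+ l) ^_) (trans x≡yh (ℕ.*-comm y h)))) (^-period {d = h} l^h~1 y 0)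

  -- Raising to the odd power pᵉ lifts a congruence modulo p to one modulo p¹⁺ᵉ.
  ¬-1~l^-mod-p : ∀ x → ¬ -1ℤ ~ (+ l) ^ x ⟨ p ⟩
  ¬-1~l^-mod-p x q = ¬-1~l^ (x ℕ.* p ℕ.^ e) (begin
    -1ℤ                           ≡⟨ -1^odd (Odd-^ e p-odd) ⟨
    -1ℤ ^ (p ℕ.^ e)               ≈⟨ ^pᵉ-lift e q ⟩
    ((+ l) ^ x) ^ (p ℕ.^ e)       ≡⟨ ^-*-assoc (+ l) x (p ℕ.^ e) ⟩
    (+ l) ^ (x ℕ.* p ℕ.^ e)       ∎)
    where open ~-Reasoning n

  l^-inverse : ∀ x → ∃[ y ] (+ l) ^ x * (+ l) ^ y ~ 1ℤ ⟨ n ⟩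
  -- Here `2 y` is `h - 1`, so the two exponents add up to `h x`.
  l^-inverse x = let y , h≡1+2y = h-odd in x ℕ.* (2 ℕ.* y) , (begin
    (+ l) ^ x * (+ l) ^ (x ℕ.* (2 ℕ.* y))    ≡⟨ ^-distribˡ-+-* (+ l) x (x ℕ.* (2 ℕ.* y)) ⟨
    (+ l) ^ (x ℕ.+ x ℕ.* (2 ℕ.* y))          ≡⟨ cong ((+ l) ^_) (trans (sym (ℕ.*-suc x (2 ℕ.* y))) (trans (cong (x ℕ.*_) (sym h≡1+2y)) (ℕ.*-comm x h))) ⟩
    (+ l) ^ (h ℕ.* x)                        ≈⟨ ^-period {d = h} l^h~1 x 0 ⟩
    1ℤ                                       ∎)
    where open ~-Reasoning n

  -- Multiplying by an inverse power of `l` reduces this to -1. That the powers of `l` and their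
  -- negatives stay apart even modulo `p` is why the sign of a unit depends only on its residue
  -- modulo `p`.
  ¬-l^~l^-mod-p : ∀ x y → ¬ - ((+ l) ^ x) ~ (+ l) ^ y ⟨ p ⟩
  ¬-l^~l^-mod-p x y q = let x′ , inv = l^-inverse x in ¬-1~l^-mod-p (y ℕ.+ x′) (begin
    -1ℤ                                ≈⟨ -‿cong~ (~-weaken p∣n inv) ⟨
    - ((+ l) ^ x * (+ l) ^ x′)         ≡⟨ neg-distribˡ-* ((+ l) ^ x) ((+ l) ^ x′) ⟩
    - ((+ l) ^ x) * (+ l) ^ x′         ≈⟨ *-congʳ~ ((+ l) ^ x′) q ⟩
    (+ l) ^ y * (+ l) ^ x′             ≡⟨ ^-distribˡ-+-* (+ l) y x′ ⟨
    (+ l) ^ (y ℕ.+ x′)                 ∎)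
    where open ~-Reasoning p

  -- Since h is odd and -1 is not a power of l, the order of -l is 2h = φ n.
  -l-primitive : PrimitiveRoot n (- (+ l))
  -l-primitive = subst (IsOrder n (- (+ l))) (sym φn≡2h) (odd⇒positive h-odd , ∣-difference power-one , least)
    where
    odd⇒positive : Odd h → 1 ≤ 2 ℕ.* h
    odd⇒positive (x , eq) = subst (λ z → 1 ≤ 2 ℕ.* z) (sym eq) (s≤s ℕ.z≤n)
    power-one : (- (+ l)) ^ (2 ℕ.* h) ~ 1ℤ ⟨ n ⟩
    power-one = begin
      (- (+ l)) ^ (2 ℕ.* h)                    ≡⟨ neg-^ (+ l) (2 ℕ.* h) ⟩
      -1ℤ ^ (2 ℕ.* h) * (+ l) ^ (2 ℕ.* h)      ≡⟨ cong₂ (λ x y → x * (+ l) ^ y) (-1^even h) (ℕ.*-comm 2 h) ⟩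
      1ℤ * (+ l) ^ (h ℕ.* 2)                   ≡⟨ *-identityˡ _ ⟩
      (+ l) ^ (h ℕ.* 2)                        ≈⟨ ^-period {d = h} l^h~1 2 0 ⟩
      1ℤ                                       ∎
      where open ~-Reasoning n
    least : ∀ f → 1 ≤ f → (- (+ l)) ^ f ≡ 1ℤ [mod n ] → 2 ℕ.* h ≤ f
    least f 1≤f q = by-parity f 1≤f (even-or-odd f) (mk~ q)
      where
      open ~-Reasoning n
      lemma : ∀ x → -1ℤ * (-1ℤ * x) ≡ x
      lemma = solve-∀
      by-parity : ∀ f → 1 ≤ f → (∃[ x ] f ≡ 2 ℕ.* x) ⊎ Odd f → (- (+ l)) ^ f ~ 1ℤ ⟨ n ⟩ → 2 ℕ.* h ≤ f
      by-parity f _ (inj₂ f-odd) q = ⊥-elim (¬-1~l^ f (begin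
        -1ℤ                             ≡⟨ -1^odd f-odd ⟨
        -1ℤ ^ f                         ≡⟨ *-identityʳ _ ⟨
        -1ℤ ^ f * 1ℤ                    ≈⟨ *-congˡ~ (-1ℤ ^ f) q ⟨
        -1ℤ ^ f * (- (+ l)) ^ f         ≡⟨ cong (-1ℤ ^ f *_) (neg-^ (+ l) f) ⟩
        -1ℤ ^ f * (-1ℤ ^ f * (+ l) ^ f) ≡⟨ cong (λ s → s * (s * (+ l) ^ f)) (-1^odd f-odd) ⟩
        -1ℤ * (-1ℤ * (+ l) ^ f)         ≡⟨ lemma ((+ l) ^ f) ⟩
        (+ l) ^ f                       ∎))
      by-parity .(2 ℕ.* zero) () (inj₁ (zero , refl))
      by-parity .(2 ℕ.* x) _ (inj₁ (x@(suc _) , refl)) q = ℕ.*-monoʳ-≤ 2 (ℕ.∣⇒≤ (Odd-∣2* {h} {x} h-odd (order-∣ l-order (begin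
        (+ l) ^ (2 ℕ.* x)                        ≡⟨ *-identityˡ _ ⟨
        1ℤ * (+ l) ^ (2 ℕ.* x)                   ≡⟨ cong (_* (+ l) ^ (2 ℕ.* x)) (-1^even x) ⟨
        -1ℤ ^ (2 ℕ.* x) * (+ l) ^ (2 ℕ.* x)      ≡⟨ neg-^ (+ l) (2 ℕ.* x) ⟨
        (- (+ l)) ^ (2 ℕ.* x)                    ≈⟨ q ⟩
        1ℤ                                       ∎))))

  data IsSign : ℤ → Set where
    plus  : IsSign 1ℤ
    minus : IsSign -1ℤ

  IsSign-* : IsSign σ → IsSign τ → IsSign (σ * τ)
  IsSign-* plus  plus  = plus
  IsSign-* plus  minus = minus
  IsSign-* minus plus  = minus
  IsSign-* minus minus = plus

  IsSign-square : IsSign σ → σ * σ ≡ 1ℤ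
  IsSign-square plus  = refl
  IsSign-square minus = refl

  -- The powers of l are the squares, so σ is the quadratic character of u.
  HasSign : ℤ → ℤ → Set
  HasSign σ u = IsSign σ × (∃[ r ] u ~ σ * (+ l) ^ r ⟨ n ⟩)

  -- The sign is the parity of the exponent to the primitive root `- l`, since `(- l) ^ r` is
  -- `(-1) ^ r` times `l ^ r`.
  sign-exists : ∀ {u} → Unit n u → ∃[ σ ] HasSign σ u
  sign-exists {u} U = let r , q = primitiveRoot-generates -l-primitive U in -1ℤ ^ r , sign^ r , r , ~-trans q (~-reflexive (neg-^ (+ l) r))
    where
    sign^ : ∀ r → IsSign (-1ℤ ^ r)
    sign^ zero    = plus
    sign^ (suc r) = IsSign-* minus (sign^ r)

  HasSign-1 : HasSign 1ℤ 1ℤ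
  HasSign-1 = plus , 0 , ~-refl

  HasSign-* : ∀ {u v} → HasSign σ u → HasSign τ v → HasSign (σ * τ) (u * v)
  HasSign-* {σ} {τ} {u} {v} (sσ , r , q) (sτ , r′ , q′) = IsSign-* sσ sτ , r ℕ.+ r′ , (begin
    u * v                                  ≈⟨ *-cong~ q q′ ⟩
    σ * (+ l) ^ r * (τ * (+ l) ^ r′)       ≡⟨ lemma σ ((+ l) ^ r) τ ((+ l) ^ r′) ⟩
    σ * τ * ((+ l) ^ r * (+ l) ^ r′)       ≡⟨ cong (σ * τ *_) (^-distribˡ-+-* (+ l) r r′) ⟨
    σ * τ * (+ l) ^ (r ℕ.+ r′)             ∎)
    where
    open ~-Reasoning n
    lemma : ∀ a b c d → a * b * (c * d) ≡ a * c * (b * d)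
    lemma = solve-∀

  HasSign-^ : ∀ {u} → HasSign σ u → ∀ x → HasSign (σ ^ x) (u ^ x)
  HasSign-^ s zero    = HasSign-1
  HasSign-^ s (suc x) = HasSign-* s (HasSign-^ s x)

  -- A square of a signed power of `l` is a power of `l`, so `q` cannot be the negative of one. The
  -- root `x` is given only modulo `p`, and the contradiction has to be reached there.
  quadraticResidue⇒HasSign : ∀ {q} → QuadraticResidue q p → HasSign 1ℤ (+ q)
  quadraticResidue⇒HasSign {q} (cop , x , x²~q) =
    conclude (sign-exists (Unit-modulus-^ (suc e) (Coprime⇒Unit (+ q) cop))) (sign-exists x-unit)
    where
    q-unit : Unit p (+ q)
    q-unit = Coprime⇒Unit (+ q) cop
    p∤x : ¬ + p ∣ x
    p∤x d = Unit⇒∤ p-prime ℕ.∣-refl q-unit (∣-resp-~ (mk~ {x * x} {+ q} x²~q) (∣m⇒∣m*n x d))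
    x-unit : Unit n x
    x-unit = prime⇒Unit p-prime (suc e) p∤x
    conclude : (∃[ σ ] HasSign σ (+ q)) → (∃[ τ ] HasSign τ x) → HasSign 1ℤ (+ q)
    conclude (_ , s@(plus  , _)) _ = s
    conclude (_ , minus , r , q~) (τ , sτ , r′ , x~) = ⊥-elim (¬-l^~l^-mod-p r (r′ ℕ.+ r′) (begin
      - ((+ l) ^ r)                                   ≡⟨ -1*i≡-i _ ⟨
      -1ℤ * (+ l) ^ r                                 ≈⟨ ~-weaken p∣n q~ ⟨
      + q                                             ≈⟨ mk~ x²~q ⟨
      x * x                                           ≈⟨ ~-weaken p∣n (*-cong~ x~ x~) ⟩
      τ * (+ l) ^ r′ * (τ * (+ l) ^ r′)               ≡⟨ lemma τ ((+ l) ^ r′) ⟩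
      τ * τ * ((+ l) ^ r′ * (+ l) ^ r′)               ≡⟨ cong₂ _*_ (IsSign-square sτ) (sym (^-distribˡ-+-* (+ l) r′ r′)) ⟩
      1ℤ * (+ l) ^ (r′ ℕ.+ r′)                        ≡⟨ *-identityˡ _ ⟩
      (+ l) ^ (r′ ℕ.+ r′)                             ∎))
      where
      open ~-Reasoning p
      lemma : ∀ a b → a * b * (a * b) ≡ a * a * (b * b)
      lemma = solve-∀

  -- l is a square modulo n because its order h is odd.
  quadraticNonresidue⇒HasSign : ∀ {q} → QuadraticNonresidue q p → HasSign -1ℤ (+ q)
  quadraticNonresidue⇒HasSign {q} (cop , nonsquare) =
    conclude (sign-exists (Unit-modulus-^ (suc e) (Coprime⇒Unit (+ q) cop)))
    where
    conclude : (∃[ σ ] HasSign σ (+ q)) → HasSign -1ℤ (+ q)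
    conclude (_ , s@(minus , _)) = s
    -- As `h` is `1 + 2 y`, the power `l ^ suc y` is a square root of `l`.
    conclude (_ , plus , r , q~) = let y , h≡1+2y = h-odd in ⊥-elim (nonsquare ((+ l) ^ (suc y ℕ.* r) , ∣-difference (~-weaken p∣n (begin
      (+ l) ^ (suc y ℕ.* r) * (+ l) ^ (suc y ℕ.* r)    ≡⟨ ^-distribˡ-+-* (+ l) (suc y ℕ.* r) (suc y ℕ.* r) ⟨
      (+ l) ^ (suc y ℕ.* r ℕ.+ suc y ℕ.* r)            ≡⟨ cong ((+ l) ^_) (trans (lemma y r) (cong (λ z → r ℕ.+ z ℕ.* r) (sym h≡1+2y))) ⟩
      (+ l) ^ (r ℕ.+ h ℕ.* r)                          ≈⟨ ^-period {d = h} l^h~1 r r ⟩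
      (+ l) ^ r                                        ≡⟨ *-identityˡ _ ⟨
      1ℤ * (+ l) ^ r                                   ≈⟨ q~ ⟨
      + q                                              ∎))))
      where
      open ~-Reasoning n
      lemma : ∀ y r → (1 ℕ.+ y) ℕ.* r ℕ.+ (1 ℕ.+ y) ℕ.* r ≡ r ℕ.+ (1 ℕ.+ 2 ℕ.* y) ℕ.* r
      lemma = ℕ.solve-∀

  -- Otherwise `g` would be a power of `l` and `g ^ h` would be 1, although the order of `g` is
  -- `2 h`.
  primitiveRoot⇒HasSign : ∀ {g} → PrimitiveRoot n g → HasSign -1ℤ g
  primitiveRoot⇒HasSign {g} o = conclude (sign-exists (order-Unit o))
    where
    conclude : (∃[ σ ] HasSign σ g) → HasSign -1ℤ g
    conclude (_ , s@(minus , _)) = s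
    conclude (_ , plus , r , g~) = ⊥-elim (ℕ.<⇒≱ (h<2h h-odd) (subst (_≤ h) φn≡2h
      (proj₂ (proj₂ o) h (odd⇒positive h-odd) (∣-difference g^h~1))))
      where
      odd⇒positive : Odd h → 1 ≤ h
      odd⇒positive (x , eq) = subst (1 ≤_) (sym eq) (s≤s ℕ.z≤n)
      h<2h : Odd h → h < 2 ℕ.* h
      h<2h (x , eq) = ℕ.m<m+n h (subst (0 <_) (sym (ℕ.+-identityʳ h)) (odd⇒positive h-odd))
      g^h~1 : g ^ h ~ 1ℤ ⟨ n ⟩
      g^h~1 = begin
        g ^ h                   ≈⟨ ^-cong~ h g~ ⟩
        (1ℤ * (+ l) ^ r) ^ h    ≡⟨ cong (_^ h) (*-identityˡ ((+ l) ^ r)) ⟩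
        ((+ l) ^ r) ^ h         ≡⟨ ^-*-assoc (+ l) r h ⟩
        (+ l) ^ (r ℕ.* h)       ≡⟨ cong ((+ l) ^_) (ℕ.*-comm r h) ⟩
        (+ l) ^ (h ℕ.* r)       ≈⟨ ^-period {d = h} l^h~1 r 0 ⟩
        1ℤ                      ∎
        where open ~-Reasoning n

  w : ℕ → ℤ → ℤ
  w i = coset n (+ (p ℕ.^ i))

  -- The coset absorbs the power of `l` in `u`, so only `σ` remains; being its own inverse, it moves
  -- from the generator to the argument.
  coset-sign : ∀ i {σ u} → HasSign σ u → ∀ a → coset n (+ (p ℕ.^ i) * u) a ≡ w i (σ * a)
  coset-sign i {σ} {u} (sσ , k , u~) a = 𝟙-cong (K? n (L * u) a) (K? n L (σ * a)) to from
    where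
    open ~-Reasoning n
    L = + (p ℕ.^ i)
    to : K n (L * u) a → K n L (σ * a)
    to (r , q) = k ℕ.+ r , (begin
      σ * a                                           ≈⟨ *-congˡ~ σ q ⟩
      σ * (L * u * (+ l) ^ r)                         ≈⟨ *-congˡ~ σ (*-congʳ~ ((+ l) ^ r) (*-congˡ~ L u~)) ⟩
      σ * (L * (σ * (+ l) ^ k) * (+ l) ^ r)           ≡⟨ lemma σ L ((+ l) ^ k) ((+ l) ^ r) ⟩
      σ * σ * (L * ((+ l) ^ k * (+ l) ^ r))           ≡⟨ cong₂ (λ x y → x * (L * y)) (IsSign-square sσ) (sym (^-distribˡ-+-* (+ l) k r)) ⟩
      1ℤ * (L * (+ l) ^ (k ℕ.+ r))                    ≡⟨ *-identityˡ _ ⟩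
      L * (+ l) ^ (k ℕ.+ r)                           ∎)
      where
      lemma : ∀ s L x y → s * (L * (s * x) * y) ≡ s * s * (L * (x * y))
      lemma = solve-∀
    from : K n L (σ * a) → K n (L * u) a
    from (r , q) = let k′ , inv = l^-inverse k in k′ ℕ.+ r , (begin
      a                                                       ≡⟨ *-identityˡ a ⟨
      1ℤ * a                                                  ≡⟨ cong (_* a) (IsSign-square sσ) ⟨
      σ * σ * a                                               ≡⟨ *-assoc σ σ a ⟩
      σ * (σ * a)                                             ≈⟨ *-congˡ~ σ q ⟩
      σ * (L * (+ l) ^ r)                                     ≡⟨ *-identityˡ _ ⟨
      1ℤ * (σ * (L * (+ l) ^ r))                              ≈⟨ *-congʳ~ (σ * (L * (+ l) ^ r)) inv ⟨
      (+ l) ^ k * (+ l) ^ k′ * (σ * (L * (+ l) ^ r))          ≡⟨ lemma ((+ l) ^ k) ((+ l) ^ k′) σ L ((+ l) ^ r) ⟩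
      L * (σ * (+ l) ^ k) * ((+ l) ^ k′ * (+ l) ^ r)          ≈⟨ *-congʳ~ ((+ l) ^ k′ * (+ l) ^ r) (*-congˡ~ L u~) ⟨
      L * u * ((+ l) ^ k′ * (+ l) ^ r)                        ≡⟨ cong (L * u *_) (^-distribˡ-+-* (+ l) k′ r) ⟨
      L * u * (+ l) ^ (k′ ℕ.+ r)                              ∎)
      where
      lemma : ∀ x x′ s L y → x * x′ * (s * (L * y)) ≡ L * (s * x) * (x′ * y)
      lemma = solve-∀

  w-dilate : ∀ i r a → w i ((+ l) ^ r * a) ≡ w i a
  w-dilate i r a = 𝟙-cong (K? n L ((+ l) ^ r * a)) (K? n L a) from to
    where
    L = + (p ℕ.^ i)
    lemma : ∀ x L y → x * (L * y) ≡ L * (x * y)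
    lemma = solve-∀
    shift : ∀ r a → K n L a → K n L ((+ l) ^ r * a)
    shift r a (r′ , q) = r ℕ.+ r′ , ~-trans (*-congˡ~ ((+ l) ^ r) q) (~-reflexive
      (trans (lemma ((+ l) ^ r) L ((+ l) ^ r′)) (cong (L *_) (sym (^-distribˡ-+-* (+ l) r r′)))))
    to : K n L a → K n L ((+ l) ^ r * a)
    to = shift r a
    from : K n L ((+ l) ^ r * a) → K n L a
    from κ = let r′ , inv = l^-inverse r in K-resp-~ {γ = L} (~-trans
      (~-reflexive (trans (sym (*-assoc ((+ l) ^ r′) ((+ l) ^ r) a)) (cong (_* a) (*-comm ((+ l) ^ r′) ((+ l) ^ r)))))
      (~-trans (*-congʳ~ a inv) (~-reflexive (*-identityˡ a)))) (shift r′ ((+ l) ^ r * a) κ)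

  w-top : ∀ a → w (suc e) a ≡ z n a
  w-top a = trans (cong (λ γ → coset n γ a) (sym (*-identityʳ (+ n)))) (coset-T p-prime (suc e) 1ℤ a)

  -- The two classes of level `i` modulo `pˢ`

  module Classes (i : ℕ) (i≤e : i ≤ e) where

    L M P : ℕ
    L = p ℕ.^ i
    M = p ℕ.^ suc i
    P = p ℕ.^ (e ℕ.∸ i)

    instance
      M≢0 : NonZero M
      M≢0 = ℕ.m^n≢0 p (suc i)

    n≡PM : n ≡ P ℕ.* M
    n≡PM = trans (cong (p ℕ.^_) (trans (cong suc (sym (ℕ.m∸n+n≡m i≤e))) (sym (ℕ.+-suc (e ℕ.∸ i) i))))
                 (ℕ.^-distribˡ-+-* p (e ℕ.∸ i) (suc i))

    L∣M : L ℕ.∣ M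
    L∣M = ℕ.n∣m*n p

    M∣n : M ℕ.∣ n
    M∣n = subst (M ℕ.∣_) (sym n≡PM) (ℕ.n∣m*n P)

    K⇒L∣ : K n (+ L) a → + L ∣ a
    K⇒L∣ (r , q) = ~-multiple⇒∣ p-prime (suc e) ((+ l) ^ r) (ℕ.m≤n⇒m≤1+n i≤e) q

    K⇒M∤ : K n (+ L) a → ¬ + M ∣ a
    K⇒M∤ (r , q) = ~-unit-multiple⇒∤ p-prime (suc e) ((+ l) ^ r) (s≤s i≤e) (Unit-^ r l-unit) q

    ∣-neg : ∀ {m} → + m ∣ - a → + m ∣ a
    ∣-neg {a} {m} d = subst (+ m ∣_) (neg-involutive a) (∣m⇒∣-m d)

    -- Cancelling `p ^ i` leaves a congruence modulo `p` between a power of `l` and the negative of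
    -- one. Allowing `a` and `b` to differ by a multiple of `M` makes it serve both `w-periodic` and
    -- `partition`.
    disjoint : a ~ b ⟨ M ⟩ → K n (+ L) a → ¬ K n (+ L) (- b)
    disjoint {a} {b} a~b (r , q) (r′ , q′) = ¬-l^~l^-mod-p r r′ (~-unscale L {{ℕ.m^n≢0 p i}}
      (subst (λ m → + L * - ((+ l) ^ r) ~ + L * (+ l) ^ r′ ⟨ m ⟩) (ℕ.*-comm p L) (begin
        + L * - ((+ l) ^ r)   ≡⟨ neg-distribʳ-* (+ L) ((+ l) ^ r) ⟨
        - (+ L * (+ l) ^ r)   ≈⟨ -‿cong~ (~-weaken M∣n q) ⟨
        - a                   ≈⟨ -‿cong~ a~b ⟩
        - b                   ≈⟨ ~-weaken M∣n q′ ⟩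
        + L * (+ l) ^ r′      ∎)))
      where open ~-Reasoning M

    exact⇒K : + L ∣ a → ¬ + M ∣ a → K n (+ L) a ⊎ K n (+ L) (- a)
    exact⇒K {a} d nd =
      let b , a≡Lb , U = exact-multiple p-prime (suc e) i d nd
      in conclude b a≡Lb (sign-exists U)
      where
      conclude : ∀ b → a ≡ + L * b → (∃[ σ ] HasSign σ b) → K n (+ L) a ⊎ K n (+ L) (- a)
      conclude b a≡Lb (_ , plus , r , q) = inj₁ (r , ~-trans (~-reflexive a≡Lb)
        (*-congˡ~ (+ L) (~-trans q (~-reflexive (*-identityˡ ((+ l) ^ r))))))
      conclude b a≡Lb (_ , minus , r , q) = inj₂ (r , ~-trans (-‿cong~ (~-trans (~-reflexive a≡Lb) (*-congˡ~ (+ L) q)))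
        (~-reflexive (lemma (+ L) ((+ l) ^ r))))
        where
        lemma : ∀ L x → - (L * (-1ℤ * x)) ≡ L * x
        lemma = solve-∀

    w-yes : K n (+ L) a → w i a ≡ 1ℤ
    w-yes {a} = 𝟙-yes (K? n (+ L) a)

    w-no : ¬ K n (+ L) a → w i a ≡ 0ℤ
    w-no {a} = 𝟙-no (K? n (+ L) a)

    w-supported : SupportedOn L (w i)
    w-supported L∤a = w-no (λ κ → L∤a (K⇒L∣ κ))

    w-idem : ∀ a → w i a * w i a ≡ w i a
    w-idem a = 𝟙-idem (K? n (+ L) a)

    -- A number congruent to a class element modulo `M` is again an exact multiple of `L`, so it or
    -- its negative lies in the class; `disjoint` rules out the negative.
    w-periodic : Periodic M (w i)
    w-periodic {a} {b} a~b = 𝟙-cong (K? n (+ L) a) (K? n (+ L) b) (transfer a~b) (transfer (~-sym a~b))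
      where
      transfer : ∀ {a b} → a ~ b ⟨ M ⟩ → K n (+ L) a → K n (+ L) b
      transfer a~b κ = [ (λ κ′ → κ′) , (λ κ′ → contradiction κ′ (disjoint a~b κ)) ]′
        (exact⇒K (∣-resp-~ (~-weaken L∣M a~b) (K⇒L∣ κ)) (λ d → K⇒M∤ κ (∣-resp-~ (~-sym a~b) d)))

    partition : ∀ a → w i a + w i (- a) ≡ z L a - z M a
    partition a = decide (+ L ∣? a) (+ M ∣? a)
      where
      decide : Dec (+ L ∣ a) → Dec (+ M ∣ a) → w i a + w i (- a) ≡ z L a - z M a
      decide (no L∤a) _ = trans (cong₂ _+_ (w-no (λ κ → L∤a (K⇒L∣ κ))) (w-no (λ κ → L∤a (∣-neg (K⇒L∣ κ)))))
        (sym (level-shallower p-prime (suc e) i L∤a))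
      decide (yes _) (yes M∣a) = trans (cong₂ _+_ (w-no (λ κ → K⇒M∤ κ M∣a))
        (w-no (λ κ → K⇒M∤ κ (∣m⇒∣-m M∣a)))) (sym (level-deeper p-prime (suc e) i M∣a))
      decide (yes L∣a) (no M∤a) = trans ([ (λ κ → cong₂ _+_ (w-yes κ) (w-no (disjoint (~-refl {a}) κ)))
                                         , (λ κ → cong₂ _+_ (w-no (λ κ′ → disjoint (~-refl {a}) κ′ κ)) (w-yes κ))
                                         ]′ (exact⇒K L∣a M∤a))
        (sym (level-exact p-prime (suc e) (s≤s i≤e) L∣a M∤a))

    open TwoClasses n L M P n≡PM L∣M (w i) w-periodic w-supported w-idem partition

    D-cong : ∀ {c c′} → c ~ c′ ⟨ n ⟩ → D c ≡ D c′
    D-cong q = S-cong n (λ a → cong (w i a *_) (w-periodicₙ (∸-cong~ (~-refl {a}) q)))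

    -- Multiplication by a power of `l` permutes the class and scales all differences.
    D-dilate : ∀ r c → D ((+ l) ^ r * c) ≡ D c
    D-dilate r c = begin
      S n (λ a → w i a * w i (a - u * c))
        ≡⟨ S-dilate n {λ a → w i a * w i (a - u * c)} (λ q → cong₂ _*_ (w-periodicₙ q) (w-periodicₙ (∸-cong~ q (~-refl {u * c})))) (Unit-^ r l-unit) ⟨
      S n (λ a → w i (u * a) * w i (u * a - u * c))
        ≡⟨ S-cong n (λ a → cong₂ _*_ (w-dilate i r a) (trans (cong (w i) (lemma u a c)) (w-dilate i r (a - c)))) ⟩
      S n (λ a → w i a * w i (a - c)) ∎
      where
      open ≡-Reasoning
      u = (+ l) ^ r
      lemma : ∀ u a c → u * a - u * c ≡ u * (a - c)
      lemma = solve-∀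

    D-K : ∀ {c} → K n (+ L) c → D c ≡ D (+ L)
    D-K (r , q) = trans (D-cong (~-trans q (~-reflexive (*-comm (+ L) ((+ l) ^ r))))) (D-dilate r (+ L))

    D-exact : ∀ {c} → + L ∣ c → ¬ + M ∣ c → D c ≡ D (+ L)
    D-exact {c} L∣c M∤c = [ D-K , (λ κ → trans (sym (D-neg c)) (D-K κ)) ]′ (exact⇒K L∣c M∤c)

    -- `H + H + P` counts the `p P` multiples of `L`, and `(3 + 4k) P` exceeds `2 (1 + 2k) P` by
    -- `P`.
    H≡ : H ≡ + ((1 ℕ.+ 2 ℕ.* k) ℕ.* P)
    H≡ = *-cancelˡ-≡ (+ 2) H _ (begin
      + 2 * H                                   ≡⟨ lemma₁ H (+ P) ⟩
      H + H + + P - + P                         ≡⟨ cong (_- + P) (trans 2H+P (S-z-power p-prime (suc e) (ℕ.m≤n⇒m≤1+n i≤e))) ⟩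
      + (p ℕ.^ (suc e ℕ.∸ i)) - + P             ≡⟨ cong (λ x → + x - + P) (trans (cong (p ℕ.^_) (ℕ.+-∸-assoc 1 i≤e)) (cong (ℕ._* P) p≡3+4k)) ⟩
      + ((3 ℕ.+ 4 ℕ.* k) ℕ.* P) - + P           ≡⟨ cong (λ x → + x - + P) (lemma₂ k P) ⟩
      + (2 ℕ.* ((1 ℕ.+ 2 ℕ.* k) ℕ.* P) ℕ.+ P) - + P ≡⟨ lemma₃ (+ (2 ℕ.* ((1 ℕ.+ 2 ℕ.* k) ℕ.* P))) (+ P) ⟩
      + (2 ℕ.* ((1 ℕ.+ 2 ℕ.* k) ℕ.* P))         ≡⟨ pos-* 2 ((1 ℕ.+ 2 ℕ.* k) ℕ.* P) ⟩
      + 2 * + ((1 ℕ.+ 2 ℕ.* k) ℕ.* P)           ∎)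
      where
      open ≡-Reasoning
      lemma₁ : ∀ x y → + 2 * x ≡ x + x + y - y
      lemma₁ = solve-∀
      lemma₂ : ∀ k P → (3 ℕ.+ 4 ℕ.* k) ℕ.* P ≡ 2 ℕ.* ((1 ℕ.+ 2 ℕ.* k) ℕ.* P) ℕ.+ P
      lemma₂ = ℕ.solve-∀
      lemma₃ : ∀ x y → x + y - y ≡ x
      lemma₃ = solve-∀

    H≡2kP+P : H ≡ + (k ℕ.* P) + + (k ℕ.* P) + + P
    H≡2kP+P = trans H≡ (cong +_ (lemma k P))
      where
      lemma : ∀ k P → (1 ℕ.+ 2 ℕ.* k) ℕ.* P ≡ k ℕ.* P ℕ.+ k ℕ.* P ℕ.+ P
      lemma = ℕ.solve-∀

    D-L≡ : D (+ L) ≡ + (k ℕ.* P)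
    D-L≡ = *-cancelˡ-≡ (+ 2) (D (+ L)) (+ (k ℕ.* P)) (begin
      + 2 * D (+ L)                               ≡⟨ lemma (D (+ L)) (+ P) ⟩
      D (+ L) + D (+ L) + + P - + P               ≡⟨ cong (_- + P) (trans (sym (H-formula (D (+ L)) D-exact {{H≢0}})) H≡2kP+P) ⟩
      + (k ℕ.* P) + + (k ℕ.* P) + + P - + P       ≡⟨ lemma (+ (k ℕ.* P)) (+ P) ⟨
      + 2 * + (k ℕ.* P)                           ∎)
      where
      open ≡-Reasoning
      -- Needed to cancel one factor `H` from the two counts of pairs.
      H≢0 : Data.Integer.Base.NonZero H
      H≢0 = subst Data.Integer.Base.NonZero (sym H≡) (ℕ.m*n≢0 (1 ℕ.+ 2 ℕ.* k) P {{_}} {{ℕ.m^n≢0 p (e ℕ.∸ i)}})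
      lemma : ∀ x y → + 2 * x ≡ x + x + y - y
      lemma = solve-∀

    -- The factor `w i (a - c)` is `w i (- (c - a))`, so this is the convolution of the class with
    -- its negative.
    w⋆w-neg : ∀ c → S n (λ a → w i a * w i (a - c)) ≡ + (k ℕ.* P) * (w i c + w i (- c)) + + ((1 ℕ.+ 2 ℕ.* k) ℕ.* P) * z M c
    w⋆w-neg c = trans (D-formula (+ (k ℕ.* P)) (λ d nd → trans (D-exact d nd) D-L≡) c)
                      (cong (λ x → + (k ℕ.* P) * (w i c + w i (- c)) + x * z M c) H≡)

    w⋆w : ∀ c → (w i ⋆⟨ n ⟩ w i) c ≡ + (k ℕ.* P) * w i c + + (suc k ℕ.* P) * w i (- c)
    w⋆w c = trans (E-formula (+ (k ℕ.* P)) (λ d nd → trans (D-exact d nd) D-L≡) H≡2kP+P c)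
                  (cong (λ x → + (k ℕ.* P) * w i c + + x * w i (- c)) (ℕ.+-comm (k ℕ.* P) P))

-- Factoring a coset modulo a product of coprime moduli

module CosetCRT where

  open import Data.Integer.Base hiding (NonZero; suc; _≤_; _<_)
  open import Data.Integer.Properties
  open import Data.Nat.Base as ℕ using (ℕ; suc; NonZero; _≤_)
  open import Data.Nat.Coprimality as Coprimality using (Coprime; coprime-Bézout)
  open import Data.Nat.GCD using (module Bézout)
  import Data.Nat.Divisibility as ℕ
  import Data.Nat.Properties as ℕ
  import Data.Nat.Tactic.RingSolver as ℕ
  open import Data.Product.Base using (_×_; _,_; ∃-syntax)
  open import Relation.Binary.PropositionalEquality
  open import Relation.Nullary using (Dec; yes; no)
  open Congruences
  open Counting
  open Units

  coprime-inverse : ∀ {h f} → 1 ≤ h → 1 ≤ f → Coprime h f → ∃[ u ] ∃[ v ] f ℕ.* u ≡ 1 ℕ.+ h ℕ.* v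
  coprime-inverse {suc h} {suc f} _ _ c with coprime-Bézout c
  ... | Bézout.-+ x y eq = y , x , trans (ℕ.*-comm (suc f) y) (trans (sym eq) (cong suc (ℕ.*-comm x (suc h))))
  -- Here `suc f * y` is -1 modulo `suc h`, so `u` has to represent `- y`. Since `h` is -1 modulo
  -- `suc h`, this is `y * h`; the added modulus keeps `v` a natural number.
  ... | Bézout.+- x y eq = y ℕ.* h ℕ.+ suc h , x ℕ.* h ℕ.+ f , (begin
    suc f ℕ.* (y ℕ.* h ℕ.+ suc h)                     ≡⟨ lemma₁ f y h ⟩
    1 ℕ.+ (1 ℕ.+ y ℕ.* suc f) ℕ.* h ℕ.+ suc h ℕ.* f   ≡⟨ cong (λ z → 1 ℕ.+ z ℕ.* h ℕ.+ suc h ℕ.* f) eq ⟩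
    1 ℕ.+ x ℕ.* suc h ℕ.* h ℕ.+ suc h ℕ.* f           ≡⟨ lemma₂ x h f ⟩
    1 ℕ.+ suc h ℕ.* (x ℕ.* h ℕ.+ f)                   ∎)
    where
    open ≡-Reasoning
    lemma₁ : ∀ f y h → (1 ℕ.+ f) ℕ.* (y ℕ.* h ℕ.+ (1 ℕ.+ h)) ≡ 1 ℕ.+ (1 ℕ.+ y ℕ.* (1 ℕ.+ f)) ℕ.* h ℕ.+ (1 ℕ.+ h) ℕ.* f
    lemma₁ = ℕ.solve-∀
    lemma₂ : ∀ x h f → 1 ℕ.+ x ℕ.* (1 ℕ.+ h) ℕ.* h ℕ.+ (1 ℕ.+ h) ℕ.* f ≡ 1 ℕ.+ (1 ℕ.+ h) ℕ.* (x ℕ.* h ℕ.+ f)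
    lemma₂ = ℕ.solve-∀

  -- The Chinese remainder theorem for exponents: `f u` is 1 modulo `h` and 0 modulo `f`, and `h v`
  -- the other way round, so `r₁ f u + r₂ h v` is `r₁` modulo `h` and `r₂` modulo `f`.
  common-exponent : ∀ {a m₁ m₂ h f} → 1 ≤ h → 1 ≤ f → Coprime h f → a ^ h ~ 1ℤ ⟨ m₁ ⟩ → a ^ f ~ 1ℤ ⟨ m₂ ⟩ →
                    ∀ r₁ r₂ → ∃[ r ] (a ^ r ~ a ^ r₁ ⟨ m₁ ⟩ × a ^ r ~ a ^ r₂ ⟨ m₂ ⟩)
  common-exponent {a} {m₁} {m₂} {h} {f} 1≤h 1≤f c aʰ~1 aᶠ~1 r₁ r₂ =
    let u , w , fu≡1+hw = coprime-inverse 1≤h 1≤f c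
        v , x , hv≡1+fx = coprime-inverse 1≤f 1≤h (Coprimality.sym c)
    in r₁ ℕ.* (f ℕ.* u) ℕ.+ r₂ ℕ.* (h ℕ.* v)
     , subst (λ z → a ^ z ~ a ^ r₁ ⟨ m₁ ⟩)
         (trans (lemma r₁ h w r₂ v) (cong (λ z → r₁ ℕ.* z ℕ.+ r₂ ℕ.* (h ℕ.* v)) (sym fu≡1+hw)))
         (^-period {d = h} aʰ~1 (w ℕ.* r₁ ℕ.+ v ℕ.* r₂) r₁)
     , subst (λ z → a ^ z ~ a ^ r₂ ⟨ m₂ ⟩)
         (trans (lemma r₂ f x r₁ u) (trans (ℕ.+-comm _ (r₁ ℕ.* (f ℕ.* u))) (cong (λ z → r₁ ℕ.* (f ℕ.* u) ℕ.+ r₂ ℕ.* z) (sym hv≡1+fx))))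
         (^-period {d = f} aᶠ~1 (x ℕ.* r₂ ℕ.+ u ℕ.* r₁) r₂)
    where
    lemma : ∀ r h w s v → r ℕ.+ h ℕ.* (w ℕ.* r ℕ.+ v ℕ.* s) ≡ r ℕ.* (1 ℕ.+ h ℕ.* w) ℕ.+ s ℕ.* (h ℕ.* v)
    lemma = ℕ.solve-∀

  𝟙-× : ∀ {P Q R : Set} (d : Dec P) (d₁ : Dec Q) (d₂ : Dec R) → (P → Q × R) → (Q → R → P) → 𝟙 d ≡ 𝟙 d₁ * 𝟙 d₂
  𝟙-× d (yes q) (yes r) _  from = 𝟙-yes d (from q r)
  𝟙-× d (yes q) (no ¬r) to _    = 𝟙-no d (λ p → ¬r (let _ , r = to p in r))
  𝟙-× d (no ¬q) d₂      to _    = trans (𝟙-no d (λ p → ¬q (let q , _ = to p in q))) (sym (*-zeroˡ (𝟙 d₂)))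

  module _ (l : ℕ) where

    open PowerCosets l

    -- Membership modulo each factor gives its own exponent of `l`; coprimality of the two orders
    -- merges them into one.
    coset-CRT : ∀ m₁ m₂ .{{_ : NonZero m₁}} .{{_ : NonZero m₂}} .{{_ : NonZero (m₁ ℕ.* m₂)}} {h f} →
                Unit m₁ (+ m₂) → Coprime h f → IsOrder m₁ (+ l) h → IsOrder m₂ (+ l) f →
                ∀ γ a → coset (m₁ ℕ.* m₂) γ a ≡ coset m₁ γ a * coset m₂ γ a
    coset-CRT m₁ m₂ {h} {f} U c (1≤h , lʰ~1 , _) (1≤f , lᶠ~1 , _) γ a =
      𝟙-× (K? (m₁ ℕ.* m₂) γ a) (K? m₁ γ a) (K? m₂ γ a)
        (λ (r , p) → (r , ~-weaken (ℕ.m∣m*n m₂) p) , (r , ~-weaken (ℕ.n∣m*n m₁) p))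
        (λ (r₁ , p₁) (r₂ , p₂) →
          let r , q₁ , q₂ = common-exponent {+ l} {m₁} {m₂} 1≤h 1≤f c (mk~ lʰ~1) (mk~ lᶠ~1) r₁ r₂
          in r , ~-coprime-* U (~-trans p₁ (*-congˡ~ γ (~-sym q₁))) (~-trans p₂ (*-congˡ~ γ (~-sym q₂))))

-- Equality in a quotient ring

module Quotients {c ℓ} (R : CommutativeRing c ℓ) (m : CommutativeRing.Carrier R) where

  open CommutativeRing R
  open import Algebra.Definitions.RawMagma *-rawMagma using (_,_)
  private module Q = CommutativeRing (R /⟨ m ⟩)

  ≈⇒≈/ : ∀ {x y} → x ≈ y → x Q.≈ y
  ≈⇒≈/ {x} {y} x≈y = 0# , trans (zeroˡ m) (sym (trans (+-congʳ x≈y) (-‿inverseʳ y)))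

  modulus : ∀ {x y} → x - y ≈ m → x Q.≈ y
  modulus {x} {y} p = 1# , trans (*-identityˡ m) (sym p)

-- Coset sums as images of indicator functions

module CosetSumsInGroupRing (p q s t l : ℕ) (g : ℤ) .{{n≢0 : NonZero (p ℕ.^ s ℕ.* q ℕ.^ t)}} where

  open import Data.Fin.Base using (toℕ)
  open import Data.Integer.Base as ℤ using (0ℤ; 1ℤ)
  import Data.Integer.Properties as ℤ
  open import Data.Product.Base using (_,_)
  open import Relation.Binary.PropositionalEquality as ≡ using (_≡_)
  open Congruences
  open Counting
  open CosetSums p q s t l g hiding (_≈_)
  open PowerCosets l

  module Q = CommutativeRing 𝔽[x]/⟨xⁿ-1⟩
  open Q using (_≈_)
  private
    module 𝔽l = CommutativeRing (𝔽 l)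
    module F = Polynomial (𝔽 l)
    module Fx = CommutativeRing F.polynomialRing
  open import Algebra.Properties.Semiring.Exp Q.semiring using (_^_)
  open import Algebra.Properties.Semiring.Exp Fx.semiring using () renaming (_^_ to _^ₓ_)
  open Quotients F.polynomialRing (F.X ^ₓ n Fx.- Fx.1#)

  κ : ℤ → Carrier
  κ = F.const

  κ-cong : ∀ {a b} → a ≡ b → κ a ≈ κ b
  κ-cong {a} ≡.refl = Q.refl {κ a}

  κ-0 : κ 0ℤ ≈ Q.0#
  κ-0 = ≈⇒≈/ {κ 0ℤ} {Q.0#} (F.mk≋ λ { zero → 𝔽l.refl {0ℤ} ; (suc _) → 𝔽l.refl {0ℤ} })

  κ-1 : κ 1ℤ ≈ Q.1#
  κ-1 = Q.refl {Q.1#}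

  κ-+ : ∀ a b → κ (a ℤ.+ b) ≈ κ a ⊞ κ b
  κ-+ a b = Q.refl {κ (a ℤ.+ b)}

  κ-* : ∀ a b → κ (a ℤ.* b) ≈ κ a ⊠ κ b
  κ-* a b = ≈⇒≈/ {κ (a ℤ.* b)} {κ a ⊠ κ b} (F.mk≋ λ { zero → 𝔽l.sym {a ℤ.* b ℤ.+ 0ℤ} {a ℤ.* b} (𝔽l.+-identityʳ (a ℤ.* b)) ; (suc _) → 𝔽l.refl {0ℤ} })

  -- The polynomial ring and its quotient share carrier and multiplication, so the two powers are
  -- the same polynomial.
  ^≡^ₓ : ∀ k → F.X ^ k ≡ F.X ^ₓ k
  ^≡^ₓ zero    = ≡.refl
  ^≡^ₓ (suc k) = ≡.cong (F.X F.⊗_) (^≡^ₓ k)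

  xⁿ≈1 : F.X ^ n ≈ Q.1#
  xⁿ≈1 = modulus {F.X ^ n} {Q.1#} (Fx.reflexive (≡.cong (Fx._- Fx.1#) (^≡^ₓ n)))

  open GroupRing 𝔽[x]/⟨xⁿ-1⟩ using (module Embedding)
  open Embedding κ (λ {a} {b} → κ-cong {a} {b}) κ-0 κ-1 κ-+ κ-* n F.X xⁿ≈1 public
    using (G; G-sum; ∑ˡ≈G; product-combination; sum-telescope)

  cosetSum≈G : ∀ {γ f} → (∀ a → coset n γ a ≡ f a) → cosetSum γ ≈ G f
  cosetSum≈G {γ} {f} coset≡f = ∑ˡ≈G (_∈C[ γ ]?) f (λ α → ≡.trans
    (𝟙-cong (α ∈C[ γ ]?) (K? n γ (+ toℕ α)) (λ (r , c) → r , mk~ c) (λ (r , c) → r , ∣-difference c)) (coset≡f (+ toℕ α)))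

-- Products of coset sums

module CosetProducts (e k t p q l : ℕ) (g : ℤ) (p-prime : Prime p) (q-prime : Prime q) (p≢q : p ≢ q)
  (p≡3+4k : p ≡ 3 ℕ.+ 4 ℕ.* k)
  (l-order-p : IsOrder (p ℕ.^ suc e) (+ l) ((1 ℕ.+ 2 ℕ.* k) ℕ.* p ℕ.^ e))
  (l-order-q : PrimitiveRoot (q ℕ.^ t) (+ l))
  (h-φ-coprime : Coprime ((1 ℕ.+ 2 ℕ.* k) ℕ.* p ℕ.^ e) (φ (q ℕ.^ t)))
  (g-order-p : PrimitiveRoot (p ℕ.^ suc e) g) (g-order-q : PrimitiveRoot (q ℕ.^ t) g)
  where

  open import Data.Integer.Base as ℤ using (-_; _+_; _-_; _*_; _^_; -1ℤ)
  open import Data.Integer.Divisibility.Signed using (_∣_; _∣?_; ∣⇒∣ᵤ; ∣n⇒∣m*n)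
  open import Data.Integer.Properties
  open import Data.Integer.Tactic.RingSolver using (solve-∀)
  import Data.Nat.Properties as ℕ
  import Data.Nat.Divisibility as ℕ
  open import Data.Product.Base using (proj₁)
  open import Data.Sum.Base using (inj₁; inj₂)
  open import Relation.Binary.PropositionalEquality
  open import Relation.Nullary using (¬_)
  open Congruences
  open Counting
  open PowerCosets l
  open ResidueSums +-*-commutativeRing
  open Units
  open HalfOrder p k e l p-prime p≡3+4k l-order-p hiding (n; n≢0)

  m₁ m₂ : ℕ
  m₁ = p ℕ.^ suc e
  m₂ = q ℕ.^ t

  private instance
    q≢0 : NonZero q
    q≢0 = prime⇒nonZero q-prime
    m₁≢0 : NonZero m₁
    m₁≢0 = ℕ.m^n≢0 p (suc e)
    m₂≢0 : NonZero m₂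
    m₂≢0 = ℕ.m^n≢0 q t
    n≢0 : NonZero (m₁ ℕ.* m₂)
    n≢0 = ℕ.m*n≢0 m₁ m₂

  open CosetSums p q (suc e) t l g
  open CosetSumsInGroupRing p q (suc e) t l g

  pos-^ : ∀ a j → + (a ℕ.^ j) ≡ (+ a) ^ j
  pos-^ a zero    = refl
  pos-^ a (suc j) = trans (pos-* a (a ℕ.^ j)) (cong (+ a *_) (pos-^ a j))

  distinct-primes-∤ : ∀ {a b} → Prime a → Prime b → a ≢ b → ¬ + a ∣ + b
  distinct-primes-∤ {a} {b} a-prime b-prime a≢b d with prime⇒irreducible b-prime (∣⇒∣ᵤ {+ a} {+ b} d)
  ... | inj₁ a≡1 = ¬prime[1] (subst Prime a≡1 a-prime)
  ... | inj₂ a≡b = a≢b a≡b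

  q-unit : Unit m₁ (+ q)
  q-unit = prime⇒Unit p-prime (suc e) (distinct-primes-∤ p-prime q-prime p≢q)

  p-unit : Unit m₂ (+ p)
  p-unit = prime⇒Unit q-prime t (distinct-primes-∤ q-prime p-prime (λ eq → p≢q (sym eq)))

  pⁱ-unit : ∀ i → Unit m₂ (+ (p ℕ.^ i))
  pⁱ-unit i = subst (Unit m₂) (sym (pos-^ p i)) (Unit-^ i p-unit)

  m₂-unit : Unit m₁ (+ m₂)
  m₂-unit = subst (Unit m₁) (sym (pos-^ q t)) (Unit-^ t q-unit)

  lev : ℕ → ℤ → ℤ
  lev = level q-prime t

  module _ {j : ℕ} (j≤t : j ≤ t) where

    -- The generator is read in two ways: modulo `pˢ` as `p ^ i` times the unit `u`, which contains
    -- the power of `q`, and modulo `qᵗ` as `q ^ j` times the unit `v`, which contains the power of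
    -- `p`. A factor `g` joins both units.
    coset≡ : ∀ i {γ u v σ} → γ ≡ + (p ℕ.^ i) * u → γ ≡ + (q ℕ.^ j) * v → HasSign σ u → Unit m₂ v →
             ∀ a → coset n γ a ≡ w i (σ * a) * lev j a
    coset≡ i {γ} {u} {v} γ≡₁ γ≡₂ sign V a = trans
      (coset-CRT l m₁ m₂ m₂-unit h-φ-coprime l-order-p l-order-q γ a)
      (cong₂ _*_ (trans (cong (λ z → coset m₁ z a) γ≡₁) (coset-sign i sign a))
                 (trans (cong (λ z → coset m₂ z a) γ≡₂) (coset-level q-prime t l-order-q j≤t V a)))
      where open CosetCRT using (coset-CRT)

    module _ {ε : ℤ} (ε-sign : HasSign ε (+ q)) where

      qʲ-sign : HasSign (ε ^ j) (+ (q ℕ.^ j))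
      qʲ-sign = subst (HasSign (ε ^ j)) (sym (pos-^ q j)) (HasSign-^ ε-sign j)

      χ-coset : ∀ i a → coset n (+ (p ℕ.^ i ℕ.* q ℕ.^ j)) a ≡ w i (ε ^ j * a) * lev j a
      χ-coset i = coset≡ i (pos-* (p ℕ.^ i) (q ℕ.^ j))
        (trans (pos-* (p ℕ.^ i) (q ℕ.^ j)) (*-comm (+ (p ℕ.^ i)) (+ (q ℕ.^ j)))) qʲ-sign (pⁱ-unit i)

      -- Modulo `pˢ` the factor `g` contributes the sign -1; modulo `qᵗ` it is a unit, and the coset
      -- there depends only on the level.
      χ*-coset : ∀ i a → coset n (+ (p ℕ.^ i ℕ.* q ℕ.^ j) * g) a ≡ w i (- (ε ^ j * a)) * lev j a
      χ*-coset i a = trans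
        (coset≡ i (trans (cong (_* g) (pos-* (p ℕ.^ i) (q ℕ.^ j))) (*-assoc (+ (p ℕ.^ i)) (+ (q ℕ.^ j)) g))
          (trans (cong (_* g) (pos-* (p ℕ.^ i) (q ℕ.^ j))) (lemma₁ (+ (p ℕ.^ i)) (+ (q ℕ.^ j)) g))
          (HasSign-* qʲ-sign (primitiveRoot⇒HasSign g-order-p)) (Unit-* (pⁱ-unit i) (order-Unit g-order-q)) a)
        (cong (λ b → w i b * lev j a) (lemma₂ (ε ^ j) a))
        where
        lemma₁ : ∀ x y z → x * y * z ≡ y * (x * z)
        lemma₁ = solve-∀
        lemma₂ : ∀ x y → x * -1ℤ * y ≡ - (x * y)
        lemma₂ = solve-∀

      χ≈G : ∀ i → χ i j Q.≈ G (λ a → w i (ε ^ j * a) * lev j a)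
      χ≈G i = cosetSum≈G (χ-coset i)

      χ*≈G : ∀ i → χ* i j Q.≈ G (λ a → w i (- (ε ^ j * a)) * lev j a)
      χ*≈G i = cosetSum≈G (χ*-coset i)

  IsSign-unit : ∀ {σ} → IsSign σ → Unit m₁ σ
  IsSign-unit {σ} sσ = unit σ (~-reflexive (IsSign-square sσ))

  z-sign : ∀ m {σ} → IsSign σ → ∀ a → z m (σ * a) ≡ z m a
  z-sign m {σ} sσ a = 𝟙-cong (+ m ∣? σ * a) (+ m ∣? a)
    (λ d → subst (+ m ∣_) (trans (sym (*-assoc σ σ a)) (trans (cong (_* a) (IsSign-square sσ)) (*-identityˡ a))) (∣n⇒∣m*n σ d))
    (∣n⇒∣m*n σ)

  ⋆-factor : ∀ {A A′ B B′ : ℤ → ℤ} → Periodic m₁ A → Periodic m₁ A′ → Periodic m₂ B → Periodic m₂ B′ →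
             ∀ c → ((λ a → A a * B a) ⋆⟨ n ⟩ (λ a → A′ a * B′ a)) c ≡ (A ⋆⟨ m₁ ⟩ A′) c * (B ⋆⟨ m₂ ⟩ B′) c
  ⋆-factor {A} {A′} {B} {B′} A-per A′-per B-per B′-per c = trans
    (S-cong n (λ a → lemma (A a) (B a) (A′ (c - a)) (B′ (c - a))))
    (S-coprime-* m₁ m₂ {λ a → A a * A′ (c - a)} {λ a → B a * B′ (c - a)} m₂-unit
      (λ r → cong₂ _*_ (A-per r) (A′-per (∸-cong~ (~-refl {c}) r)))
      (λ r → cong₂ _*_ (B-per r) (B′-per (∸-cong~ (~-refl {c}) r))))
    where
    lemma : ∀ a b a′ b′ → a * b * (a′ * b′) ≡ (a * a′) * (b * b′)
    lemma = solve-∀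

  -- As `j < j′`, the period `q ^ suc j` of level `j` divides `q ^ j′`. Each element of level `j′`
  -- therefore contributes `lev j c`.
  lev⋆lev : ∀ {j j′} → j < j′ → j′ ≤ t → ∀ c → (lev j ⋆⟨ m₂ ⟩ lev j′) c ≡ lev j c * + φ (q ℕ.^ (t ℕ.∸ j′))
  lev⋆lev {j} {j′} j<j′ j′≤t c = trans
    (⋆-local m₂ (Periodic-weaken (r^-mono-∣ q-prime t j<j′) (level-periodic-< q-prime t (ℕ.<-≤-trans j<j′ j′≤t)))
      (level-periodic q-prime t j′≤t) (level-supported q-prime t j′≤t) c)
    (cong (lev j c *_) (S-level q-prime t j′≤t))

  module Products (i j j′ : ℕ) (i≤e : i ≤ e) (j<j′ : j < j′) (j′≤t : j′ ≤ t) {ε : ℤ} (ε-sign : HasSign ε (+ q)) where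

    open Classes i i≤e

    private
      j≤t : j ≤ t
      j≤t = ℕ.≤-trans (ℕ.<⇒≤ j<j′) j′≤t
      N : ℕ
      N = φ (q ℕ.^ (t ℕ.∸ j′))
      σ : ℤ
      σ = ε ^ j
      σ-IsSign : IsSign σ
      σ-IsSign = proj₁ (HasSign-^ ε-sign j)
      χf χf* : ℕ → ℤ → ℤ
      χf  i a = w i (σ * a) * lev j a
      χf* i a = w i (- (σ * a)) * lev j a
      χf*′ : ℤ → ℤ
      χf*′ a = w i (- (ε ^ j′ * a)) * lev j′ a

    w-periodic-m₁ : Periodic m₁ (w i)
    w-periodic-m₁ = Periodic-weaken M∣n w-periodic

    ws-periodic : ∀ τ → Periodic m₁ (λ a → w i (τ * a))
    ws-periodic τ r = w-periodic-m₁ (*-congˡ~ τ r)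

    ws-neg-periodic : ∀ τ → Periodic m₁ (λ a → w i (- (τ * a)))
    ws-neg-periodic τ r = w-periodic-m₁ (-‿cong~ (*-congˡ~ τ r))

    χf*′-periodic : Periodic n χf*′
    χf*′-periodic r = cong₂ _*_ (ws-neg-periodic (ε ^ j′) (~-weaken (ℕ.m∣m*n m₂) r))
                                (level-periodic q-prime t j′≤t (~-weaken (ℕ.n∣m*n m₁) r))

    χf⋆χf*′ : ∀ c → (χf i ⋆⟨ n ⟩ χf*′) c ≡ ((λ a → w i (σ * a)) ⋆⟨ m₁ ⟩ (λ a → w i (- (ε ^ j′ * a)))) c * (lev j c * + N)
    χf⋆χf*′ c = trans
      (⋆-factor {λ a → w i (σ * a)} {λ a → w i (- (ε ^ j′ * a))} {lev j} {lev j′}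
        (ws-periodic σ) (ws-neg-periodic (ε ^ j′)) (level-periodic q-prime t j≤t) (level-periodic q-prime t j′≤t) c)
      (cong (((λ a → w i (σ * a)) ⋆⟨ m₁ ⟩ (λ a → w i (- (ε ^ j′ * a)))) c *_) (lev⋆lev j<j′ j′≤t c))

    -- The starred factor carries a minus sign, so equal powers of `ε` pair a class with its
    -- negative. Substituting `σ a` for `a` then gives the difference count at `σ c`.
    opposite-classes : ε ^ j′ ≡ ε ^ j → ∀ c →
      ((λ a → w i (σ * a)) ⋆⟨ m₁ ⟩ (λ a → w i (- (ε ^ j′ * a)))) c ≡
      + (k ℕ.* P) * (w i (σ * c) + w i (- (σ * c))) + + ((1 ℕ.+ 2 ℕ.* k) ℕ.* P) * z M c
    opposite-classes eq c = begin
      S m₁ (λ a → w i (σ * a) * w i (- (ε ^ j′ * (c - a))))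
        ≡⟨ S-cong m₁ (λ a → cong (λ b → w i (σ * a) * w i b) (trans (cong (λ τ → - (τ * (c - a))) eq) (lemma σ c a))) ⟩
      S m₁ (λ a → w i (σ * a) * w i (σ * a - σ * c))
        ≡⟨ S-dilate m₁ {λ a → w i a * w i (a - σ * c)} (λ r → cong₂ _*_ (w-periodic-m₁ r) (w-periodic-m₁ (∸-cong~ r (~-refl {σ * c})))) (IsSign-unit σ-IsSign) ⟩
      S m₁ (λ a → w i a * w i (a - σ * c))
        ≡⟨ w⋆w-neg (σ * c) ⟩
      + (k ℕ.* P) * (w i (σ * c) + w i (- (σ * c))) + + ((1 ℕ.+ 2 ℕ.* k) ℕ.* P) * z M (σ * c)
        ≡⟨ cong (λ x → + (k ℕ.* P) * (w i (σ * c) + w i (- (σ * c))) + + ((1 ℕ.+ 2 ℕ.* k) ℕ.* P) * x) (z-sign M σ-IsSign c) ⟩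
      + (k ℕ.* P) * (w i (σ * c) + w i (- (σ * c))) + + ((1 ℕ.+ 2 ℕ.* k) ℕ.* P) * z M c ∎
      where
      open ≡-Reasoning
      lemma : ∀ s c a → - (s * (c - a)) ≡ s * a - s * c
      lemma = solve-∀

    -- The minus sign of the starred factor cancels against that of the power of `ε`, which leaves a
    -- class convolved with itself.
    equal-classes : ε ^ j′ ≡ - (ε ^ j) → ∀ c →
      ((λ a → w i (σ * a)) ⋆⟨ m₁ ⟩ (λ a → w i (- (ε ^ j′ * a)))) c ≡
      + (k ℕ.* P) * w i (σ * c) + + (suc k ℕ.* P) * w i (- (σ * c))
    equal-classes eq c = begin
      S m₁ (λ a → w i (σ * a) * w i (- (ε ^ j′ * (c - a))))
        ≡⟨ S-cong m₁ (λ a → cong (λ b → w i (σ * a) * w i b) (trans (cong (λ τ → - (τ * (c - a))) eq) (lemma σ c a))) ⟩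
      S m₁ (λ a → w i (σ * a) * w i (σ * c - σ * a))
        ≡⟨ S-dilate m₁ {λ a → w i a * w i (σ * c - a)} (λ r → cong₂ _*_ (w-periodic-m₁ r) (w-periodic-m₁ (∸-cong~ (~-refl {σ * c}) r))) (IsSign-unit σ-IsSign) ⟩
      S m₁ (λ a → w i a * w i (σ * c - a))
        ≡⟨ w⋆w (σ * c) ⟩
      + (k ℕ.* P) * w i (σ * c) + + (suc k ℕ.* P) * w i (- (σ * c)) ∎
      where
      open ≡-Reasoning
      lemma : ∀ s c a → - (- s * (c - a)) ≡ s * c - s * a
      lemma = solve-∀

    -- The two classes of each level above `i`, together with the zero residue modulo `pˢ`, make up
    -- all multiples of `M`. The sum telescopes because the classes of level `k` fill the gap
    -- between the multiples of `p ^ k` and of `p ^ suc k`.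
    deeper≈G : (∑[ i <k< suc e ] (λ k → χ k j ⊞ χ* k j) ⊞ χ (suc e) j) Q.≈ G (λ a → z M a * lev j a)
    deeper≈G = sum-telescope (λ k → χ k j ⊞ χ* k j) (λ k a → χf k a + χf* k a) (λ k a → z (p ℕ.^ k) a * lev j a) i (suc e) {χ (suc e) j}
      (s≤s i≤e)
      (λ k _ _ → G-sum {χ k j} {χ* k j} {χf k} {χf* k} (χ≈G j≤t ε-sign k) (χ*≈G j≤t ε-sign k))
      (cosetSum≈G (λ a → trans (χ-coset j≤t ε-sign (suc e) a) (cong (_* lev j a) (trans (w-top (σ * a)) (z-sign m₁ σ-IsSign a)))))
      (λ { k _ (s≤s k≤e) a → begin
        w k (σ * a) * lev j a + w k (- (σ * a)) * lev j a + z (p ℕ.^ suc k) a * lev j a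
          ≡⟨ lemma₁ (w k (σ * a)) (w k (- (σ * a))) (z (p ℕ.^ suc k) a) (lev j a) ⟩
        (w k (σ * a) + w k (- (σ * a)) + z (p ℕ.^ suc k) a) * lev j a
          ≡⟨ cong₂ (λ x y → (x + y) * lev j a) (Classes.partition k k≤e (σ * a)) (sym (z-sign (p ℕ.^ suc k) σ-IsSign a)) ⟩
        (z (p ℕ.^ k) (σ * a) - z (p ℕ.^ suc k) (σ * a) + z (p ℕ.^ suc k) (σ * a)) * lev j a
          ≡⟨ cong (_* lev j a) (trans (lemma₂ (z (p ℕ.^ k) (σ * a)) (z (p ℕ.^ suc k) (σ * a))) (z-sign (p ℕ.^ k) σ-IsSign a)) ⟩
        z (p ℕ.^ k) a * lev j a ∎ })
      where
      open ≡-Reasoning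
      lemma₁ : ∀ x y z v → x * v + y * v + z * v ≡ (x + y + z) * v
      lemma₁ = solve-∀
      lemma₂ : ∀ x y → x - y + y ≡ x
      lemma₂ = solve-∀

    -- The coefficients enter through equations, so that the quotients `(p - 3) / 4` and
    -- `φ (p ^ (s - i)) / 2` can be matched separately with their values in terms of `k`.
    product-opposite : ε ^ j′ ≡ ε ^ j → ∀ {A B} → k ℕ.* P ℕ.* N ≡ A → (1 ℕ.+ 2 ℕ.* k) ℕ.* P ℕ.* N ≡ B →
      χ i j ⊠ χ* i j′ ≈ A · (χ i j ⊞ χ* i j) ⊞ B · (∑[ i <k< suc e ] (λ k → χ k j ⊞ χ* k j) ⊞ χ (suc e) j)
    product-opposite eq refl refl = product-combination {χ i j} {χ* i j′} {χ i j ⊞ χ* i j} {∑[ i <k< suc e ] (λ k → χ k j ⊞ χ* k j) ⊞ χ (suc e) j}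
      (+ (k ℕ.* P ℕ.* N)) (+ ((1 ℕ.+ 2 ℕ.* k) ℕ.* P ℕ.* N))
      {χf i} {χf*′} {λ a → χf i a + χf* i a} {λ a → z M a * lev j a} χf*′-periodic
      (χ≈G j≤t ε-sign i) (χ*≈G j′≤t ε-sign i)
      (G-sum {χ i j} {χ* i j} {χf i} {χf* i} (χ≈G j≤t ε-sign i) (χ*≈G j≤t ε-sign i)) deeper≈G
      (λ c → begin
        (χf i ⋆⟨ n ⟩ χf*′) c
          ≡⟨ χf⋆χf*′ c ⟩
        ((λ a → w i (σ * a)) ⋆⟨ m₁ ⟩ (λ a → w i (- (ε ^ j′ * a)))) c * (lev j c * + N)
          ≡⟨ cong (_* (lev j c * + N)) (opposite-classes eq c) ⟩
        (+ (k ℕ.* P) * (w i (σ * c) + w i (- (σ * c))) + + ((1 ℕ.+ 2 ℕ.* k) ℕ.* P) * z M c) * (lev j c * + N)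
          ≡⟨ lemma (+ (k ℕ.* P)) (+ ((1 ℕ.+ 2 ℕ.* k) ℕ.* P)) (w i (σ * c)) (w i (- (σ * c))) (z M c) (lev j c) (+ N) ⟩
        (+ (k ℕ.* P) * + N) * (χf i c + χf* i c) + (+ ((1 ℕ.+ 2 ℕ.* k) ℕ.* P) * + N) * (z M c * lev j c)
          ≡⟨ cong₂ (λ x y → x * (χf i c + χf* i c) + y * (z M c * lev j c)) (pos-* (k ℕ.* P) N) (pos-* ((1 ℕ.+ 2 ℕ.* k) ℕ.* P) N) ⟨
        + (k ℕ.* P ℕ.* N) * (χf i c + χf* i c) + + ((1 ℕ.+ 2 ℕ.* k) ℕ.* P ℕ.* N) * (z M c * lev j c) ∎)
      where
      open ≡-Reasoning
      lemma : ∀ A H x y z v f → (A * (x + y) + H * z) * (v * f) ≡ (A * f) * (x * v + y * v) + (H * f) * (z * v)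
      lemma = solve-∀

    product-equal : ε ^ j′ ≡ - (ε ^ j) → ∀ {A B} → k ℕ.* P ℕ.* N ≡ A → suc k ℕ.* P ℕ.* N ≡ B →
      χ i j ⊠ χ* i j′ ≈ A · χ i j ⊞ B · χ* i j
    product-equal eq refl refl = product-combination {χ i j} {χ* i j′} {χ i j} {χ* i j}
      (+ (k ℕ.* P ℕ.* N)) (+ (suc k ℕ.* P ℕ.* N))
      {χf i} {χf*′} {χf i} {χf* i} χf*′-periodic
      (χ≈G j≤t ε-sign i) (χ*≈G j′≤t ε-sign i) (χ≈G j≤t ε-sign i) (χ*≈G j≤t ε-sign i)
      (λ c → begin
        (χf i ⋆⟨ n ⟩ χf*′) c
          ≡⟨ χf⋆χf*′ c ⟩
        ((λ a → w i (σ * a)) ⋆⟨ m₁ ⟩ (λ a → w i (- (ε ^ j′ * a)))) c * (lev j c * + N)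
          ≡⟨ cong (_* (lev j c * + N)) (equal-classes eq c) ⟩
        (+ (k ℕ.* P) * w i (σ * c) + + (suc k ℕ.* P) * w i (- (σ * c))) * (lev j c * + N)
          ≡⟨ lemma (+ (k ℕ.* P)) (+ (suc k ℕ.* P)) (w i (σ * c)) (w i (- (σ * c))) (lev j c) (+ N) ⟩
        (+ (k ℕ.* P) * + N) * χf i c + (+ (suc k ℕ.* P) * + N) * χf* i c
          ≡⟨ cong₂ (λ x y → x * χf i c + y * χf* i c) (pos-* (k ℕ.* P) N) (pos-* (suc k ℕ.* P) N) ⟨
        + (k ℕ.* P ℕ.* N) * χf i c + + (suc k ℕ.* P ℕ.* N) * χf* i c ∎)
      where
      open ≡-Reasoning
      lemma : ∀ A B x y v f → (A * x + B * y) * (v * f) ≡ (A * f) * (x * v) + (B * f) * (y * v)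
      lemma = solve-∀

-- The coefficients in terms of `k`, and signs by parity

module Coefficients where

  open import Data.Empty using (⊥-elim)
  open import Data.Integer.Base as ℤ using (-1ℤ)
  import Data.Integer.Properties as ℤ
  open import Data.Nat.Base
  open import Data.Nat.Coprimality using (Coprime)
  open import Data.Nat.Divisibility
  open import Data.Nat.DivMod using (m*n/n≡m; m≡m%n+[m/n]*n)
  open import Data.Nat.GCD using (gcd; gcd-greatest)
  open import Data.Nat.Properties
  open import Data.Product.Base using (_,_)
  open import Data.Sum.Base using (inj₁; inj₂)
  open import Relation.Binary.PropositionalEquality
  open import Relation.Nullary using (¬_)
  open Counting using (φ≡2h)
  open OddParity

  %4≡3 : ∀ p → p % 4 ≡ 3 → p ≡ 3 + 4 * (p / 4)
  %4≡3 p p%4≡3 = trans (m≡m%n+[m/n]*n p 4) (cong₂ _+_ p%4≡3 (*-comm (p / 4) 4))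

  [p∸3]/4 : ∀ {p} k → p ≡ 3 + 4 * k → (p ∸ 3) / 4 ≡ k
  [p∸3]/4 k refl = trans (cong (_/ 4) (*-comm 4 k)) (m*n/n≡m k 4)

  [p+1]/4 : ∀ {p} k → p ≡ 3 + 4 * k → (p + 1) / 4 ≡ suc k
  [p+1]/4 k refl = trans (cong (_/ 4) (trans (+-comm (3 + 4 * k) 1) (cong (_+_ 4) (*-comm 4 k)))) (m*n/n≡m (suc k) 4)

  φ/2 : ∀ {p} k e → Prime p → p ≡ 3 + 4 * k → φ (p ^ suc e) / 2 ≡ (1 + 2 * k) * p ^ e
  φ/2 {p} k e p-prime p≡3+4k = trans
    (cong (_/ 2) (trans (φ≡2h k e p-prime p≡3+4k) (*-comm 2 ((1 + 2 * k) * p ^ e))))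
    (m*n/n≡m ((1 + 2 * k) * p ^ e) 2)

  -- A common divisor of `h` and `f` divides 2, and 2 does not divide the odd `h`.
  Odd-coprime : ∀ {h f} → Odd h → gcd (2 * h) f ≡ 2 → Coprime h f
  Odd-coprime {h} {f} h-odd gcd≡2 {d} (d∣h , d∣f)
    with prime⇒irreducible prime[2] (subst (d ∣_) gcd≡2 (gcd-greatest (∣n⇒∣m*n 2 d∣h) d∣f))
  ... | inj₁ d≡1 = d≡1
  ... | inj₂ d≡2 = ⊥-elim (Odd⇒2∤ h-odd (subst (_∣ h) d≡2 d∣h))

  -1^-split : ∀ {j j′} → j ≤ j′ → -1ℤ ℤ.^ j′ ≡ -1ℤ ℤ.^ j ℤ.* -1ℤ ℤ.^ (j′ ∸ j)
  -1^-split {j} {j′} j≤j′ = trans (cong (-1ℤ ℤ.^_) (sym (m+[n∸m]≡n j≤j′))) (ℤ.^-distribˡ-+-* -1ℤ j (j′ ∸ j))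

  -1^-same : ∀ {j j′} → j ≤ j′ → 2 ∣ j′ ∸ j → -1ℤ ℤ.^ j′ ≡ -1ℤ ℤ.^ j
  -1^-same {j} {j′} j≤j′ (divides x eq) = trans (-1^-split j≤j′) (trans
    (cong (-1ℤ ℤ.^ j ℤ.*_) (trans (cong (-1ℤ ℤ.^_) (trans eq (*-comm x 2))) (-1^even x)))
    (ℤ.*-identityʳ (-1ℤ ℤ.^ j)))

  -1^-flip : ∀ {j j′} → j ≤ j′ → ¬ 2 ∣ j′ ∸ j → -1ℤ ℤ.^ j′ ≡ ℤ.- (-1ℤ ℤ.^ j)
  -1^-flip {j} {j′} j≤j′ 2∤d with even-or-odd (j′ ∸ j)
  ... | inj₁ (x , d≡2x) = ⊥-elim (2∤d (subst (2 ∣_) (sym d≡2x) (m∣m*n x)))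
  ... | inj₂ d-odd = trans (-1^-split j≤j′) (trans (cong (-1ℤ ℤ.^ j ℤ.*_) (-1^odd d-odd))
    (trans (ℤ.*-comm (-1ℤ ℤ.^ j) -1ℤ) (ℤ.-1*i≡-i (-1ℤ ℤ.^ j))))

-- The three cases of the theorem

open import Data.Integer.Base using (ℤ; +_)
open import Data.Nat.Base using (ℕ; suc; _+_; _*_; _∸_; _^_; _≤_; _<_; _/_; _%_)
open import Data.Nat.Divisibility using (_∣_)
open import Data.Nat.GCD using (gcd)
open import Data.Nat.Primality using (Prime)
open import Data.Product.Base using (_×_; _,_)
open import Relation.Binary.PropositionalEquality using (_≡_; _≢_)
open import Relation.Nullary using (¬_)

theorem4p10 : (s t p q l : ℕ) (g : ℤ) →
    1 ≤ s → 1 ≤ t →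
    Prime p → Prime q → Prime l → p ≢ q → p ≢ l → q ≢ l →
    ¬ (2 ∣ p) → ¬ (2 ∣ q) → p % 4 ≡ 3 →
    IsOrder (p ^ s) (+ l) (φ (p ^ s) / 2) →
    IsOrder (q ^ t) (+ l) (φ (q ^ t)) →
    gcd (φ (p ^ s)) (φ (q ^ t)) ≡ 2 →
    PrimitiveRoot (p ^ s) g → PrimitiveRoot (q ^ t) g →
    (i j j' : ℕ) → i ≤ s ∸ 1 → j < j' → j' ≤ t →
    let open CosetSums p q s t l g in
    (QuadraticResidue q p →
    χ i j ⊠ χ* i j' ≈
    ((p ∸ 3) / 4 * p ^ (s ∸ i ∸ 1) * φ (q ^ (t ∸ j'))) · (χ i j ⊞ χ* i j)
    ⊞ (φ (p ^ (s ∸ i)) / 2 * φ (q ^ (t ∸ j'))) · (∑[ i <k< s ] (λ k → χ k j ⊞ χ* k j) ⊞ χ s j))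
    ×
    (QuadraticNonresidue q p → ¬ (2 ∣ j' ∸ j) →
    χ i j ⊠ χ* i j' ≈
    ((p ∸ 3) / 4 * p ^ (s ∸ i ∸ 1) * φ (q ^ (t ∸ j'))) · χ i j
    ⊞ ((p + 1) / 4 * p ^ (s ∸ i ∸ 1) * φ (q ^ (t ∸ j'))) · χ* i j)
    ×
    (QuadraticNonresidue q p → 2 ∣ j' ∸ j →
    χ i j ⊠ χ* i j' ≈
    ((p ∸ 3) / 4 * p ^ (s ∸ i ∸ 1) * φ (q ^ (t ∸ j'))) · (χ i j ⊞ χ* i j)
    ⊞ (φ (p ^ (s ∸ i)) / 2 * φ (q ^ (t ∸ j'))) · (∑[ i <k< s ] (λ k → χ k j ⊞ χ* k j) ⊞ χ s j))
theorem4p10 (suc e) t p q l g _ _ p-prime q-prime _ p≢q _ _ _ _ p%4≡3 l-order-p l-order-q gcd≡2 g-order-p g-order-q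
            i j j' i≤e j<j' j'≤t =
    -- A residue `q` has `ε = 1`, so all its powers agree. A nonresidue has `ε = -1`, and the parity
    -- of `j' ∸ j` decides whether `(-1) ^ j'` equals `(-1) ^ j` or its negative.
    (λ r → Products.product-opposite i j j' i≤e j<j' j'≤t (quadraticResidue⇒HasSign r)
      (trans (ℤ.^-zeroˡ j') (sym (ℤ.^-zeroˡ j))) coefficient₁ coefficient₃)
  , (λ r 2∤d → Products.product-equal i j j' i≤e j<j' j'≤t (quadraticNonresidue⇒HasSign r)
      (-1^-flip (ℕ.<⇒≤ j<j') 2∤d) coefficient₁ coefficient₂)
  , (λ r 2∣d → Products.product-opposite i j j' i≤e j<j' j'≤t (quadraticNonresidue⇒HasSign r)
      (-1^-same (ℕ.<⇒≤ j<j') 2∣d) coefficient₁ coefficient₃)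
  where
  open import Data.Integer.Base as ℤ using ()
  import Data.Integer.Properties as ℤ
  import Data.Nat.Properties as ℕ
  open import Relation.Binary.PropositionalEquality using (sym; trans; cong; cong₂; subst)
  open Coefficients
  open Counting using (φ≡2h)

  k : ℕ
  k = p / 4

  p≡3+4k : p ≡ 3 + 4 * k
  p≡3+4k = %4≡3 p p%4≡3

  l-order : IsOrder (p ^ suc e) (+ l) ((1 + 2 * k) * p ^ e)
  l-order = subst (IsOrder (p ^ suc e) (+ l)) (φ/2 k e p-prime p≡3+4k) l-order-p

  open HalfOrder p k e l p-prime p≡3+4k l-order
    using (h-odd; quadraticResidue⇒HasSign; quadraticNonresidue⇒HasSign)

  open CosetProducts e k t p q l g p-prime q-prime p≢q p≡3+4k l-order l-order-q
    (Odd-coprime h-odd (trans (cong (λ m → gcd m (φ (q ^ t))) (sym (φ≡2h k e p-prime p≡3+4k))) gcd≡2))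
    g-order-p g-order-q
    using (module Products)

  s∸i : suc e ∸ i ≡ suc (e ∸ i)
  s∸i = ℕ.+-∸-assoc 1 i≤e

  coefficient₁ : k * p ^ (e ∸ i) * φ (q ^ (t ∸ j')) ≡ (p ∸ 3) / 4 * p ^ (suc e ∸ i ∸ 1) * φ (q ^ (t ∸ j'))
  coefficient₁ = cong (_* φ (q ^ (t ∸ j'))) (cong₂ (λ x y → x * p ^ y) (sym ([p∸3]/4 k p≡3+4k)) (cong (_∸ 1) (sym s∸i)))

  coefficient₂ : suc k * p ^ (e ∸ i) * φ (q ^ (t ∸ j')) ≡ (p + 1) / 4 * p ^ (suc e ∸ i ∸ 1) * φ (q ^ (t ∸ j'))
  coefficient₂ = cong (_* φ (q ^ (t ∸ j'))) (cong₂ (λ x y → x * p ^ y) (sym ([p+1]/4 k p≡3+4k)) (cong (_∸ 1) (sym s∸i)))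

  coefficient₃ : (1 + 2 * k) * p ^ (e ∸ i) * φ (q ^ (t ∸ j')) ≡ φ (p ^ (suc e ∸ i)) / 2 * φ (q ^ (t ∸ j'))
  coefficient₃ = cong (_* φ (q ^ (t ∸ j'))) (sym (trans (cong (λ x → φ (p ^ x) / 2) s∸i) (φ/2 k (e ∸ i) p-prime p≡3+4k)))
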